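{- There is a universal constant $c>0$ such that the following holds. For every sufficiently large $n$, every $t\geq 1$ and every word size $w\geq 7\log_2 n$, every array $A\in\{0,1\}^n$ can be preprocessed into a data structure in the cell-probe model with word size $w$ that occupies \[ n+\left\lceil \frac{n}{w^{ct}}\right\rceil \] bits of memory and answers every rank query $\mathrm{rank}(u)=\sum_{i=0}^{u-1}A[i]$, $0\le u\le n$, using $O(t)$ cell probes. Here the constant hidden in $O(t)$ is universal.
   Context: Cell-probe model with word size $w$: memory is an array of cells of $w$ bits each. A query algorithm may probe (read) cells adaptively, choosing each probe as an arbitrary function of the query and the contents of the cells read so far; arbitrary computation is free (equivalently, arbitrary operations on $O(w)$-bit words cost nothing). The query time is the number of cells probed. -}

module Defs where

open import Data.Nat using (ℕ; zero; suc; _+_; _*_; _<?_)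
open import Data.Bool using (Bool; true; false)
open import Data.Vec using (Vec; []; _∷_; lookup; tabulate)
open import Data.Fin using (Fin; fromℕ<)
open import Relation.Nullary using (yes; no)
open import Relation.Binary.PropositionalEquality using (_≡_)

rank : ∀ {n} → Vec Bool n → ℕ → ℕ
rank [] u = 0
rank (b ∷ A) zero = 0
rank (true ∷ A) (suc u) = suc (rank A u)
rank (false ∷ A) (suc u) = rank A u

bitAt : ∀ {s} → Vec Bool s → ℕ → Bool
bitAt {s} M i with i <? s
... | yes i<s = lookup M (fromℕ< i<s)
... | no _ = false

-- Cell j of a memory of s bits with word size w: bits j*w .. j*w+w-1
-- (the last cell may be partially filled; cells beyond the memory read as all zeros).
cell : ∀ {s} (w : ℕ) → Vec Bool s → ℕ → Vec Bool w
cell w M j = tabulate (λ (i : Fin w) → bitAt M (j * w + Data.Fin.toℕ i))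

-- An adaptive cell-probe query algorithm with word size w, returning an
-- answer in R, making at most d probes.  Each probe chooses a cell index
-- (arbitrary function of the query and what was read so far) and continues
-- as an arbitrary function of the w-bit contents read.
data Probe (w : ℕ) (R : Set) : ℕ → Set where
  ret   : ∀ {d} → R → Probe w R d
  probe : ∀ {d} → ℕ → (Vec Bool w → Probe w R d) → Probe w R (suc d)

run : ∀ {w R d s} → Probe w R d → Vec Bool s → R
run (ret r) M = r
run {w} (probe j k) M = run (k (cell w M j)) M

record RankDS (n w s q : ℕ) : Set where
  field
    preprocess : Vec Bool n → Vec Bool s
    query      : Fin (suc n) → Probe w ℕ q
    correct    : ∀ (A : Vec Bool n) (u : Fin (suc n)) →
                 run (query u) (preprocess A) ≡ rank A (Data.Fin.toℕ u)

{-# OPTIONS --safe #-}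
module Submission where

-- A tree of degree about √w is built over the array.  A subtree on m bits is stored as a state of O(w) bits,
-- which determines its number of ones, and m - O(w) bits of memory; a node has to store the states of its
-- children so that each state, and the number of ones to its left, is found with O(1) probes, and this must waste
-- only a factor 1 + 2^-Ω(w).  The labels have binomial distributions, which are smooth, so the prefix sums of the
-- labels are almost independent once they are known up to blocks slightly smaller than the standard deviation.
-- Exactly: a tuple of states is a point under the graph of a product of smooth functions of consecutive prefix
-- sums, and a protocol that refines the blocks of two neighbouring prefix sums by one bit whenever a point lies
-- too close to the graph splits almost all of this region into boxes with short descriptions.  In a box the
-- coordinates are independent, and they are packed into words of memory with random access.  The points for
-- which the protocol runs long, and those with two children in exceptional states, are so rare that they may be
-- stored wastefully.  A tree of height O(t) covers blocks of w^t bits; for longer arrays the prefix sums at the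
-- blocks are stored explicitly.

open import Defs
open import Data.Nat using (ℕ; zero; suc; pred; _+_; _*_; _∸_; _^_; _≤_; _<_; z≤n; s≤s; _≡ᵇ_; _<ᵇ_; _<?_; _≤?_; ⌊_/2⌋; NonZero; >-nonZero; >-nonZero⁻¹; _⊓_; ∣_-_∣)
open import Data.Nat.Properties
open import Data.Nat.DivMod using (_/_; _%_; m≡m%n+[m/n]*n; m%n<n; m/n*n≤m; /-monoˡ-≤; m<n⇒m%n≡m; [m+kn]%n≡m%n; +-distrib-/; m*n/n≡m; m<n⇒m/n≡0; m*n%n≡0; m≥n⇒m/n>0)
open import Data.Nat.Tactic.RingSolver using (solve-∀)
open import Data.Bool using (Bool; true; false; if_then_else_; not; _∧_; T)
open import Data.List using (List; []; _∷_; _++_; map; concatMap; length; downFrom; drop)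
open import Data.List.Properties using (length-map; length-++; length-downFrom; length-drop)
open import Data.List.Membership.Propositional using (_∈_)
open import Data.List.Membership.Propositional.Properties using (∈-map⁺; ∈-map⁻; ∈-++⁺ˡ; ∈-++⁺ʳ; ∈-++⁻; ∈-downFrom⁺; ∈-downFrom⁻)
open import Data.List.Relation.Unary.Any using (here; there)
open import Data.Product using (Σ; _×_; _,_; proj₁; proj₂; ∃)
open import Data.Sum using (_⊎_; inj₁; inj₂)
open import Data.Empty using (⊥; ⊥-elim)
open import Data.Unit using (⊤; tt)
open import Data.Vec using (Vec; []; _∷_; lookup; tabulate)
open import Data.Fin using (Fin; fromℕ<; toℕ)
import Data.Fin.Properties as FinP
import Data.Vec.Properties as VecP
open import Function using (_∘_)
open import Relation.Nullary using (Dec; yes; no)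
open import Relation.Binary.PropositionalEquality using (_≡_; _≢_; refl; sym; trans; cong; cong₂; subst; subst₂; module ≡-Reasoning)

-- Sums, products and shifts

-- The waste allowed per node is a factor 1 + `1 / D` with `D` = 2^(20 w). The obstacle is a circle:
-- the states a child wastes, and those lost in making its distribution smooth, reappear at the
-- parent as exceptional states, whose share is bounded only by 2^(-18 w), more than `1 / D`. So a
-- tuple with one exceptional child must still be packed tightly. Two such children save 2 * 16 w =
-- 32 w bits, enough to pay for a wasteful format. The same 32 w limits the refinements: a child
-- refined e times has its index confined to a window smaller by the factor 2^e. Each box is a key
-- kept in the state, and packing it adds an error of up to 2^(4 w - a) of the whole space, whatever
-- its volume. Hence the boxes must number far fewer than 2^a: there are at most 2^(102 w), of which
-- 2^(96 w) come from the refinements, and a ≥ 150 w suffices. A block is described relative to the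
-- preceding one by O(log w) bits; the degree is about √w so that these bits, for all children
-- together, stay below w. Over a tree on fewer than 2^w bits the wasted factors multiply to at most
-- 2, hence one extra bit per tree.

≤-add : ∀ {m n} k → n ≡ m + k → m ≤ n
≤-add {m} k refl = m≤m+n m k

true≢false : true ≢ false
true≢false ()

≡ᵇ-self : ∀ n → (n ≡ᵇ n) ≡ true
≡ᵇ-self zero = refl
≡ᵇ-self (suc n) = ≡ᵇ-self n

≡ᵇ-true⇒≡ : ∀ {m n} → (m ≡ᵇ n) ≡ true → m ≡ n
≡ᵇ-true⇒≡ {m} {n} h = ≡ᵇ⇒≡ m n (subst T (sym h) tt)

≡ᵇ-false : ∀ {m n} → m ≢ n → (m ≡ᵇ n) ≡ false
≡ᵇ-false {m} {n} h with m ≡ᵇ n in eq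
... | true = ⊥-elim (h (≡ᵇ-true⇒≡ eq))
... | false = refl

<⇒<ᵇ-true : ∀ {m n} → m < n → (m <ᵇ n) ≡ true
<⇒<ᵇ-true {m} {n} h with m <ᵇ n in eq
... | true = refl
... | false = ⊥-elim (subst T eq (<⇒<ᵇ h))

<ᵇ-true⇒< : ∀ {m n} → (m <ᵇ n) ≡ true → m < n
<ᵇ-true⇒< {m} {n} h = <ᵇ⇒< m n (subst T (sym h) tt)

<ᵇ-false⇒≥ : ∀ {m n} → (m <ᵇ n) ≡ false → n ≤ m
<ᵇ-false⇒≥ h = ≮⇒≥ λ lt → true≢false (trans (sym (<⇒<ᵇ-true lt)) h)

stepwise-mono : ∀ (y : ℕ → ℕ) → (∀ i → y i ≤ y (suc i)) → ∀ {i k} → i ≤ k → y i ≤ y k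
stepwise-mono y h {i} {k} i≤k with m≤n⇒m<n∨m≡n i≤k
... | inj₂ refl = ≤-refl
stepwise-mono y h {i} {suc k} _ | inj₁ (s≤s i≤k) = ≤-trans (stepwise-mono y h i≤k) (h k)

sumOf : ∀ {A : Set} → (A → ℕ) → List A → ℕ
sumOf f [] = 0
sumOf f (x ∷ xs) = f x + sumOf f xs

sumTo : (ℕ → ℕ) → ℕ → ℕ
sumTo f n = sumOf f (downFrom n)

prodTo : (ℕ → ℕ) → ℕ → ℕ
prodTo f zero = 1
prodTo f (suc n) = prodTo f n * f n

prodFrom : (ℕ → ℕ) → ℕ → ℕ → ℕ
prodFrom f i zero = 1
prodFrom f i (suc r) = f i * prodFrom f (suc i) r

prodFrom-snoc : ∀ f i r → prodFrom f i (suc r) ≡ prodFrom f i r * f (i + r)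
prodFrom-snoc f i zero rewrite +-identityʳ i = *-comm (f i) 1
prodFrom-snoc f i (suc r) rewrite prodFrom-snoc f (suc i) r | +-suc i r =
  sym (*-assoc (f i) (prodFrom f (suc i) r) (f (suc (i + r))))

prodFrom-prodTo : ∀ f r → prodFrom f 0 r ≡ prodTo f r
prodFrom-prodTo f zero = refl
prodFrom-prodTo f (suc r) = trans (prodFrom-snoc f 0 r) (cong (_* f r) (prodFrom-prodTo f r))

sumTo-mono : ∀ {f g : ℕ → ℕ} n → (∀ i → i < n → f i ≤ g i) → sumTo f n ≤ sumTo g n
sumTo-mono zero h = z≤n
sumTo-mono (suc n) h = +-mono-≤ (h n ≤-refl) (sumTo-mono n λ i i<n → h i (m≤n⇒m≤1+n i<n))

sumTo-cong : ∀ {f g : ℕ → ℕ} n → (∀ i → i < n → f i ≡ g i) → sumTo f n ≡ sumTo g n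
sumTo-cong zero h = refl
sumTo-cong (suc n) h = cong₂ _+_ (h n ≤-refl) (sumTo-cong n λ i i<n → h i (m≤n⇒m≤1+n i<n))

prodTo-mono : ∀ {f g : ℕ → ℕ} n → (∀ i → i < n → f i ≤ g i) → prodTo f n ≤ prodTo g n
prodTo-mono zero h = ≤-refl
prodTo-mono (suc n) h = *-mono-≤ (prodTo-mono n λ i i<n → h i (m≤n⇒m≤1+n i<n)) (h n ≤-refl)

prodTo-cong : ∀ {f g : ℕ → ℕ} n → (∀ i → i < n → f i ≡ g i) → prodTo f n ≡ prodTo g n
prodTo-cong zero h = refl
prodTo-cong (suc n) h = cong₂ _*_ (prodTo-cong n λ i i< → h i (m≤n⇒m≤1+n i<)) (h n ≤-refl)

prodTo-zero : ∀ n → 1 ≤ n → prodTo (λ _ → 0) n ≡ 0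
prodTo-zero (suc n) _ = *-zeroʳ (prodTo (λ _ → 0) n)

prodTo-const : ∀ c n → prodTo (λ _ → c) n ≡ c ^ n
prodTo-const c zero = refl
prodTo-const c (suc n) rewrite prodTo-const c n = *-comm (c ^ n) c

prodTo-* : ∀ f g n → prodTo (λ i → f i * g i) n ≡ prodTo f n * prodTo g n
prodTo-* f g zero = refl
prodTo-* f g (suc n) rewrite prodTo-* f g n = lem (prodTo f n) (prodTo g n) (f n) (g n)
  where
  lem : ∀ a b c d → a * b * (c * d) ≡ a * c * (b * d)
  lem = solve-∀

sumTo-pow : ∀ c f n → prodTo (λ i → c ^ f i) n ≡ c ^ sumTo f n
sumTo-pow c f zero = refl
sumTo-pow c f (suc n) rewrite sumTo-pow c f n =
  trans (*-comm (c ^ sumTo f n) (c ^ f n)) (sym (^-distribˡ-+-* c (f n) (sumTo f n)))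

sumTo-left : ∀ f n → sumTo f (suc n) ≡ f 0 + sumTo (f ∘ suc) n
sumTo-left f zero = refl
sumTo-left f (suc n) rewrite sumTo-left f n = lem (f (suc n)) (f 0) (sumTo (f ∘ suc) n)
  where
  lem : ∀ a b c → a + (b + c) ≡ b + (a + c)
  lem = solve-∀

sumTo-+ : ∀ f m n → sumTo f (m + n) ≡ sumTo f m + sumTo (λ i → f (m + i)) n
sumTo-+ f m zero rewrite +-identityʳ m | +-identityʳ (sumTo f m) = refl
sumTo-+ f m (suc n) rewrite +-suc m n | sumTo-+ f m n =
  lem (f (m + n)) (sumTo f m) (sumTo (λ i → f (m + i)) n)
  where
  lem : ∀ a b c → a + (b + c) ≡ b + (a + c)
  lem = solve-∀

module _ {A : Set} where

  sumOf-mono : ∀ {f g : A → ℕ} xs → (∀ x → x ∈ xs → f x ≤ g x) → sumOf f xs ≤ sumOf g xs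
  sumOf-mono [] h = z≤n
  sumOf-mono (x ∷ xs) h = +-mono-≤ (h x (here refl)) (sumOf-mono xs λ y y∈ → h y (there y∈))

  sumOf-cong : ∀ {f g : A → ℕ} xs → (∀ x → f x ≡ g x) → sumOf f xs ≡ sumOf g xs
  sumOf-cong [] h = refl
  sumOf-cong (x ∷ xs) h = cong₂ _+_ (h x) (sumOf-cong xs h)

  sumOf-++ : ∀ (f : A → ℕ) xs ys → sumOf f (xs ++ ys) ≡ sumOf f xs + sumOf f ys
  sumOf-++ f [] ys = refl
  sumOf-++ f (x ∷ xs) ys rewrite sumOf-++ f xs ys = sym (+-assoc (f x) (sumOf f xs) (sumOf f ys))

  sumOf-add : ∀ (f g : A → ℕ) xs → sumOf (λ x → f x + g x) xs ≡ sumOf f xs + sumOf g xs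
  sumOf-add f g [] = refl
  sumOf-add f g (x ∷ xs) rewrite sumOf-add f g xs = lem (f x) (g x) (sumOf f xs) (sumOf g xs)
    where
    lem : ∀ a b c d → a + b + (c + d) ≡ a + c + (b + d)
    lem = solve-∀

  sumOf-*ˡ : ∀ c (f : A → ℕ) xs → sumOf (λ x → c * f x) xs ≡ c * sumOf f xs
  sumOf-*ˡ c f [] = sym (*-zeroʳ c)
  sumOf-*ˡ c f (x ∷ xs) rewrite sumOf-*ˡ c f xs = sym (*-distribˡ-+ c (f x) (sumOf f xs))

  sumOf-*ʳ : ∀ c (f : A → ℕ) xs → sumOf (λ x → f x * c) xs ≡ sumOf f xs * c
  sumOf-*ʳ c f [] = refl
  sumOf-*ʳ c f (x ∷ xs) rewrite sumOf-*ʳ c f xs = sym (*-distribʳ-+ c (f x) (sumOf f xs))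

  sumOf-const : ∀ c (xs : List A) → sumOf (λ _ → c) xs ≡ length xs * c
  sumOf-const c [] = refl
  sumOf-const c (x ∷ xs) = cong (c +_) (sumOf-const c xs)

  sumOf-≤ : ∀ {f : A → ℕ} c xs → (∀ x → x ∈ xs → f x ≤ c) → sumOf f xs ≤ length xs * c
  sumOf-≤ c xs h = ≤-trans (sumOf-mono xs h) (≤-reflexive (sumOf-const c xs))

  sumOf-map : ∀ {B : Set} (f : A → ℕ) (h : B → A) xs → sumOf f (map h xs) ≡ sumOf (f ∘ h) xs
  sumOf-map f h [] = refl
  sumOf-map f h (x ∷ xs) = cong (f (h x) +_) (sumOf-map f h xs)

  sumOf-concatMap : ∀ {B : Set} (f : A → ℕ) (h : B → List A) xs →
    sumOf f (concatMap h xs) ≡ sumOf (λ x → sumOf f (h x)) xs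
  sumOf-concatMap f h [] = refl
  sumOf-concatMap f h (x ∷ xs) rewrite sumOf-++ f (h x) (concatMap h xs) | sumOf-concatMap f h xs = refl

  length-concatMap : ∀ {B : Set} (h : B → List A) xs → length (concatMap h xs) ≡ sumOf (length ∘ h) xs
  length-concatMap h [] = refl
  length-concatMap h (x ∷ xs) rewrite length-++ (h x) {concatMap h xs} | length-concatMap h xs = refl

  ∈-concatMap : ∀ {B : Set} (h : B → List A) {xs x y} → x ∈ xs → y ∈ h x → y ∈ concatMap h xs
  ∈-concatMap h (here refl) q = ∈-++⁺ˡ q
  ∈-concatMap h {x ∷ xs} (there p) q = ∈-++⁺ʳ (h x) (∈-concatMap h p q)

  ∈-concatMap⁻ : ∀ {B : Set} (h : B → List A) xs {y} → y ∈ concatMap h xs → ∃ λ x → x ∈ xs × y ∈ h x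
  ∈-concatMap⁻ h (x ∷ xs) p with ∈-++⁻ (h x) p
  ... | inj₁ q = x , here refl , q
  ... | inj₂ q with ∈-concatMap⁻ h xs q
  ...   | z , z∈ , y∈ = z , there z∈ , y∈

  -- Out-of-range positions yield the default value.
  nth : A → List A → ℕ → A
  nth z [] i = z
  nth z (x ∷ xs) zero = x
  nth z (x ∷ xs) (suc i) = nth z xs i

  ∈⇒nth : ∀ (z : A) {xs x} → x ∈ xs → ∃ λ i → i < length xs × nth z xs i ≡ x
  ∈⇒nth z (here refl) = 0 , s≤s z≤n , refl
  ∈⇒nth z (there p) with ∈⇒nth z p
  ... | i , i< , eq = suc i , s≤s i< , eq

  nth-drop : ∀ (z : A) k xs i → nth z (drop k xs) i ≡ nth z xs (k + i)
  nth-drop z zero xs i = refl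
  nth-drop z (suc k) [] i = refl
  nth-drop z (suc k) (x ∷ xs) i = nth-drop z k xs i

  nth-∈ : ∀ (z : A) xs {i} → i < length xs → nth z xs i ∈ xs
  nth-∈ z (x ∷ xs) {zero} _ = here refl
  nth-∈ z (x ∷ xs) {suc i} (s≤s p) = there (nth-∈ z xs p)

sumOf-swap : ∀ {A B : Set} (f : A → B → ℕ) xs ys →
  sumOf (λ x → sumOf (f x) ys) xs ≡ sumOf (λ y → sumOf (λ x → f x y) xs) ys
sumOf-swap f [] ys = sym (trans (sumOf-const 0 ys) (*-zeroʳ (length ys)))
sumOf-swap f (x ∷ xs) ys rewrite sumOf-swap f xs ys =
  sym (sumOf-add (f x) (λ y → sumOf (λ x → f x y) xs) ys)

length-concatMap-≤ : ∀ {A B : Set} (h : B → List A) xs c → (∀ x → length (h x) ≤ c) →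
  length (concatMap h xs) ≤ length xs * c
length-concatMap-≤ h xs c p rewrite length-concatMap h xs = sumOf-≤ c xs λ x _ → p x

bit : Bool → ℕ
bit true = 1
bit false = 0

2^>0 : ∀ n → 0 < 2 ^ n
2^>0 n = >-nonZero⁻¹ (2 ^ n) {{m^n≢0 2 n}}

2^-mono : ∀ {m n} → m ≤ n → 2 ^ m ≤ 2 ^ n
2^-mono = ^-monoʳ-≤ 2

2^-+ : ∀ m n → 2 ^ (m + n) ≡ 2 ^ m * 2 ^ n
2^-+ = ^-distribˡ-+-* 2

2^-suc : ∀ n → 2 ^ suc n ≡ 2 ^ n + 2 ^ n
2^-suc n = cong (2 ^ n +_) (+-identityʳ (2 ^ n))

2^+2^≤ : ∀ {a b m n} → a ≤ 2 ^ m → b ≤ 2 ^ n → m ≤ n → a + b ≤ 2 ^ suc n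
2^+2^≤ {n = n} p q r = ≤-trans (+-mono-≤ (≤-trans p (2^-mono r)) q) (≤-reflexive (sym (2^-suc n)))

2^*2^≤ : ∀ {a b} m n {k} → a ≤ 2 ^ m → b ≤ 2 ^ n → m + n ≤ k → a * b ≤ 2 ^ k
2^*2^≤ m n p q r = ≤-trans (*-mono-≤ p q) (≤-trans (≤-reflexive (sym (2^-+ m n))) (2^-mono r))

n<2^n : ∀ n → n < 2 ^ n
n<2^n zero = s≤s z≤n
n<2^n (suc n) = ≤-trans (+-mono-≤ (2^>0 n) (n<2^n n)) (≤-reflexive (sym (2^-suc n)))

parity : ∀ n → n ≡ 2 * ⌊ n /2⌋ ⊎ n ≡ suc (2 * ⌊ n /2⌋)
parity zero = inj₁ refl
parity (suc zero) = inj₂ refl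
parity (suc (suc n)) with parity n
... | inj₁ e = inj₁ (trans (cong (suc ∘ suc) e) (sym (*-suc 2 ⌊ n /2⌋)))
... | inj₂ e = inj₂ (cong suc (trans (cong suc e) (sym (*-suc 2 ⌊ n /2⌋))))

half-double : ∀ n → ⌊ 2 * n /2⌋ ≡ n
half-double zero = refl
half-double (suc n) rewrite +-suc n (n + 0) = cong suc (half-double n)

half-double+1 : ∀ n → ⌊ suc (2 * n) /2⌋ ≡ n
half-double+1 zero = refl
half-double+1 (suc n) rewrite +-suc n (n + 0) = cong suc (half-double+1 n)

sh : ℕ → ℕ → ℕ
sh zero y = y
sh (suc e) y = ⌊ sh e y /2⌋

sh-decomp : ∀ e y → ∃ λ l → l < 2 ^ e × y ≡ sh e y * 2 ^ e + l
sh-decomp zero y = 0 , s≤s z≤n , sym (trans (+-identityʳ (y * 1)) (*-identityʳ y))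
sh-decomp (suc e) y with sh-decomp e y | parity (sh e y)
... | l , l< , eq | inj₁ p = l , <-≤-trans l< (m≤m+n (2 ^ e) _) ,
      trans eq (cong (_+ l) (trans (cong (_* 2 ^ e) p) (lem ⌊ sh e y /2⌋ (2 ^ e))))
  where
  lem : ∀ h p → 2 * h * p ≡ h * (2 * p)
  lem = solve-∀
... | l , l< , eq | inj₂ p = 2 ^ e + l , subst (2 ^ e + l <_) (sym (2^-suc e)) (+-monoʳ-< (2 ^ e) l<) ,
      trans eq (trans (cong (λ s → s * 2 ^ e + l) p) (lem ⌊ sh e y /2⌋ (2 ^ e) l))
  where
  lem : ∀ h p l → suc (2 * h) * p + l ≡ h * (2 * p) + (p + l)
  lem = solve-∀

sh-lower : ∀ e y → sh e y * 2 ^ e ≤ y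
sh-lower e y with sh-decomp e y
... | l , _ , eq = subst (sh e y * 2 ^ e ≤_) (sym eq) (m≤m+n _ l)

sh-upper : ∀ e y → y < sh e y * 2 ^ e + 2 ^ e
sh-upper e y with sh-decomp e y
... | l , l< , eq = subst (_< sh e y * 2 ^ e + 2 ^ e) (sym eq) (+-monoʳ-< (sh e y * 2 ^ e) l<)

sh-≥ : ∀ e y q → q * 2 ^ e ≤ y → q ≤ sh e y
sh-≥ e y q h with q ≤? sh e y
... | yes p = p
... | no p = ⊥-elim (<⇒≱ (sh-upper e y) (≤-trans (≤-trans (≤-reflexive (+-comm (sh e y * 2 ^ e) (2 ^ e))) (*-monoˡ-≤ (2 ^ e) (≰⇒> p))) h))

sh-< : ∀ e y q → y < q * 2 ^ e → sh e y < q
sh-< e y q h with suc (sh e y) ≤? q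
... | yes p = p
... | no p = ⊥-elim (<⇒≱ h (≤-trans (*-monoˡ-≤ (2 ^ e) (≤-pred (≰⇒> p))) (sh-lower e y)))

sh-unique : ∀ e q l → l < 2 ^ e → sh e (q * 2 ^ e + l) ≡ q
sh-unique e q l l< = ≤-antisym
  (≤-pred (sh-< e _ (suc q) (subst (q * 2 ^ e + l <_) (+-comm (q * 2 ^ e) (2 ^ e)) (+-monoʳ-< (q * 2 ^ e) l<))))
  (sh-≥ e _ q (m≤m+n _ l))

sh-mono : ∀ e {x y} → x ≤ y → sh e x ≤ sh e y
sh-mono e {x} {y} h = sh-≥ e y (sh e x) (≤-trans (sh-lower e x) h)

sh-≤ : ∀ e y → sh e y ≤ y
sh-≤ e y = ≤-trans (m≤m*n (sh e y) (2 ^ e) {{m^n≢0 2 e}}) (sh-lower e y)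

sh-pow : ∀ e k y → y ≤ 2 ^ (k + e) → sh e y ≤ 2 ^ k
sh-pow e k y h with sh e y ≤? 2 ^ k
... | yes p = p
... | no p = ⊥-elim (<⇒≱ (<-≤-trans (≤-<-trans h lt) (sh-lower e y)) ≤-refl)
  where
  lt : 2 ^ (k + e) < sh e y * 2 ^ e
  lt = <-≤-trans (≤-<-trans (≤-reflexive (2^-+ k e)) (*-monoˡ-< (2 ^ e) {{m^n≢0 2 e}} (n<1+n (2 ^ k))))
         (*-monoˡ-≤ (2 ^ e) (≰⇒> p))

sh-+ : ∀ e x y → sh e (x + y) ≤ suc (sh e x + sh e y)
sh-+ e x y = ≤-pred (sh-< e (x + y) (2 + (sh e x + sh e y))
  (<-≤-trans (+-mono-<-≤ (sh-upper e x) (<⇒≤ (sh-upper e y))) (≤-reflexive (lem (sh e x) (sh e y) (2 ^ e)))))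
  where
  lem : ∀ a b p → (a * p + p) + (b * p + p) ≡ (2 + (a + b)) * p
  lem = solve-∀

sh-+-≥ : ∀ e x y → sh e x + sh e y ≤ sh e (x + y)
sh-+-≥ e x y = sh-≥ e (x + y) (sh e x + sh e y)
  (subst (_≤ x + y) (sym (*-distribʳ-+ (2 ^ e) (sh e x) (sh e y))) (+-mono-≤ (sh-lower e x) (sh-lower e y)))

low : ℕ → ℕ → ℕ
low e y = y ∸ sh e y * 2 ^ e

low-< : ∀ e y → low e y < 2 ^ e
low-< e y with sh-decomp e y
... | l , l< , eq = subst (_< 2 ^ e) (sym (trans (cong (_∸ sh e y * 2 ^ e) eq) (m+n∸m≡n (sh e y * 2 ^ e) l))) l<

low-eq : ∀ e y → sh e y * 2 ^ e + low e y ≡ y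
low-eq e y = m+[n∸m]≡n (sh-lower e y)

-- Mixed radix pairs; radix 0 decodes to junk.
pair : ℕ → ℕ → ℕ → ℕ
pair k x y = x + y * k

pfst psnd : ℕ → ℕ → ℕ
pfst zero v = 0
pfst (suc k) v = v % suc k
psnd zero v = 0
psnd (suc k) v = v / suc k

pfst-pair : ∀ k x y → x < k → pfst k (pair k x y) ≡ x
pfst-pair (suc k) x y x< = trans ([m+kn]%n≡m%n x y (suc k)) (m<n⇒m%n≡m x<)

psnd-pair : ∀ k x y → x < k → psnd k (pair k x y) ≡ y
psnd-pair (suc k) x y x< = begin
  (x + y * suc k) / suc k            ≡⟨ +-distrib-/ x (y * suc k) lt ⟩
  x / suc k + y * suc k / suc k      ≡⟨ cong₂ _+_ (m<n⇒m/n≡0 x<) (m*n/n≡m y (suc k)) ⟩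
  y                                  ∎
  where
  open ≡-Reasoning
  lt : x % suc k + y * suc k % suc k < suc k
  lt rewrite m*n%n≡0 y (suc k) {{_}} | m<n⇒m%n≡m x< | +-identityʳ x = x<

pair-< : ∀ {k l x y} → x < k → y < l → pair k x y < k * l
pair-< {k} {l} {x} {y} x< y< = <-≤-trans (+-monoˡ-< (y * k) x<)
  (≤-trans (*-monoˡ-≤ k y<) (≤-reflexive (*-comm l k)))

pair-eq : ∀ k .{{_ : NonZero k}} v → pair k (pfst k v) (psnd k v) ≡ v
pair-eq (suc k) v = sym (m≡m%n+[m/n]*n v (suc k))

pfst-< : ∀ k .{{_ : NonZero k}} v → pfst k v < k
pfst-< (suc k) v = m%n<n v (suc k)

-- Binary digits and prefix counts

num : ℕ → (ℕ → Bool) → ℕ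
num zero f = 0
num (suc k) f = bit (f 0) + 2 * num k (f ∘ suc)

odd? : ℕ → Bool
odd? zero = false
odd? (suc zero) = true
odd? (suc (suc n)) = odd? n

bitOf : ℕ → ℕ → Bool
bitOf v zero = odd? v
bitOf v (suc i) = bitOf ⌊ v /2⌋ i

num-cong : ∀ k {f g : ℕ → Bool} → (∀ i → i < k → f i ≡ g i) → num k f ≡ num k g
num-cong zero h = refl
num-cong (suc k) h = cong₂ (λ x y → bit x + 2 * y) (h 0 (s≤s z≤n)) (num-cong k λ i i< → h (suc i) (s≤s i<))

num-< : ∀ k f → num k f < 2 ^ k
num-< zero f = s≤s z≤n
num-< (suc k) f with f 0
... | true = ≤-trans (≤-reflexive (sym (*-suc 2 (num k (f ∘ suc))))) (*-monoʳ-≤ 2 (num-< k (f ∘ suc)))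
... | false = *-monoʳ-< 2 (num-< k (f ∘ suc))

odd?-double : ∀ n → odd? (2 * n) ≡ false
odd?-double zero = refl
odd?-double (suc n) rewrite +-suc n (n + 0) = odd?-double n

odd?-double+1 : ∀ n → odd? (suc (2 * n)) ≡ true
odd?-double+1 zero = refl
odd?-double+1 (suc n) rewrite +-suc n (n + 0) = odd?-double+1 n

bitOf-num : ∀ k f i → i < k → bitOf (num k f) i ≡ f i
bitOf-num (suc k) f zero _ with f 0
... | true = odd?-double+1 (num k (f ∘ suc))
... | false = odd?-double (num k (f ∘ suc))
bitOf-num (suc k) f (suc i) (s≤s p) with f 0
... | true rewrite half-double+1 (num k (f ∘ suc)) = bitOf-num k (f ∘ suc) i p
... | false rewrite half-double (num k (f ∘ suc)) = bitOf-num k (f ∘ suc) i p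

odd?-bit : ∀ v → bit (odd? v) + 2 * ⌊ v /2⌋ ≡ v
odd?-bit zero = refl
odd?-bit (suc zero) = refl
odd?-bit (suc (suc v)) = trans (lem (bit (odd? v)) ⌊ v /2⌋) (cong (suc ∘ suc) (odd?-bit v))
  where
  lem : ∀ a b → a + 2 * suc b ≡ suc (suc (a + 2 * b))
  lem = solve-∀

num-bitOf : ∀ k v → v < 2 ^ k → num k (bitOf v) ≡ v
num-bitOf zero zero _ = refl
num-bitOf zero (suc v) (s≤s ())
num-bitOf (suc k) v v< = trans (cong (λ x → bit (odd? v) + 2 * x) (num-bitOf k ⌊ v /2⌋ lt)) (odd?-bit v)
  where
  lt : ⌊ v /2⌋ < 2 ^ k
  lt = sh-< 1 v (2 ^ k) (subst (v <_) (*-comm 2 (2 ^ k)) v<)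

rk : (ℕ → Bool) → ℕ → ℕ
rk f zero = 0
rk f (suc u) = bit (f 0) + rk (f ∘ suc) u

rk-cong : ∀ {f g : ℕ → Bool} u → (∀ i → i < u → f i ≡ g i) → rk f u ≡ rk g u
rk-cong zero h = refl
rk-cong (suc u) h = cong₂ (λ x y → bit x + y) (h 0 (s≤s z≤n)) (rk-cong u λ i i< → h (suc i) (s≤s i<))

rk-+ : ∀ f u v → rk f (u + v) ≡ rk f u + rk (λ i → f (u + i)) v
rk-+ f zero v = refl
rk-+ f (suc u) v rewrite rk-+ (f ∘ suc) u v =
  sym (+-assoc (bit (f 0)) (rk (f ∘ suc) u) (rk (λ i → f (suc (u + i))) v))

rk-≤ : ∀ f u → rk f u ≤ u
rk-≤ f zero = z≤n
rk-≤ f (suc u) with f 0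
... | true = s≤s (rk-≤ (f ∘ suc) u)
... | false = m≤n⇒m≤1+n (rk-≤ (f ∘ suc) u)

bit-injective : ∀ x y → bit x ≡ bit y → x ≡ y
bit-injective true true _ = refl
bit-injective false false _ = refl

rk-injective : ∀ m (f g : ℕ → Bool) → (∀ u → u ≤ m → rk f u ≡ rk g u) → ∀ i → i < m → f i ≡ g i
rk-injective m f g h i i< = bit-injective (f i) (g i) (+-cancelˡ-≡ (rk g i) _ _ (begin
  rk g i + bit (f i)   ≡⟨ cong (_+ bit (f i)) (sym (h i (<⇒≤ i<))) ⟩
  rk f i + bit (f i)   ≡⟨ step f ⟩
  rk f (i + 1)         ≡⟨ h (i + 1) (subst (_≤ m) (+-comm 1 i) i<) ⟩
  rk g (i + 1)         ≡⟨ sym (step g) ⟩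
  rk g i + bit (g i)   ∎))
  where
  open ≡-Reasoning
  step : ∀ f → rk f i + bit (f i) ≡ rk f (i + 1)
  step f = sym (trans (rk-+ f i 1) (cong (rk f i +_)
    (trans (+-identityʳ (bit (f (i + 0)))) (cong (bit ∘ f) (+-identityʳ i)))))

-- Binomial coefficients

bin : ℕ → ℕ → ℕ
bin m zero = 1
bin zero (suc x) = 0
bin (suc m) (suc x) = bin m x + bin m (suc x)

bin-> : ∀ m x → m < x → bin m x ≡ 0
bin-> zero (suc x) _ = refl
bin-> (suc m) (suc x) (s≤s p) rewrite bin-> m x p | bin-> m (suc x) (m≤n⇒m≤1+n p) = refl

bin-≤ : ∀ m x → bin m x ≤ 2 ^ m
bin-≤ m zero = 2^>0 m
bin-≤ zero (suc x) = z≤n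
bin-≤ (suc m) (suc x) = ≤-trans (+-mono-≤ (bin-≤ m x) (bin-≤ m (suc x))) (≤-reflexive (sym (2^-suc m)))

-- The absorption identity (x + 1) C(m, x + 1) = (m - x) C(m, x), with the negative term moved to
-- the left so that it holds for every x.
bin-absorb : ∀ m x → suc x * bin m (suc x) + x * bin m x ≡ m * bin m x
bin-absorb zero zero = refl
bin-absorb zero (suc x) rewrite *-zeroʳ x = refl
bin-absorb (suc m) zero rewrite sym (bin-absorb m zero) = refl
bin-absorb (suc m) (suc x) = begin
  suc (suc x) * (q + r) + suc x * (p + q)                     ≡⟨ lem₁ x p q r ⟩
  (suc (suc x) * r + suc x * q) + (suc x * q + x * p) + (p + q) ≡⟨ cong₂ (λ s t → s + t + (p + q)) (bin-absorb m (suc x)) (bin-absorb m x) ⟩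
  m * q + m * p + (p + q)                                     ≡⟨ lem₂ m p q ⟩
  suc m * (p + q)                                             ∎
  where
  open ≡-Reasoning
  p = bin m x
  q = bin m (suc x)
  r = bin m (suc (suc x))
  lem₁ : ∀ x p q r → suc (suc x) * (q + r) + suc x * (p + q) ≡ (suc (suc x) * r + suc x * q) + (suc x * q + x * p) + (p + q)
  lem₁ = solve-∀
  lem₂ : ∀ m p q → m * q + m * p + (p + q) ≡ suc m * (p + q)
  lem₂ = solve-∀

bin-absorb′ : ∀ v x → suc x * bin (x + v) (suc x) ≡ v * bin (x + v) x
bin-absorb′ v x = +-cancelʳ-≡ (x * bin (x + v) x) _ _
  (trans (bin-absorb (x + v) x) (trans (*-distribʳ-+ (bin (x + v) x) x v) (+-comm (x * bin (x + v) x) _)))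

bin-self : ∀ m → bin m m ≡ 1
bin-self zero = refl
bin-self (suc m) rewrite bin-self m | bin-> m (suc m) ≤-refl = refl

bin-sym : ∀ x y → bin (x + y) x ≡ bin (x + y) y
bin-sym zero y = sym (bin-self y)
bin-sym (suc x) zero rewrite +-identityʳ x = bin-self (suc x)
bin-sym (suc x) (suc y) = begin
  bin (x + suc y) x + bin (x + suc y) (suc x)       ≡⟨ cong₂ _+_ (bin-sym x (suc y)) (cong (λ z → bin z (suc x)) (+-suc x y)) ⟩
  bin (x + suc y) (suc y) + bin (suc x + y) (suc x) ≡⟨ cong (bin (x + suc y) (suc y) +_) (bin-sym (suc x) y) ⟩
  bin (x + suc y) (suc y) + bin (suc x + y) y       ≡⟨ cong (λ z → bin (x + suc y) (suc y) + bin z y) (sym (+-suc x y)) ⟩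
  bin (x + suc y) (suc y) + bin (x + suc y) y       ≡⟨ +-comm (bin (x + suc y) (suc y)) _ ⟩
  bin (x + suc y) y + bin (x + suc y) (suc y)       ∎
  where open ≡-Reasoning

-- Pascal's rule turns a weighted sum over row m + 1 into one over row m, which gives the total and
-- the variance of a row by induction.
bin-pascal-sum : ∀ m (φ : ℕ → ℕ) →
  sumTo (λ j → φ j * bin (suc m) j) (suc (suc m)) ≡ sumTo (λ j → (φ j + φ (suc j)) * bin m j) (suc m)
bin-pascal-sum m φ = begin
  sumTo (λ j → φ j * bin (suc m) j) (suc (suc m))
    ≡⟨ sumTo-left (λ j → φ j * bin (suc m) j) (suc m) ⟩
  φ 0 * 1 + sumTo (λ j → φ (suc j) * (bin m j + bin m (suc j))) (suc m)
    ≡⟨ cong (φ 0 * 1 +_) (trans (sumTo-cong (suc m) λ j _ → *-distribˡ-+ (φ (suc j)) (bin m j) (bin m (suc j)))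
                                (sumOf-add (λ j → φ (suc j) * bin m j) (λ j → φ (suc j) * bin m (suc j)) (downFrom (suc m)))) ⟩
  φ 0 * 1 + (S₁ + (φ (suc m) * bin m (suc m) + S₂))
    ≡⟨ cong (λ z → φ 0 * 1 + (S₁ + (φ (suc m) * z + S₂))) (bin-> m (suc m) ≤-refl) ⟩
  φ 0 * 1 + (S₁ + (φ (suc m) * 0 + S₂))
    ≡⟨ lem (φ 0 * 1) S₁ (φ (suc m)) S₂ ⟩
  (φ 0 * 1 + S₂) + S₁
    ≡⟨ cong (_+ S₁) (sym (sumTo-left (λ j → φ j * bin m j) m)) ⟩
  sumTo (λ j → φ j * bin m j) (suc m) + S₁
    ≡⟨ sym (sumOf-add (λ j → φ j * bin m j) (λ j → φ (suc j) * bin m j) (downFrom (suc m))) ⟩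
  sumTo (λ j → φ j * bin m j + φ (suc j) * bin m j) (suc m)
    ≡⟨ sumTo-cong (suc m) (λ j _ → sym (*-distribʳ-+ (bin m j) (φ j) (φ (suc j)))) ⟩
  sumTo (λ j → (φ j + φ (suc j)) * bin m j) (suc m) ∎
  where
  open ≡-Reasoning
  S₁ = sumTo (λ j → φ (suc j) * bin m j) (suc m)
  S₂ = sumTo (λ j → φ (suc j) * bin m (suc j)) m
  lem : ∀ a s f t → a + (s + (f * 0 + t)) ≡ (a + t) + s
  lem = solve-∀

bin-sum : ∀ m → sumTo (bin m) (suc m) ≡ 2 ^ m
bin-sum m = trans (sumTo-cong (suc m) λ j _ → sym (*-identityˡ (bin m j))) (go m)
  where
  go : ∀ m → sumTo (λ j → 1 * bin m j) (suc m) ≡ 2 ^ m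
  go zero = refl
  go (suc m) = trans (bin-pascal-sum m (λ _ → 1))
    (trans (trans (sumTo-cong (suc m) λ j _ → *-assoc 2 1 (bin m j)) (sumOf-*ˡ 2 (λ j → 1 * bin m j) (downFrom (suc m)))) (cong (2 *_) (go m)))

-- Variance, slope and tails of the binomial coefficients

sq : ℕ → ℕ → ℕ
sq x y = ∣ x - y ∣ * ∣ x - y ∣

-- The second difference of the square: under Pascal's rule it makes the mean square deviation grow
-- by exactly one per row.
sq-step : ∀ x y → sq (suc x) y + sq x (suc y) ≡ 2 * sq x y + 2
sq-step zero zero = refl
sq-step zero (suc y) = lem y
  where
  lem : ∀ y → y * y + (2 + y) * (2 + y) ≡ 2 * ((1 + y) * (1 + y)) + 2
  lem = solve-∀
sq-step (suc x) zero rewrite ∣-∣-identityʳ x = lem x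
  where
  lem : ∀ x → (2 + x) * (2 + x) + x * x ≡ 2 * ((1 + x) * (1 + x)) + 2
  lem = solve-∀
sq-step (suc x) (suc y) = sq-step x y

-- The variance of m steps ±1, that is of m - 2j; doubling the variable avoids the half-integral
-- mean.
bin-variance : ∀ m → sumTo (λ j → sq m (2 * j) * bin m j) (suc m) ≡ m * 2 ^ m
bin-variance zero = refl
bin-variance (suc m) = begin
  sumTo (λ j → sq (suc m) (2 * j) * bin (suc m) j) (suc (suc m))
    ≡⟨ bin-pascal-sum m (λ j → sq (suc m) (2 * j)) ⟩
  sumTo (λ j → (sq (suc m) (2 * j) + sq (suc m) (2 * suc j)) * bin m j) (suc m)
    ≡⟨ sumTo-cong (suc m) (λ j _ → cong (_* bin m j) (eq j)) ⟩
  sumTo (λ j → (2 * sq m (2 * j) + 2) * bin m j) (suc m)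
    ≡⟨ sumTo-cong (suc m) (λ j _ → lem₁ (sq m (2 * j)) (bin m j)) ⟩
  sumTo (λ j → 2 * (sq m (2 * j) * bin m j) + 2 * bin m j) (suc m)
    ≡⟨ sumOf-add (λ j → 2 * (sq m (2 * j) * bin m j)) (λ j → 2 * bin m j) (downFrom (suc m)) ⟩
  sumTo (λ j → 2 * (sq m (2 * j) * bin m j)) (suc m) + sumTo (λ j → 2 * bin m j) (suc m)
    ≡⟨ cong₂ _+_ (trans (sumOf-*ˡ 2 (λ j → sq m (2 * j) * bin m j) (downFrom (suc m))) (cong (2 *_) (bin-variance m)))
                 (trans (sumOf-*ˡ 2 (bin m) (downFrom (suc m))) (cong (2 *_) (bin-sum m))) ⟩
  2 * (m * 2 ^ m) + 2 * 2 ^ m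
    ≡⟨ lem₂ m (2 ^ m) ⟩
  suc m * (2 * 2 ^ m) ∎
  where
  open ≡-Reasoning
  eq : ∀ j → sq (suc m) (2 * j) + sq (suc m) (2 * suc j) ≡ 2 * sq m (2 * j) + 2
  eq j = trans (cong (λ z → sq (suc m) (2 * j) + sq (suc m) z) (*-suc 2 j)) (sq-step m (2 * j))
  lem₁ : ∀ s b → (2 * s + 2) * b ≡ 2 * (s * b) + 2 * b
  lem₁ = solve-∀
  lem₂ : ∀ m p → 2 * (m * p) + 2 * p ≡ suc m * (2 * p)
  lem₂ = solve-∀

sumTo-≤-total : ∀ f {k n} → k ≤ n → sumTo f k ≤ sumTo f n
sumTo-≤-total f {k} {n} p with m≤n⇒∃[o]m+o≡n p
... | o , refl = ≤-trans (m≤m+n _ _) (≤-reflexive (sym (sumTo-+ f k o)))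

sumTo-term : ∀ f {k n} → k < n → f k ≤ sumTo f n
sumTo-term f {k} p = ≤-trans (m≤m+n (f k) _) (sumTo-≤-total f p)

-- The difference of consecutive terms of u (u + 1 + x) binom(m, x), where m = u + 1 + 2 x, is at most the
-- corresponding term of the variance.
bin-partial-variance : ∀ x u m → m ≡ suc u + 2 * x →
  u * (suc u + x) * bin m x ≤ sumTo (λ j → sq m (2 * j) * bin m j) (suc x)
bin-partial-variance zero u m refl = ≤-trans
  (≤-trans (*-monoˡ-≤ 1 (*-mono-≤ (n≤1+n u) ≤-refl)) (≤-reflexive eq)) (m≤m+n _ 0)
  where
  eq : suc u * (suc u + 0) * 1 ≡ sq (suc u + 0) 0 * 1
  eq rewrite +-identityʳ u = refl
bin-partial-variance (suc x) u m m≡ = begin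
  u * (suc u + suc x) * c
    ≤⟨ ≤-add ((2 * suc x + u + 1) * c) (lem₁ u x c) ⟩
  suc u * suc u * c + (2 + u) * (suc x * c)
    ≡⟨ cong₂ _+_ (cong (_* c) sq-eq) (cong ((2 + u) *_) absorb) ⟩
  sq m (2 * suc x) * c + (2 + u) * ((3 + u + x) * bin m x)
    ≡⟨ cong (sq m (2 * suc x) * c +_) (sym (*-assoc (2 + u) (3 + u + x) (bin m x))) ⟩
  sq m (2 * suc x) * c + (2 + u) * (3 + u + x) * bin m x
    ≤⟨ +-monoʳ-≤ (sq m (2 * suc x) * c) (bin-partial-variance x (2 + u) m (trans m≡ (lem₂ u x))) ⟩
  sumTo (λ j → sq m (2 * j) * bin m j) (suc (suc x)) ∎
  where
  open ≤-Reasoning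
  c = bin m (suc x)
  lem₁ : ∀ u x c → suc u * suc u * c + (2 + u) * (suc x * c) ≡ u * (suc u + suc x) * c + (2 * suc x + u + 1) * c
  lem₁ = solve-∀
  lem₂ : ∀ u x → suc u + 2 * suc x ≡ suc (2 + u) + 2 * x
  lem₂ = solve-∀
  lem₃ : ∀ u x → suc u + 2 * suc x ≡ x + (3 + u + x)
  lem₃ = solve-∀
  sq-eq : suc u * suc u ≡ sq m (2 * suc x)
  sq-eq = cong (λ z → z * z) (sym (trans (∣-∣-comm m (2 * suc x))
    (trans (cong (λ z → ∣ 2 * suc x - z ∣) (trans m≡ (+-comm (suc u) (2 * suc x)))) (∣m-m+n∣≡n (2 * suc x) (suc u)))))
  absorb : suc x * c ≡ (3 + u + x) * bin m x
  absorb rewrite trans m≡ (lem₃ u x) = bin-absorb′ (3 + u + x) x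

bin-variance-bound : ∀ x u m → m ≡ suc u + 2 * x → u * (suc u + x) * bin m x ≤ m * 2 ^ m
bin-variance-bound x u m m≡ = ≤-trans (bin-partial-variance x u m m≡)
  (≤-trans (sumTo-≤-total _ (s≤s x≤m)) (≤-reflexive (bin-variance m)))
  where
  x≤m : x ≤ m
  x≤m = subst (x ≤_) (sym m≡) (≤-trans (m≤m+n x (x + 0)) (m≤n+m (2 * x) (suc u)))

-- By absorption the increment is u / (x + 1) times `bin m x`. If x is of the order of m, the
-- partial variance controls it; if x + 1 ≤ m / 4, the single variance term at x + 1 already makes
-- `bin m (suc x)` small.
bin-slope-left : ∀ x u m → m ≡ suc u + 2 * x →
  bin m x ≤ bin m (suc x) × bin m (suc x) * m ≤ bin m x * m + 8 * 2 ^ m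
bin-slope-left x u m m≡ = mono , bound
  where
  open ≤-Reasoning
  p = bin m x
  q = bin m (suc x)
  instance
    nz : NonZero m
    nz = subst NonZero (sym m≡) _
  lem₀ : ∀ u x → suc u + 2 * x ≡ x + (suc u + x)
  lem₀ = solve-∀
  absorb : suc x * q ≡ (suc u + x) * p
  absorb rewrite trans m≡ (lem₀ u x) = bin-absorb′ (suc u + x) x
  mono : p ≤ q
  mono = *-cancelˡ-≤ (suc x) (≤-trans (*-monoˡ-≤ p (s≤s (m≤n+m x u))) (≤-reflexive (sym absorb)))
  δ = q ∸ p
  q≡ : q ≡ p + δ
  q≡ = sym (m+[n∸m]≡n mono)
  δ-eq : suc x * δ ≡ u * p
  δ-eq = +-cancelˡ-≡ (suc x * p) _ _ (trans (sym (*-distribˡ-+ (suc x) p δ)) (trans (cong (suc x *_) (sym q≡)) (trans absorb (lem u x p))))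
    where
    lem : ∀ u x p → (suc u + x) * p ≡ suc x * p + u * p
    lem = solve-∀
  δ-bound : δ * (suc x * (suc u + x)) ≤ m * 2 ^ m
  δ-bound = ≤-trans (≤-reflexive (trans (lem₁ δ (suc x) (suc u + x)) (trans (cong (_* (suc u + x)) δ-eq) (lem₂ u p (suc u + x)))))
              (bin-variance-bound x u m m≡)
    where
    lem₁ : ∀ a b c → a * (b * c) ≡ b * a * c
    lem₁ = solve-∀
    lem₂ : ∀ u p c → u * p * c ≡ u * c * p
    lem₂ = solve-∀
  near : m ≤ 4 * suc x → δ * m ≤ 8 * 2 ^ m
  near h = *-cancelʳ-≤ _ _ m (begin
    δ * m * m                               ≡⟨ *-assoc δ m m ⟩
    δ * (m * m)                             ≤⟨ *-monoʳ-≤ δ (*-mono-≤ h (≤-trans (≤-reflexive m≡) (≤-add (suc u) (lem₁ u x)))) ⟩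
    δ * (4 * suc x * (2 * (suc u + x)))     ≡⟨ lem₂ δ (suc x) (suc u + x) ⟩
    8 * (δ * (suc x * (suc u + x)))         ≤⟨ *-monoʳ-≤ 8 δ-bound ⟩
    8 * (m * 2 ^ m)                         ≡⟨ lem₃ m (2 ^ m) ⟩
    8 * 2 ^ m * m                           ∎)
    where
    lem₁ : ∀ u x → 2 * (suc u + x) ≡ suc u + 2 * x + suc u
    lem₁ = solve-∀
    lem₂ : ∀ d a b → d * (4 * a * (2 * b)) ≡ 8 * (d * (a * b))
    lem₂ = solve-∀
    lem₃ : ∀ a b → 8 * (a * b) ≡ 8 * b * a
    lem₃ = solve-∀
  far : 4 * suc x ≤ m → q * m ≤ 8 * 2 ^ m
  far h = *-cancelʳ-≤ _ _ m (begin
    q * m * m                                 ≡⟨ *-assoc q m m ⟩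
    q * (m * m)                               ≤⟨ *-monoʳ-≤ q (*-mono-≤ dist dist) ⟩
    q * (2 * ∣ m - 2 * suc x ∣ * (2 * ∣ m - 2 * suc x ∣)) ≡⟨ lem₂ q ∣ m - 2 * suc x ∣ ⟩
    4 * (sq m (2 * suc x) * q)                ≤⟨ *-monoʳ-≤ 4 (≤-trans (sumTo-term (λ j → sq m (2 * j) * bin m j) {suc x} {suc m} lt) (≤-reflexive (bin-variance m))) ⟩
    4 * (m * 2 ^ m)                           ≤⟨ *-monoˡ-≤ (m * 2 ^ m) (m≤m+n 4 4) ⟩
    8 * (m * 2 ^ m)                           ≡⟨ lem₃ m (2 ^ m) ⟩
    8 * 2 ^ m * m                             ∎)
    where
    lt : suc x < suc m
    lt = s≤s (≤-trans (m≤m+n (suc x) _) h)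
    o = proj₁ (m≤n⇒∃[o]m+o≡n h)
    dist : m ≤ 2 * ∣ m - 2 * suc x ∣
    dist = ≤-trans (≤-add o lem′) (≤-reflexive (cong (2 *_) (sym d-eq)))
      where
      m-eq : m ≡ 2 * suc x + (2 * suc x + o)
      m-eq = trans (sym (proj₂ (m≤n⇒∃[o]m+o≡n h))) (l (suc x) o)
        where
        l : ∀ a b → 4 * a + b ≡ 2 * a + (2 * a + b)
        l = solve-∀
      d-eq : ∣ m - 2 * suc x ∣ ≡ 2 * suc x + o
      d-eq = trans (∣-∣-comm m (2 * suc x)) (trans (cong (λ z → ∣ 2 * suc x - z ∣) m-eq) (∣m-m+n∣≡n (2 * suc x) (2 * suc x + o)))
      lem′ : 2 * (2 * suc x + o) ≡ m + o
      lem′ = trans (l (suc x) o) (cong (_+ o) (sym m-eq))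
        where
        l : ∀ a b → 2 * (2 * a + b) ≡ 2 * a + (2 * a + b) + b
        l = solve-∀
    lem₂ : ∀ q d → q * (2 * d * (2 * d)) ≡ 4 * (d * d * q)
    lem₂ = solve-∀
    lem₃ : ∀ a b → 8 * (a * b) ≡ 8 * b * a
    lem₃ = solve-∀
  bound : q * m ≤ p * m + 8 * 2 ^ m
  bound with ≤-total m (4 * suc x)
  ... | inj₁ h = ≤-trans (≤-reflexive (trans (cong (_* m) q≡) (*-distribʳ-+ m p δ))) (+-monoʳ-≤ (p * m) (near h))
  ... | inj₂ h = ≤-trans (far h) (m≤n+m (8 * 2 ^ m) (p * m))

Close : ℕ → ℕ → ℕ → Set
Close δ x y = x ≤ y + δ × y ≤ x + δ

Close-sym : ∀ {δ x y} → Close δ x y → Close δ y x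
Close-sym (p , q) = q , p

-- The right half is the left half mirrored by `bin-sym`. Only the edge x ≥ m is separate: there the
-- drop is at most 1, and m ≤ 2^m.
bin-slope : ∀ m x → Close (8 * 2 ^ m) (bin m x * m) (bin m (suc x) * m)
bin-slope m x with 2 * x <? m
... | yes p with m≤n⇒∃[o]m+o≡n p
...   | u , eq with bin-slope-left x u m (trans (sym eq) (cong suc (+-comm (2 * x) u)))
...     | mono , bound = ≤-trans (*-monoˡ-≤ m mono) (m≤m+n _ _) , bound
bin-slope m x | no p with suc x ≤? m
... | no q = ≤-trans (≤-trans small (m≤m+n (2 ^ m) (7 * 2 ^ m))) (m≤n+m (8 * 2 ^ m) (bin m (suc x) * m)) ,
             ≤-trans (≤-reflexive (cong (_* m) (bin-> m (suc x) (≰⇒> q)))) z≤n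
  where
  le1 : ∀ x → m ≤ x → bin m x ≤ 1
  le1 x h with m≤n⇒m<n∨m≡n h
  ... | inj₁ lt = ≤-trans (≤-reflexive (bin-> m x lt)) z≤n
  ... | inj₂ refl = ≤-reflexive (bin-self m)
  small : bin m x * m ≤ 2 ^ m
  small = ≤-trans (*-mono-≤ (le1 x (≤-pred (≰⇒> q))) (<⇒≤ (n<2^n m))) (≤-reflexive (*-identityˡ (2 ^ m)))
... | yes q with m≤n⇒∃[o]m+o≡n q
...   | y , refl = subst₂ (Close (8 * 2 ^ m)) (cong (_* m) e₁) (cong (_* m) e₂)
                     (Close-sym (≤-trans (*-monoˡ-≤ m (proj₁ s)) (m≤m+n _ _) , proj₂ s))
  where
  u≥ : suc (2 * y) ≤ suc x + y
  u≥ = s≤s (≤-trans (≤-reflexive (cong (y +_) (+-identityʳ y))) (+-monoˡ-≤ y (+-cancelʳ-≤ (suc x) y x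
         (≤-trans (≤-reflexive (+-comm y (suc x))) (≤-trans (≮⇒≥ p) (≤-trans (≤-reflexive (cong (x +_) (+-identityʳ x))) (+-monoʳ-≤ x (n≤1+n x))))))))
  o = proj₁ (m≤n⇒∃[o]m+o≡n u≥)
  s = bin-slope-left y o m (trans (sym (proj₂ (m≤n⇒∃[o]m+o≡n u≥))) (cong suc (+-comm (2 * y) o)))
  e₁ : bin m (suc y) ≡ bin m x
  e₁ = trans (cong (λ z → bin z (suc y)) (sym (+-suc x y))) (trans (sym (bin-sym x (suc y))) (cong (λ z → bin z x) (+-suc x y)))
  e₂ : bin m y ≡ bin m (suc x)
  e₂ = sym (bin-sym (suc x) y)

-- The slope 8 * 2^m / m is at most 2^(m - 2 - 2d) because m ≥ 2^(5 + 2d); `e` stands for the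
-- exponent m - 2 - 2d.
bin-close : ∀ m d e x → 2 ^ (5 + 2 * d) ≤ m → m ≤ e + (2 + 2 * d) → Close (2 ^ e) (bin m x) (bin m (suc x))
bin-close m d e x h₁ h₂ = go (proj₁ (bin-slope m x)) , go (proj₂ (bin-slope m x))
  where
  instance
    nz : NonZero m
    nz = >-nonZero (<-≤-trans (2^>0 (5 + 2 * d)) h₁)
  go : ∀ {p q} → p * m ≤ q * m + 8 * 2 ^ m → p ≤ q + 2 ^ e
  go {p} {q} h = *-cancelʳ-≤ p (q + 2 ^ e) m (≤-trans h (≤-trans (+-monoʳ-≤ (q * m) big) (≤-reflexive (sym (*-distribʳ-+ m q (2 ^ e))))))
    where
    big : 8 * 2 ^ m ≤ 2 ^ e * m
    big = ≤-trans (≤-trans (≤-reflexive (sym (2^-+ 3 m))) (2^-mono (≤-trans (+-monoʳ-≤ 3 h₂) (≤-reflexive (lem e d)))))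
            (≤-trans (≤-reflexive (2^-+ e (5 + 2 * d))) (*-monoʳ-≤ (2 ^ e) h₁))
      where
      lem : ∀ e d → 3 + (e + (2 + 2 * d)) ≡ e + (5 + 2 * d)
      lem = solve-∀

-- Past distance s from the centre (with s² ≥ m) consecutive binomials shrink by the factor 1 + 1/s, hence
-- they halve every s steps.
bin-shrink : ∀ m s x → m ≤ s * s → m + s ≤ suc (2 * x) → bin m (suc x) * suc s ≤ bin m x * s
bin-shrink m s x m≤ far with suc x ≤? m
... | no q = ≤-trans (≤-reflexive (cong (_* suc s) (bin-> m (suc x) (≰⇒> q)))) z≤n
... | yes q with m≤n⇒∃[o]m+o≡n q
...   | y , refl = *-cancelʳ-≤ _ _ (suc y) (begin
    bin m (suc x) * suc s * suc y              ≡⟨ *-assoc (bin m (suc x)) (suc s) (suc y) ⟩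
    bin m (suc x) * (suc y + s * suc y)        ≤⟨ *-monoʳ-≤ (bin m (suc x)) (+-monoˡ-≤ (s * suc y) (≤-trans (s≤s (m≤n+m y x)) m≤)) ⟩
    bin m (suc x) * (s * s + s * suc y)        ≡⟨ cong (bin m (suc x) *_) (sym (*-distribˡ-+ s s (suc y))) ⟩
    bin m (suc x) * (s * (s + suc y))          ≤⟨ *-monoʳ-≤ (bin m (suc x)) (*-monoʳ-≤ s gap) ⟩
    bin m (suc x) * (s * suc x)                ≡⟨ lem (bin m (suc x)) s (suc x) ⟩
    suc x * bin m (suc x) * s                  ≡⟨ cong (_* s) absorb ⟩
    suc y * bin m x * s                        ≡⟨ lem₂ (suc y) (bin m x) s ⟩
    bin m x * s * suc y                        ∎)
  where
  open ≤-Reasoning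
  lem : ∀ a s b → a * (s * b) ≡ b * a * s
  lem = solve-∀
  lem₂ : ∀ a b c → a * b * c ≡ b * c * a
  lem₂ = solve-∀
  absorb : suc x * bin m (suc x) ≡ suc y * bin m x
  absorb = subst (λ z → suc x * bin z (suc x) ≡ suc y * bin z x) (+-suc x y) (bin-absorb′ (suc y) x)
  gap : s + suc y ≤ suc x
  gap = +-cancelˡ-≤ x _ _ (≤-trans (≤-reflexive (l₁ x s y)) (≤-trans far (≤-reflexive (l₂ x))))
    where
    l₁ : ∀ x s y → x + (s + suc y) ≡ suc x + y + s
    l₁ = solve-∀
    l₂ : ∀ x → suc (2 * x) ≡ x + suc x
    l₂ = solve-∀

-- Bernoulli's inequality (1 + 1/s)^i ≥ 1 + i/s without denominators; i = s yields the factor two of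
-- a halving.
bernoulli : ∀ s i → s ^ i * (s + i) ≤ s * suc s ^ i
bernoulli s zero = ≤-reflexive (trans (+-identityʳ (s + 0)) (trans (+-identityʳ s) (sym (*-identityʳ s))))
bernoulli s (suc i) = begin
  s * s ^ i * (s + suc i)         ≤⟨ ≤-add (s ^ i * i) (lem s (s ^ i) i) ⟩
  suc s * (s ^ i * (s + i))       ≤⟨ *-monoʳ-≤ (suc s) (bernoulli s i) ⟩
  suc s * (s * suc s ^ i)         ≡⟨ lem₂ (suc s) s (suc s ^ i) ⟩
  s * (suc s * suc s ^ i)         ∎
  where
  open ≤-Reasoning
  lem : ∀ s p i → suc s * (p * (s + i)) ≡ s * p * (s + suc i) + p * i
  lem = solve-∀
  lem₂ : ∀ a b c → a * (b * c) ≡ b * (a * c)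
  lem₂ = solve-∀

module _ (m s′ : ℕ) (m≤ : m ≤ suc s′ * suc s′) where
  private s = suc s′

  bin-shrink^ : ∀ i x → m + s ≤ suc (2 * x) → bin m (x + i) * suc s ^ i ≤ bin m x * s ^ i
  bin-shrink^ zero x h = ≤-reflexive (cong (λ z → bin m z * 1) (+-identityʳ x))
  bin-shrink^ (suc i) x h = begin
    bin m (x + suc i) * (suc s * suc s ^ i)   ≡⟨ cong (λ z → bin m z * (suc s * suc s ^ i)) (+-suc x i) ⟩
    bin m (suc (x + i)) * (suc s * suc s ^ i) ≡⟨ sym (*-assoc (bin m (suc (x + i))) (suc s) (suc s ^ i)) ⟩
    bin m (suc (x + i)) * suc s * suc s ^ i   ≤⟨ *-monoˡ-≤ (suc s ^ i) (bin-shrink m s (x + i) m≤ (≤-trans h (s≤s (*-monoʳ-≤ 2 (m≤m+n x i))))) ⟩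
    bin m (x + i) * s * suc s ^ i             ≡⟨ lem (bin m (x + i)) s (suc s ^ i) ⟩
    s * (bin m (x + i) * suc s ^ i)           ≤⟨ *-monoʳ-≤ s (bin-shrink^ i x h) ⟩
    s * (bin m x * s ^ i)                     ≡⟨ lem₂ s (bin m x) (s ^ i) ⟩
    bin m x * (s * s ^ i)                     ∎
    where
    open ≤-Reasoning
    lem : ∀ a b c → a * b * c ≡ b * (a * c)
    lem = solve-∀
    lem₂ : ∀ a b c → a * (b * c) ≡ b * (a * c)
    lem₂ = solve-∀

  bin-halve : ∀ x → m + s ≤ suc (2 * x) → bin m (x + s) * 2 ≤ bin m x
  bin-halve x h = *-cancelʳ-≤ _ _ (s ^ s) {{m^n≢0 s s}} (begin
    bin m (x + s) * 2 * s ^ s     ≡⟨ *-assoc (bin m (x + s)) 2 (s ^ s) ⟩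
    bin m (x + s) * (2 * s ^ s)   ≤⟨ *-monoʳ-≤ (bin m (x + s)) two ⟩
    bin m (x + s) * suc s ^ s     ≤⟨ bin-shrink^ s x h ⟩
    bin m x * s ^ s               ∎)
    where
    open ≤-Reasoning
    lem : ∀ s p → s * (2 * p) ≡ p * (s + s)
    lem = solve-∀
    two : 2 * s ^ s ≤ suc s ^ s
    two = *-cancelˡ-≤ s (≤-trans (≤-reflexive (lem s (s ^ s))) (bernoulli s s))

  bin-halve^ : ∀ k x → m + s ≤ suc (2 * x) → bin m (x + k * s) * 2 ^ k ≤ 2 ^ m
  bin-halve^ zero x h = ≤-trans (≤-reflexive (*-identityʳ _)) (bin-≤ m (x + 0))
  bin-halve^ (suc k) x h = begin
    bin m (x + (s + k * s)) * (2 * 2 ^ k)  ≡⟨ cong₂ (λ u v → bin m u * v) (lem x s (k * s)) refl ⟩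
    bin m (x + k * s + s) * (2 * 2 ^ k)    ≡⟨ sym (*-assoc (bin m (x + k * s + s)) 2 (2 ^ k)) ⟩
    bin m (x + k * s + s) * 2 * 2 ^ k      ≤⟨ *-monoˡ-≤ (2 ^ k) (bin-halve (x + k * s) (≤-trans h (s≤s (*-monoʳ-≤ 2 (m≤m+n x (k * s)))))) ⟩
    bin m (x + k * s) * 2 ^ k              ≤⟨ bin-halve^ k x h ⟩
    2 ^ m                                  ∎
    where
    open ≤-Reasoning
    lem : ∀ a b c → a + (b + c) ≡ a + c + b
    lem = solve-∀

  -- Going back k * s positions from x still leaves a point where the halving applies, so k halvings
  -- separate the two.
  bin-tail : ∀ k x → m + s + 2 * (k * s) ≤ suc (2 * x) → bin m x * 2 ^ k ≤ 2 ^ m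
  bin-tail k x h = subst (λ z → bin m z * 2 ^ k ≤ 2 ^ m) (m∸n+n≡m ks≤x) (bin-halve^ k (x ∸ k * s)
    (+-cancelʳ-≤ (2 * (k * s)) _ _ (≤-trans h (≤-reflexive (cong suc (trans (cong (2 *_) (sym (m∸n+n≡m ks≤x)))
      (*-distribˡ-+ 2 (x ∸ k * s) (k * s))))))))
    where
    ks≤x : k * s ≤ x
    ks≤x with k * s ≤? x
    ... | yes p = p
    ... | no p = ⊥-elim (<⇒≱ (s≤s {suc (2 * x)} {suc (2 * x)} ≤-refl) (≤-trans (≤-trans (≤-reflexive (sym (*-suc 2 x)))
                   (≤-trans (*-monoʳ-≤ 2 (≰⇒> p)) (m≤n+m (2 * (k * s)) (m + s)))) h))

  bin-tail-left : ∀ k x → 2 * x + (s + 2 * (k * s)) ≤ suc m → bin m x * 2 ^ k ≤ 2 ^ m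
  bin-tail-left k x h = subst (λ z → z * 2 ^ k ≤ 2 ^ m) eq (bin-tail k (m ∸ x) (+-cancelʳ-≤ (2 * x) _ _ (begin
      m + s + 2 * (k * s) + 2 * x          ≡⟨ lem m s (2 * (k * s)) (2 * x) ⟩
      m + (2 * x + (s + 2 * (k * s)))      ≤⟨ +-monoʳ-≤ m h ⟩
      m + suc m                            ≡⟨ lem₂ m ⟩
      suc (2 * m)                          ≡⟨ cong (λ z → suc (2 * z)) (sym (m∸n+n≡m x≤m)) ⟩
      suc (2 * (m ∸ x + x))                ≡⟨ cong suc (*-distribˡ-+ 2 (m ∸ x) x) ⟩
      suc (2 * (m ∸ x)) + 2 * x            ∎)))
    where
    open ≤-Reasoning
    lem : ∀ m s a b → m + s + a + b ≡ m + (b + (s + a))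
    lem = solve-∀
    lem₂ : ∀ m → m + suc m ≡ suc (2 * m)
    lem₂ = solve-∀
    x≤m : x ≤ m
    x≤m = ≤-pred (≤-trans (≤-trans (≤-reflexive (+-comm 1 x)) (+-mono-≤ (m≤m+n x (x + 0)) (s≤s z≤n))) h)
    eq : bin m (m ∸ x) ≡ bin m x
    eq = trans (cong (λ z → bin z (m ∸ x)) (sym (m∸n+n≡m x≤m))) (trans (bin-sym (m ∸ x) x) (cong (λ z → bin z x) (m∸n+n≡m x≤m)))

-- Protocols and boxes

Box : Set
Box = List (List ℕ)

vol : Box → ℕ
vol [] = 1
vol (l ∷ F) = length l * vol F

sumB : Box → (List ℕ → ℕ) → ℕ
sumB [] φ = φ []
sumB (l ∷ F) φ = sumOf (λ x → sumB F (λ v → φ (x ∷ v))) l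

InBox : List ℕ → Box → Set
InBox [] [] = ⊤
InBox [] (_ ∷ _) = ⊥
InBox (_ ∷ _) [] = ⊥
InBox (x ∷ v) (l ∷ F) = x ∈ l × InBox v F

keep : (ℕ → Bool) → List ℕ → List ℕ
keep q [] = []
keep q (x ∷ l) = if q x then x ∷ keep q l else keep q l

-- Past the end of the box the coordinate is read as 0, so a failing test must produce an empty box.
restrict : ℕ → (ℕ → Bool) → Box → Box
restrict c q [] = if q 0 then [] else [] ∷ []
restrict zero q (l ∷ F) = keep q l ∷ F
restrict (suc c) q (l ∷ F) = l ∷ restrict c q F

-- A protocol in which every question concerns a single coordinate; its leaves are boxes.
data Prot : Set where
  ok fail : Prot
  ask     : ℕ → (ℕ → Bool) → Prot → Prot → Prot

run? : Prot → List ℕ → Bool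
run? ok v = true
run? fail v = false
run? (ask c q P Q) v = if q (nth 0 v c) then run? P v else run? Q v

okLeaves : Prot → Box → List Box
okLeaves ok F = F ∷ []
okLeaves fail F = []
okLeaves (ask c q P Q) F = okLeaves P (restrict c q F) ++ okLeaves Q (restrict c (not ∘ q) F)

leafCount : Prot → ℕ
leafCount ok = 1
leafCount fail = 1
leafCount (ask c q P Q) = leafCount P + leafCount Q

length-okLeaves : ∀ P F → length (okLeaves P F) ≤ leafCount P
length-okLeaves ok F = ≤-refl
length-okLeaves fail F = z≤n
length-okLeaves (ask c q P Q) F = ≤-trans (≤-reflexive (length-++ (okLeaves P (restrict c q F))))
  (+-mono-≤ (length-okLeaves P _) (length-okLeaves Q _))

sumB-cong : ∀ F {φ ψ : List ℕ → ℕ} → (∀ v → φ v ≡ ψ v) → sumB F φ ≡ sumB F ψ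
sumB-cong [] h = h []
sumB-cong (l ∷ F) h = sumOf-cong l λ x → sumB-cong F λ v → h (x ∷ v)

sumB-mono : ∀ F {φ ψ : List ℕ → ℕ} → (∀ v → InBox v F → φ v ≤ ψ v) → sumB F φ ≤ sumB F ψ
sumB-mono [] h = h [] tt
sumB-mono (l ∷ F) h = sumOf-mono l λ x x∈ → sumB-mono F λ v v∈ → h (x ∷ v) (x∈ , v∈)

sumB-*ˡ : ∀ F c (φ : List ℕ → ℕ) → sumB F (λ v → c * φ v) ≡ c * sumB F φ
sumB-*ˡ [] c φ = refl
sumB-*ˡ (l ∷ F) c φ = trans (sumOf-cong l λ x → sumB-*ˡ F c (λ v → φ (x ∷ v))) (sumOf-*ˡ c (λ x → sumB F (λ v → φ (x ∷ v))) l)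

sumB-1 : ∀ F → sumB F (λ _ → 1) ≡ vol F
sumB-1 [] = refl
sumB-1 (l ∷ F) = trans (sumOf-cong l λ _ → sumB-1 F) (sumOf-const (vol F) l)

sumB-0 : ∀ F → sumB F (λ _ → 0) ≡ 0
sumB-0 [] = refl
sumB-0 (l ∷ F) = trans (sumOf-cong l λ _ → sumB-0 F) (trans (sumOf-const 0 l) (*-zeroʳ (length l)))

sumB-split : ∀ c q F (φ ψ : List ℕ → ℕ) →
  sumB F (λ v → if q (nth 0 v c) then φ v else ψ v) ≡ sumB (restrict c q F) φ + sumB (restrict c (not ∘ q) F) ψ
sumB-split c q [] φ ψ with q 0
... | true = sym (+-identityʳ (φ []))
... | false = refl
sumB-split zero q (l ∷ F) φ ψ = go l
  where
  Φ Ψ : ℕ → ℕ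
  Φ x = sumB F (λ v → φ (x ∷ v))
  Ψ x = sumB F (λ v → ψ (x ∷ v))
  go : ∀ l → sumOf (λ x → sumB F (λ v → if q x then φ (x ∷ v) else ψ (x ∷ v))) l ≡
             sumOf Φ (keep q l) + sumOf Ψ (keep (not ∘ q) l)
  go [] = refl
  go (x ∷ l) with q x
  ... | true = trans (cong (Φ x +_) (go l)) (sym (+-assoc (Φ x) _ _))
  ... | false = trans (cong (Ψ x +_) (go l)) (lem (Ψ x) (sumOf Φ (keep q l)) (sumOf Ψ (keep (not ∘ q) l)))
    where
    lem : ∀ a b c → a + (b + c) ≡ b + (a + c)
    lem = solve-∀
sumB-split (suc c) q (l ∷ F) φ ψ = trans
  (sumOf-cong l λ x → sumB-split c q F (λ v → φ (x ∷ v)) (λ v → ψ (x ∷ v)))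
  (sumOf-add (λ x → sumB (restrict c q F) (λ v → φ (x ∷ v))) (λ x → sumB (restrict c (not ∘ q) F) (λ v → ψ (x ∷ v))) l)

-- The accepting leaves partition the accepted points. With this, soundness of a protocol becomes a
-- bound on the room its boxes take.
okLeaves-vol : ∀ P F → sumOf vol (okLeaves P F) ≡ sumB F (λ v → bit (run? P v))
okLeaves-vol ok F = trans (+-identityʳ (vol F)) (sym (sumB-1 F))
okLeaves-vol fail F = sym (sumB-0 F)
okLeaves-vol (ask c q P Q) F = begin
  sumOf vol (okLeaves P (restrict c q F) ++ okLeaves Q (restrict c (not ∘ q) F))
    ≡⟨ sumOf-++ vol (okLeaves P (restrict c q F)) _ ⟩
  sumOf vol (okLeaves P (restrict c q F)) + sumOf vol (okLeaves Q (restrict c (not ∘ q) F))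
    ≡⟨ cong₂ _+_ (okLeaves-vol P (restrict c q F)) (okLeaves-vol Q (restrict c (not ∘ q) F)) ⟩
  sumB (restrict c q F) (λ v → bit (run? P v)) + sumB (restrict c (not ∘ q) F) (λ v → bit (run? Q v))
    ≡⟨ sym (sumB-split c q F (λ v → bit (run? P v)) (λ v → bit (run? Q v))) ⟩
  sumB F (λ v → if q (nth 0 v c) then bit (run? P v) else bit (run? Q v))
    ≡⟨ sumB-cong F (λ v → eq (q (nth 0 v c)) v) ⟩
  sumB F (λ v → bit (if q (nth 0 v c) then run? P v else run? Q v)) ∎
  where
  open ≡-Reasoning
  eq : ∀ b v → (if b then bit (run? P v) else bit (run? Q v)) ≡ bit (if b then run? P v else run? Q v)
  eq true v = refl
  eq false v = refl

keep-∈ : ∀ (q : ℕ → Bool) {x l} → x ∈ l → q x ≡ true → x ∈ keep q l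
keep-∈ q {x} (here refl) h rewrite h = here refl
keep-∈ q {x} {y ∷ l} (there p) h with q y
... | true = there (keep-∈ q p h)
... | false = keep-∈ q p h

length-keep : ∀ q l → length (keep q l) ≤ length l
length-keep q [] = z≤n
length-keep q (x ∷ l) with q x
... | true = s≤s (length-keep q l)
... | false = m≤n⇒m≤1+n (length-keep q l)

restrict-InBox : ∀ c q v F → InBox v F → q (nth 0 v c) ≡ true → InBox v (restrict c q F)
restrict-InBox c q [] [] p h rewrite h = tt
restrict-InBox zero q (x ∷ v) (l ∷ F) (x∈ , p) h = keep-∈ q x∈ h , p
restrict-InBox (suc c) q (x ∷ v) (l ∷ F) (x∈ , p) h = x∈ , restrict-InBox c q v F p h

okLeaves-run : ∀ P v F → InBox v F → run? P v ≡ true → ∃ λ F′ → F′ ∈ okLeaves P F × InBox v F′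
okLeaves-run ok v F p h = F , here refl , p
okLeaves-run (ask c q P Q) v F p h with q (nth 0 v c) in eq
... | true with okLeaves-run P v (restrict c q F) (restrict-InBox c q v F p eq) h
...   | F′ , F′∈ , v∈ = F′ , ∈-++⁺ˡ F′∈ , v∈
okLeaves-run (ask c q P Q) v F p h | false
  with okLeaves-run Q v (restrict c (not ∘ q) F) (restrict-InBox c (not ∘ q) v F p (cong not eq)) h
... | F′ , F′∈ , v∈ = F′ , ∈-++⁺ʳ (okLeaves P (restrict c q F)) F′∈ , v∈

side : Box → ℕ → ℕ
side F c = length (nth [] F c)

side-restrict : ∀ c q F k → side (restrict c q F) k ≤ side F k
side-restrict c q [] k with q 0
side-restrict c q [] k | true = z≤n
side-restrict c q [] zero | false = z≤n
side-restrict c q [] (suc k) | false = z≤n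
side-restrict zero q (l ∷ F) zero = length-keep q l
side-restrict zero q (l ∷ F) (suc k) = ≤-refl
side-restrict (suc c) q (l ∷ F) zero = ≤-refl
side-restrict (suc c) q (l ∷ F) (suc k) = side-restrict c q F k

side-okLeaves : ∀ P F {F′} → F′ ∈ okLeaves P F → ∀ k → side F′ k ≤ side F k
side-okLeaves ok F (here refl) k = ≤-refl
side-okLeaves (ask c q P Q) F p k with ∈-++⁻ (okLeaves P (restrict c q F)) p
... | inj₁ p′ = ≤-trans (side-okLeaves P _ p′ k) (side-restrict c q F k)
... | inj₂ p′ = ≤-trans (side-okLeaves Q _ p′ k) (side-restrict c (not ∘ q) F k)

InBox-nth : ∀ v F c → InBox v F → c < length F → nth 0 v c ∈ nth [] F c
InBox-nth (x ∷ v) (l ∷ F) zero (x∈ , _) _ = x∈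
InBox-nth (x ∷ v) (l ∷ F) (suc c) (_ , p) (s≤s lt) = InBox-nth v F c p lt

InBox-length : ∀ v F → InBox v F → length v ≡ length F
InBox-length [] [] p = refl
InBox-length (x ∷ v) (l ∷ F) (_ , p) = cong suc (InBox-length v F p)

-- Packing fields into words

-- Fields v 0, v 1, … with v j < f j are stored in words of 2a bits: word j consists of the high part of
-- v j and the low part of v (j + 1), with radices chosen so that almost nothing is lost, so that each field is
-- recovered from two words.
module Chain (a : ℕ) (f : ℕ → ℕ) where

  A : ℕ
  A = a + a

  -- `cap j` is what remains of 2^A once the range of `hi j` is provided for, so each radix is
  -- dictated by the preceding field. The predecessor is defined so that `cap` is a successor and
  -- may always be divided by.
  hi-bound cap⁻ : ℕ → ℕ
  hi-bound zero = sh a (f 0)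
  hi-bound (suc j) = f (suc j) / suc (cap⁻ j)
  cap⁻ j = pred (2 ^ A / suc (hi-bound j))

  cap : ℕ → ℕ
  cap j = suc (cap⁻ j)

  module Fields (v : ℕ → ℕ) where
    hi word : ℕ → ℕ
    hi zero = sh a (v 0)
    hi (suc j) = v (suc j) / cap j
    word j = pair (cap j) (pfst (cap j) (v (suc j))) (hi j)

    hi-≤ : ∀ j → v j ≤ f j → hi j ≤ hi-bound j
    hi-≤ zero h = sh-mono a h
    hi-≤ (suc j) h = /-monoˡ-≤ (cap j) h

    hi-word : ∀ j → psnd (cap j) (word j) ≡ hi j
    hi-word j = psnd-pair (cap j) _ (hi j) (pfst-< (cap j) (v (suc j)))

  -- Two pieces have no word: `lo₀`, the low part of field 0, and `top`, the high part of the last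
  -- field. They are kept in the state. `w₋` and `w₀` are the words before and at the position.
  field-of : ℕ → ℕ → ℕ → ℕ → ℕ → ℕ → ℕ
  field-of last lo₀ top zero w₋ w₀ = (if 0 ≡ᵇ last then top else psnd (cap 0) w₀) * 2 ^ a + lo₀
  field-of last lo₀ top (suc j) w₋ w₀ =
    pair (cap j) (pfst (cap j) w₋) (if suc j ≡ᵇ last then top else psnd (cap (suc j)) w₀)

  module _ (v : ℕ → ℕ) (last : ℕ) where
    open Fields v

    private
      top-or-word : ∀ p w₀ → (p < last → w₀ ≡ word p) → p ≤ last →
        (if p ≡ᵇ last then hi last else psnd (cap p) w₀) ≡ hi p
      top-or-word p w₀ h p≤ with m≤n⇒m<n∨m≡n p≤
      ... | inj₂ refl rewrite ≡ᵇ-self p = refl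
      ... | inj₁ lt with p ≡ᵇ last in eq
      ...   | true = cong hi (sym (≡ᵇ-true⇒≡ {p} {last} eq))
      ...   | false = trans (cong (psnd (cap p)) (h lt)) (hi-word p)

    field-of-correct : ∀ p w₋ w₀ → p ≤ last → (∀ j → p ≡ suc j → w₋ ≡ word j) → (p < last → w₀ ≡ word p) →
      field-of last (low a (v 0)) (hi last) p w₋ w₀ ≡ v p
    field-of-correct zero w₋ w₀ p≤ _ h rewrite top-or-word zero w₀ h p≤ = low-eq a (v 0)
    field-of-correct (suc j) w₋ w₀ p≤ g h rewrite top-or-word (suc j) w₀ h p≤ | g j refl
      | pfst-pair (cap j) (pfst (cap j) (v (suc j))) (hi j) (pfst-< (cap j) (v (suc j))) = pair-eq (cap j) (v (suc j))

  module Bounds (w b′ : ℕ) (small : 3 * suc b′ + 2 ≤ w) (w≤a : w ≤ a) (f≤ : ∀ j → j ≤ b′ → f j ≤ 2 ^ suc A) where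

    private
      S : ℕ → ℕ
      S j = suc (hi-bound j)

      exp≤ : ∀ j → j ≤ b′ → a + 2 + 3 * j ≤ a + w
      exp≤ j j≤ = ≤-trans (≤-reflexive (+-assoc a 2 (3 * j))) (+-monoʳ-≤ a
        (≤-trans (≤-trans (≤-reflexive (+-comm 2 (3 * j))) (+-monoˡ-≤ 2 (*-monoʳ-≤ 3 (m≤n⇒m≤1+n j≤)))) small))

      cap-≡ : ∀ j → S j ≤ 2 ^ A → cap j ≡ 2 ^ A / S j
      cap-≡ j h = suc-pred (2 ^ A / S j) {{>-nonZero (m≥n⇒m/n>0 h)}}

      cap-lower : ∀ j → S j ≤ 2 ^ A → cap j * S j ≤ 2 ^ A
      cap-lower j h = subst (λ c → c * S j ≤ 2 ^ A) (sym (cap-≡ j h)) (m/n*n≤m (2 ^ A) (S j))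

      cap-upper : ∀ j → S j ≤ 2 ^ A → 2 ^ A ≤ S j + cap j * S j
      cap-upper j h = subst (λ c → 2 ^ A ≤ S j + c * S j) (sym (cap-≡ j h)) (≤-trans (≤-reflexive (m≡m%n+[m/n]*n (2 ^ A) (S j)))
        (+-monoˡ-≤ (2 ^ A / S j * S j) (<⇒≤ (m%n<n (2 ^ A) (S j)))))

      a+w≤A : a + w ≤ A
      a+w≤A = +-monoʳ-≤ a w≤a

    -- Each step costs at most three bits: one because fields may reach 2^(A + 1), one for rounding
    -- `cap` down, one for the successor.
    S-bound′ : ∀ j → j ≤ b′ → S j ≤ 2 ^ (a + 2 + 3 * j)
    S-bound′ zero _ = ≤-trans (≤-trans (≤-reflexive (+-comm 1 (sh a (f 0))))
        (2^+2^≤ {m = suc a} {n = suc a} (sh-pow a (suc a) (f 0) (f≤ 0 z≤n)) (2^>0 (suc a)) ≤-refl))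
        (2^-mono (≤-reflexive (lem a)))
      where
      lem : ∀ a → suc (suc a) ≡ a + 2 + 0
      lem = solve-∀
    S-bound′ (suc j) j< = ≤-trans (s≤s q≤) (≤-trans (≤-reflexive (+-comm 1 _))
        (≤-trans (2^+2^≤ {m = e + 2} {n = e + 2} (≤-trans (≤-reflexive (*-comm 4 (2 ^ e))) (≤-reflexive (sym (2^-+ e 2)))) (2^>0 (e + 2)) ≤-refl)
        (2^-mono (≤-reflexive (lem₀ a j)))))
      where
      open ≤-Reasoning
      e = a + 2 + 3 * j
      lem₀ : ∀ a j → suc (a + 2 + 3 * j + 2) ≡ a + 2 + 3 * suc j
      lem₀ = solve-∀
      IH = S-bound′ j (<⇒≤ j<)
      SA : S j ≤ 2 ^ A
      SA = ≤-trans IH (2^-mono (≤-trans (exp≤ j (<⇒≤ j<)) a+w≤A))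
      q = f (suc j) / cap j
      q≤ : q ≤ 4 * 2 ^ e
      q≤ = *-cancelʳ-≤ q (4 * 2 ^ e) (2 ^ A) {{m^n≢0 2 A}} (begin
        q * 2 ^ A                          ≤⟨ *-monoʳ-≤ q (cap-upper j SA) ⟩
        q * (S j + cap j * S j)            ≤⟨ *-monoʳ-≤ q (+-monoˡ-≤ (cap j * S j) (m≤n*m (S j) (cap j))) ⟩
        q * (cap j * S j + cap j * S j)    ≡⟨ lem q (cap j) (S j) ⟩
        2 * (q * cap j) * S j              ≤⟨ *-mono-≤ (*-monoʳ-≤ 2 (m/n*n≤m (f (suc j)) (cap j))) IH ⟩
        2 * f (suc j) * 2 ^ e              ≤⟨ *-monoˡ-≤ (2 ^ e) (*-monoʳ-≤ 2 (f≤ (suc j) j<)) ⟩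
        2 * (2 * 2 ^ A) * 2 ^ e            ≡⟨ lem₂ (2 ^ A) (2 ^ e) ⟩
        4 * 2 ^ e * 2 ^ A                  ∎)
        where
        lem : ∀ q c s → q * (c * s + c * s) ≡ 2 * (q * c) * s
        lem = solve-∀
        lem₂ : ∀ x y → 2 * (2 * x) * y ≡ 4 * y * x
        lem₂ = solve-∀

    S-bound : ∀ j → j ≤ b′ → S j ≤ 2 ^ (a + w)
    S-bound j j≤ = ≤-trans (S-bound′ j j≤) (2^-mono (exp≤ j j≤))

    word-< : ∀ v j → j < b′ → v j ≤ f j → Fields.word v j < 2 ^ A
    word-< v j j< h = <-≤-trans (pair-< (pfst-< (cap j) (v (suc j))) (s≤s (Fields.hi-≤ v j h)))
      (cap-lower j (≤-trans (S-bound j (<⇒≤ j<)) (2^-mono a+w≤A)))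

    volume-step : ∀ j → j ≤ b′ → 2 ^ a * (2 ^ (A * j) * S j) ≤ prodTo f (suc j) + 2 ^ (a + A * j + (3 * w + 2 * j))
    volume-step zero _ = begin
      2 ^ a * (2 ^ (A * 0) * S 0)       ≡⟨ cong (λ z → 2 ^ a * (2 ^ z * S 0)) (*-zeroʳ A) ⟩
      2 ^ a * (1 * S 0)                 ≡⟨ lem (2 ^ a) (sh a (f 0)) ⟩
      sh a (f 0) * 2 ^ a + 2 ^ a        ≤⟨ +-mono-≤ (sh-lower a (f 0)) (2^-mono (≤-trans (m≤m+n a (A * 0)) (m≤m+n _ _))) ⟩
      f 0 + 2 ^ (a + A * 0 + (3 * w + 2 * 0)) ≡⟨ cong (_+ 2 ^ (a + A * 0 + (3 * w + 2 * 0))) (sym (*-identityˡ (f 0))) ⟩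
      1 * f 0 + 2 ^ (a + A * 0 + (3 * w + 2 * 0)) ∎
      where
      open ≤-Reasoning
      lem : ∀ p x → p * (1 * suc x) ≡ x * p + p
      lem = solve-∀
    volume-step (suc j) j< = begin
      2 ^ a * (2 ^ (A * suc j) * S (suc j))
        ≡⟨ cong (λ z → 2 ^ a * (z * S (suc j))) (trans (cong (2 ^_) (*-suc A j)) (2^-+ A (A * j))) ⟩
      2 ^ a * (2 ^ A * 2 ^ (A * j) * S (suc j))
        ≡⟨ lem₁ (2 ^ a) (2 ^ A) (2 ^ (A * j)) (S (suc j)) ⟩
      2 ^ a * 2 ^ (A * j) * (2 ^ A * S (suc j))
        ≤⟨ *-monoʳ-≤ (2 ^ a * 2 ^ (A * j)) main ⟩
      2 ^ a * 2 ^ (A * j) * (F * S j + 2 ^ (suc (A + 2 * w)))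
        ≡⟨ lem₂ (2 ^ a) (2 ^ (A * j)) F (S j) (2 ^ (suc (A + 2 * w))) ⟩
      2 ^ a * (2 ^ (A * j) * S j) * F + 2 ^ a * 2 ^ (A * j) * 2 ^ (suc (A + 2 * w))
        ≤⟨ +-mono-≤ (*-monoˡ-≤ F (volume-step j (<⇒≤ j<))) (≤-reflexive (trans (cong (_* 2 ^ (suc (A + 2 * w))) (sym (2^-+ a (A * j)))) (sym (2^-+ (a + A * j) (suc (A + 2 * w)))))) ⟩
      (prodTo f (suc j) + 2 ^ E) * F + 2 ^ (a + A * j + suc (A + 2 * w))
        ≡⟨ lem₃ (prodTo f (suc j)) (2 ^ E) F (2 ^ (a + A * j + suc (A + 2 * w))) ⟩
      prodTo f (suc j) * F + (2 ^ (a + A * j + suc (A + 2 * w)) + 2 ^ E * F)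
        ≤⟨ +-monoʳ-≤ (prodTo f (suc j) * F) (≤-trans (2^+2^≤ {m = a + A * j + suc (A + 2 * w)} {n = E + suc A} ≤-refl
             (2^*2^≤ E (suc A) ≤-refl (f≤ (suc j) j<) ≤-refl) (≤-add (w + 2 * j) (lem₄ a A j w)))
             (2^-mono (≤-add 0 (lem₅ a A j w)))) ⟩
      prodTo f (suc j) * F + 2 ^ (a + A * suc j + (3 * w + 2 * suc j)) ∎
      where
      open ≤-Reasoning
      F = f (suc j)
      E = a + A * j + (3 * w + 2 * j)
      q = F / cap j
      lem₁ : ∀ p x y s → p * (x * y * s) ≡ p * y * (x * s)
      lem₁ = solve-∀
      lem₂ : ∀ p y f s t → p * y * (f * s + t) ≡ p * (y * s) * f + p * y * t
      lem₂ = solve-∀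
      lem₃ : ∀ x e f t → (x + e) * f + t ≡ x * f + (t + e * f)
      lem₃ = solve-∀
      lem₄ : ∀ a A j w → a + A * j + (3 * w + 2 * j) + suc A ≡ a + A * j + suc (A + 2 * w) + (w + 2 * j)
      lem₄ = solve-∀
      lem₅ : ∀ a A j w → a + A * suc j + (3 * w + 2 * suc j) ≡ suc (a + A * j + (3 * w + 2 * j) + suc A) + 0
      lem₅ = solve-∀
      SA : S j ≤ 2 ^ A
      SA = ≤-trans (S-bound j (<⇒≤ j<)) (2^-mono a+w≤A)
      -- Rounding the quotient up costs 2^A and rounding `cap` down costs q * `S j`. Both are at
      -- most 2^(A + 2w), since high parts have only a + w bits.
      main : 2 ^ A * S (suc j) ≤ F * S j + 2 ^ (suc (A + 2 * w))
      main = begin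
        2 ^ A * suc q                            ≡⟨ l₁ (2 ^ A) q ⟩
        q * 2 ^ A + 2 ^ A                        ≤⟨ +-monoˡ-≤ (2 ^ A) (*-monoʳ-≤ q (cap-upper j SA)) ⟩
        q * (S j + cap j * S j) + 2 ^ A          ≡⟨ l₂ q (S j) (cap j) (2 ^ A) ⟩
        q * cap j * S j + (2 ^ A + q * S j)      ≤⟨ +-mono-≤ (*-monoˡ-≤ (S j) (m/n*n≤m F (cap j)))
                                                     (2^+2^≤ {m = A} {n = A + 2 * w} ≤-refl
                                                       (2^*2^≤ (a + w) (a + w) (≤-trans (n≤1+n q) (S-bound (suc j) j<)) (S-bound j (<⇒≤ j<)) (≤-reflexive (l₃ a w)))
                                                       (m≤m+n A _)) ⟩
        F * S j + 2 ^ (suc (A + 2 * w))          ∎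
        where
        l₁ : ∀ p q → p * suc q ≡ q * p + p
        l₁ = solve-∀
        l₂ : ∀ q s c p → q * (s + c * s) + p ≡ q * c * s + (p + q * s)
        l₂ = solve-∀
        l₃ : ∀ a w → a + w + (a + w) ≡ a + a + 2 * w
        l₃ = solve-∀

    -- The error is additive and does not depend on the fields, so even an empty box pays it; this
    -- is why the number of keys has to be bounded.
    volume : 2 ^ a * S b′ * 2 ^ (A * b′) ≤ prodTo f (suc b′) + 2 ^ (a + 4 * w + A * b′)
    volume = ≤-trans (≤-reflexive (lem (2 ^ a) (S b′) (2 ^ (A * b′)))) (≤-trans (volume-step b′ ≤-refl)
      (+-monoʳ-≤ _ (2^-mono (≤-trans (+-monoʳ-≤ (a + A * b′) (+-monoʳ-≤ (3 * w) 2b≤w)) (≤-reflexive (lem₂ a (A * b′) w))))))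
      where
      lem : ∀ p s y → p * s * y ≡ p * (y * s)
      lem = solve-∀
      lem₂ : ∀ a x w → a + x + (3 * w + w) ≡ a + 4 * w + x
      lem₂ = solve-∀
      lem₃ : ∀ b → 3 * suc b + 2 ≡ 2 * b + (b + 5)
      lem₃ = solve-∀
      2b≤w : 2 * b′ ≤ w
      2b≤w = ≤-trans (≤-add (b′ + 5) (lem₃ b′)) small

-- Label distributions of the children of a node

opaque
  -- The distribution is cut after 20 w halvings, each spanning 16 blocks; the tail lemmas count
  -- them twice, in 2x, which gives 640 w blocks. The constant pays for the first step of 16 blocks
  -- and for rounding.
  width : ℕ → ℕ
  width w = 640 * w + 20

  width-≡ : ∀ w → width w ≡ 640 * w + 20
  width-≡ w = refl

  -- Twice 16 w, the saving of one exceptional child, so that two of them reach the limit set for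
  -- refinements.
  fuel : ℕ → ℕ
  fuel w = 32 * w

  fuel-≡ : ∀ w → fuel w ≡ 32 * w
  fuel-≡ w = refl

opaque
  300w≤2a : ∀ w a → 150 * w ≤ a → 300 * w ≤ a + a
  300w≤2a w a h = ≤-trans (≤-reflexive (lem w)) (+-mono-≤ h h)
    where
    lem : ∀ w → 300 * w ≡ 150 * w + 150 * w
    lem = solve-∀

module Params (w a : ℕ) where
  A : ℕ
  A = a + a

  -- The inverse of the relative waste allowed at a node.
  D : ℕ
  D = 2 ^ (20 * w)

  W : ℕ
  W = width w

  -- The states below K of a subtree, split into good ones, indexed by the label x and j < good (suc x), and
  -- few bad ones, indexed by x and j < bad (suc x).  The distribution of the good ones is smooth at scale 2 ^ d
  -- and supported in W blocks of size 2 ^ d.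
  record Child (d : ℕ) : Set where
    field
      K m      : ℕ
      lab      : ℕ → ℕ
      good bad : ℕ → ℕ
      state    : Bool → ℕ → ℕ → ℕ
      badState : ℕ → ℕ
      G Z lo   : ℕ
      classify : ∀ σ → σ < K → lab σ ≤ m →
                 (∃ λ j → j < good (suc (lab σ)) × state false (suc (lab σ)) j ≡ σ) ⊎
                 ((∃ λ j → j < bad (suc (lab σ)) × state true (suc (lab σ)) j ≡ σ) × (∃ λ ζ → ζ < Z × badState ζ ≡ σ))
      good-0   : good 0 ≡ 0
      bad-0    : bad 0 ≡ 0
      good-sum : ∀ n → sumTo good n ≤ G
      bad-sum  : ∀ n → sumTo bad n ≤ Z
      total    : G + Z ≤ K
      K-lower  : 2 ^ A ≤ K
      K-upper  : K ≤ 2 ^ suc A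
      Z-small  : Z ≤ 2 ^ (A ∸ 18 * w)
      smooth   : ∀ z → Close (2 ^ (A ∸ (1 + 2 * d))) (good z) (good (suc z))
      good-max : ∀ z → good z ≤ 2 ^ (suc A ∸ d)
      support  : ∀ x → 0 < good (suc x) → lo ≤ sh d x × suc (sh d x) < lo + W

Close-iter : ∀ (g : ℕ → ℕ) δ → (∀ z → Close δ (g z) (g (suc z))) → ∀ z i → Close (i * δ) (g z) (g (i + z))
Close-iter g δ h z zero = m≤m+n _ _ , m≤m+n _ _
Close-iter g δ h z (suc i) with Close-iter g δ h z i | h (i + z)
... | p , q | p′ , q′ =
  ≤-trans p (≤-trans (+-monoˡ-≤ (i * δ) p′) (≤-reflexive (+-assoc (g (suc i + z)) δ (i * δ)))) ,
  ≤-trans q′ (≤-trans (+-monoˡ-≤ δ q) (≤-reflexive (trans (+-assoc (g z) (i * δ) δ) (cong (g z +_) (+-comm (i * δ) δ)))))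

sum-indicator : ∀ v n → (n ≤ v → sumTo (λ x → bit (v ≡ᵇ x)) n ≡ 0) × sumTo (λ x → bit (v ≡ᵇ x)) n ≤ 1
sum-indicator v zero = (λ _ → refl) , z≤n
sum-indicator v (suc n) with sum-indicator v n | v ≡ᵇ n in eq
... | p , q | true = (λ n< → ⊥-elim (<⇒≢ n< (sym v≡n))) , ≤-reflexive (cong suc (p (≤-reflexive (sym v≡n))))
  where
  v≡n : v ≡ n
  v≡n = ≡ᵇ-true⇒≡ {v} {n} eq
... | p , q | false = (λ n< → p (<⇒≤ n<)) , q

length-keep-∷ : ∀ q y l → length (keep q (y ∷ l)) ≡ bit (q y) + length (keep q l)
length-keep-∷ q y l with q y
... | true = refl
... | false = refl

sum-fibres : ∀ (lab : ℕ → ℕ) l n → sumTo (λ x → length (keep (λ σ → lab σ ≡ᵇ x) l)) n ≤ length l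
sum-fibres lab [] n = ≤-reflexive (trans (sumOf-const 0 (downFrom n)) (*-zeroʳ (length (downFrom n))))
sum-fibres lab (y ∷ l) n = begin
  sumTo (λ x → length (keep (λ σ → lab σ ≡ᵇ x) (y ∷ l))) n
    ≡⟨ sumTo-cong n (λ x _ → length-keep-∷ (λ σ → lab σ ≡ᵇ x) y l) ⟩
  sumTo (λ x → bit (lab y ≡ᵇ x) + length (keep (λ σ → lab σ ≡ᵇ x) l)) n
    ≡⟨ sumOf-add (λ x → bit (lab y ≡ᵇ x)) (λ x → length (keep (λ σ → lab σ ≡ᵇ x) l)) (downFrom n) ⟩
  sumTo (λ x → bit (lab y ≡ᵇ x)) n + sumTo (λ x → length (keep (λ σ → lab σ ≡ᵇ x) l)) n
    ≤⟨ +-mono-≤ (proj₂ (sum-indicator (lab y) n)) (sum-fibres lab l n) ⟩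
  suc (length l) ∎
  where open ≤-Reasoning

-- A label x is addressed as x + 1. Argument 0 is what `suc y′ ∸ y` gives for y′ < y, and it must
-- carry no mass.
shift0 : (ℕ → ℕ) → ℕ → ℕ
shift0 g zero = 0
shift0 g (suc x) = g x

sum-shift0 : ∀ g N → (∀ x → N ≤ x → g x ≡ 0) → ∀ n → sumTo (shift0 g) n ≤ sumTo g N
sum-shift0 g N h zero = z≤n
sum-shift0 g N h (suc n) = ≤-trans (≤-reflexive (sumTo-left (shift0 g) n)) (le n)
  where
  le : ∀ n → sumTo g n ≤ sumTo g N
  le zero = z≤n
  le (suc n) with suc n ≤? N
  ... | yes p = sumTo-≤-total g p
  ... | no p = ≤-trans (≤-reflexive (cong (_+ sumTo g n) (h n (≤-pred (≰⇒> p))))) (le n)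

-- The smooth part of the states of a subtree

module ChildBuild (w a : ℕ) (w≥ : 2 ≤ w) (a≥ : 150 * w ≤ a)
                  (d m K : ℕ) (lab : ℕ → ℕ)
                  (A≤m : Params.A w a ≤ m) (m< : m < 2 ^ w) (m-lower : 2 ^ (5 + 2 * d) ≤ m) (m-upper : m ≤ 2 ^ (8 + 2 * d))
                  (K-up : K * Params.D w a ≤ 2 ^ Params.A w a * (Params.D w a + 2 * m))
                  (fibre≥ : ∀ x → bin m x ≤ length (keep (λ σ → lab σ ≡ᵇ x) (downFrom K)) * 2 ^ (m ∸ Params.A w a)) where
  open Params w a

  private
    M τ : ℕ
    M = m ∸ A
    τ = 2 ^ (A ∸ 20 * w)

    A+M : A + M ≡ m
    A+M = m+[n∸m]≡n A≤m

    300w≤A : 300 * w ≤ A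
    300w≤A = 300w≤2a w a a≥

    kw≤A : ∀ k → k ≤ 300 → k * w ≤ A
    kw≤A k h = ≤-trans (*-monoˡ-≤ w h) 300w≤A

    d≤w : 5 + 2 * d ≤ w
    d≤w with 5 + 2 * d ≤? w
    ... | yes p = p
    ... | no p = ⊥-elim (<⇒≱ m< (≤-trans (2^-mono (<⇒≤ (≰⇒> p))) m-lower))

    d-room : 5 + 2 * d ≤ A
    d-room = ≤-trans d≤w (≤-trans (≤-reflexive (sym (*-identityˡ w))) (kw≤A 1 (s≤s z≤n)))

    fib : ℕ → List ℕ
    fib x = keep (λ σ → lab σ ≡ᵇ x) (downFrom K)

    -- `c` counts the states of a label and may be irregular. `g` is a scaled binomial that lies
    -- below it, hence smooth in any case; subtracting `τ` makes it vanish in the tails and at label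
    -- 0. The states in excess of `g` become the bad ones.
    c g : ℕ → ℕ
    c x = length (fib x)
    g x = sh M (bin m x) ∸ τ

    g≤c : ∀ x → g x ≤ c x
    g≤c x = ≤-trans (m∸n≤m _ τ) (≤-trans (sh-mono M (fibre≥ x))
      (≤-reflexive (trans (cong (sh M) (sym (+-identityʳ (c x * 2 ^ M)))) (sh-unique M (c x) 0 (2^>0 M)))))

    g-out : ∀ x → suc m ≤ x → g x ≡ 0
    g-out x h = trans (cong (λ z → sh M z ∸ τ) (bin-> m x h)) (trans (cong (_∸ τ) (n≤0⇒n≡0 (sh-≤ M 0))) (0∸n≡0 τ))

    b : ℕ → ℕ
    b x with x ≤? m
    ... | yes _ = c x ∸ g x
    ... | no _ = 0

    b-in : ∀ x → x ≤ m → b x ≡ c x ∸ g x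
    b-in x h with x ≤? m
    ... | yes _ = refl
    ... | no p = ⊥-elim (p h)

    b-out : ∀ x → suc m ≤ x → b x ≡ 0
    b-out x h with x ≤? m
    ... | yes p = ⊥-elim (<⇒≱ h p)
    ... | no _ = refl

    badList : List ℕ
    badList = concatMap (λ x → drop (g x) (fib x)) (downFrom (suc m))

    Z₀ : ℕ
    Z₀ = sumTo b (suc m)

    badList-length : length badList ≡ Z₀
    badList-length = trans (length-concatMap (λ x → drop (g x) (fib x)) (downFrom (suc m)))
      (sumTo-cong (suc m) λ x x< → trans (length-drop (g x) (fib x)) (sym (b-in x (≤-pred x<))))

    sums : sumTo g (suc m) + Z₀ ≤ K
    sums = begin
      sumTo g (suc m) + Z₀          ≡⟨ sym (sumOf-add g b (downFrom (suc m))) ⟩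
      sumTo (λ x → g x + b x) (suc m) ≡⟨ sumTo-cong (suc m) (λ x x< → trans (cong (g x +_) (b-in x (≤-pred x<))) (m+[n∸m]≡n (g≤c x))) ⟩
      sumTo c (suc m)               ≤⟨ sum-fibres lab (downFrom K) (suc m) ⟩
      length (downFrom K)           ≡⟨ length-downFrom K ⟩
      K                             ∎
      where open ≤-Reasoning

    sum-sh : 2 ^ A ≤ sumTo (λ x → sh M (bin m x)) (suc m) + suc m
    sum-sh = *-cancelʳ-≤ _ _ (2 ^ M) {{m^n≢0 2 M}} (begin
      2 ^ A * 2 ^ M                               ≡⟨ sym (2^-+ A M) ⟩
      2 ^ (A + M)                                 ≡⟨ cong (2 ^_) A+M ⟩
      2 ^ m                                       ≡⟨ sym (bin-sum m) ⟩
      sumTo (bin m) (suc m)                       ≤⟨ sumTo-mono (suc m) (λ x _ → <⇒≤ (sh-upper M (bin m x))) ⟩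
      sumTo (λ x → sh M (bin m x) * 2 ^ M + 2 ^ M) (suc m)
        ≡⟨ sumOf-add (λ x → sh M (bin m x) * 2 ^ M) (λ _ → 2 ^ M) (downFrom (suc m)) ⟩
      sumTo (λ x → sh M (bin m x) * 2 ^ M) (suc m) + sumTo (λ _ → 2 ^ M) (suc m)
        ≡⟨ cong₂ _+_ (sumOf-*ʳ (2 ^ M) (λ x → sh M (bin m x)) (downFrom (suc m)))
             (trans (sumOf-const (2 ^ M) (downFrom (suc m))) (cong (_* 2 ^ M) (length-downFrom (suc m)))) ⟩
      sumTo (λ x → sh M (bin m x)) (suc m) * 2 ^ M + suc m * 2 ^ M
        ≡⟨ sym (*-distribʳ-+ (2 ^ M) (sumTo (λ x → sh M (bin m x)) (suc m)) (suc m)) ⟩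
      (sumTo (λ x → sh M (bin m x)) (suc m) + suc m) * 2 ^ M ∎)
      where open ≤-Reasoning

    sum-g : 2 ^ A ≤ sumTo g (suc m) + suc m * suc τ
    sum-g = ≤-trans sum-sh (≤-trans (+-monoˡ-≤ (suc m) (≤-trans
      (sumTo-mono (suc m) λ x _ → m≤n+m∸n (sh M (bin m x)) τ)
      (≤-reflexive (trans (sumOf-add (λ _ → τ) g (downFrom (suc m)))
        (cong (_+ sumTo g (suc m)) (trans (sumOf-const τ (downFrom (suc m))) (cong (_* τ) (length-downFrom (suc m)))))))))
      (≤-reflexive (lem (suc m) τ (sumTo g (suc m)))))
      where
      lem : ∀ m t s → m * t + s + m ≡ s + m * suc t
      lem = solve-∀

    pow20 : 2 ^ A ≡ 2 ^ (A ∸ 20 * w) * 2 ^ (20 * w)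
    pow20 = trans (cong (2 ^_) (sym (m∸n+n≡m (kw≤A 20 (m≤m+n 20 280))))) (2^-+ (A ∸ 20 * w) (20 * w))

    K-bound : K ≤ 2 ^ A + 2 * m * τ
    K-bound = *-cancelʳ-≤ K _ D {{m^n≢0 2 (20 * w)}} (≤-trans K-up (≤-reflexive
      (trans (*-distribˡ-+ (2 ^ A) D (2 * m)) (trans (cong (2 ^ A * D +_) (cong (_* (2 * m)) pow20))
        (lem (2 ^ A) D τ (2 * m))))))
      where
      lem : ∀ p D t m → p * D + t * D * m ≡ (p + m * t) * D
      lem = solve-∀

    τ-exp : 2 + w + (A ∸ 20 * w) ≤ A ∸ 18 * w
    τ-exp = +-cancelʳ-≤ (18 * w) _ _ (≤-trans (+-monoˡ-≤ (18 * w) (+-monoˡ-≤ (A ∸ 20 * w) (+-monoˡ-≤ w w≥)))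
      (≤-trans (≤-reflexive (trans (lem w (A ∸ 20 * w)) (m∸n+n≡m (kw≤A 20 (m≤m+n 20 280)))))
      (≤-reflexive (sym (m∸n+n≡m (kw≤A 18 (m≤m+n 18 282)))))))
      where
      lem : ∀ w x → w + w + x + 18 * w ≡ x + 20 * w
      lem = solve-∀

    -- The origin of 18 w: the excess of `K` over 2^A and the loss of about `τ` at each of at most
    -- 2^w labels sum to 4 * 2^w * `τ`, where `τ` = 2^(A - 20 w) and 2 + w ≤ 2w.
    error : 2 * m * τ + suc m * suc τ ≤ 2 ^ (A ∸ 18 * w)
    error = ≤-trans (+-mono-≤ p q) (≤-trans (≤-reflexive (lem (2 ^ w) τ)) (≤-trans (≤-reflexive
        (trans (cong (4 *_) (sym (2^-+ w (A ∸ 20 * w)))) (sym (2^-+ 2 (w + (A ∸ 20 * w)))))) (2^-mono τ-exp)))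
      where
      p : 2 * m * τ ≤ 2 * 2 ^ w * τ
      p = *-monoˡ-≤ τ (*-monoʳ-≤ 2 (<⇒≤ m<))
      q : suc m * suc τ ≤ 2 ^ w * (2 * τ)
      q = *-mono-≤ m< (≤-trans (+-monoˡ-≤ τ (2^>0 (A ∸ 20 * w))) (≤-reflexive (cong (τ +_) (sym (+-identityʳ τ)))))
      lem : ∀ x t → 2 * x * t + x * (2 * t) ≡ 4 * (x * t)
      lem = solve-∀

    Z-small₀ : Z₀ ≤ 2 ^ (A ∸ 18 * w)
    Z-small₀ = +-cancelˡ-≤ (2 ^ A) _ _ (begin
      2 ^ A + Z₀                                          ≤⟨ +-monoˡ-≤ Z₀ sum-g ⟩
      sumTo g (suc m) + suc m * suc τ + Z₀                ≡⟨ lem (sumTo g (suc m)) (suc m * suc τ) Z₀ ⟩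
      sumTo g (suc m) + Z₀ + suc m * suc τ                ≤⟨ +-monoˡ-≤ (suc m * suc τ) (≤-trans sums K-bound) ⟩
      2 ^ A + 2 * m * τ + suc m * suc τ                   ≡⟨ +-assoc (2 ^ A) (2 * m * τ) (suc m * suc τ) ⟩
      2 ^ A + (2 * m * τ + suc m * suc τ)                 ≤⟨ +-monoʳ-≤ (2 ^ A) error ⟩
      2 ^ A + 2 ^ (A ∸ 18 * w)                            ∎)
      where
      open ≤-Reasoning
      lem : ∀ a b c → a + b + c ≡ a + c + b
      lem = solve-∀

    K-upper₀ : K ≤ 2 ^ suc A
    K-upper₀ = ≤-trans K-bound (≤-trans (+-monoʳ-≤ (2 ^ A) (≤-trans (m≤m+n _ _) (≤-trans error (2^-mono (m∸n≤m A (18 * w))))))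
      (≤-reflexive (sym (2^-suc A))))

    K-lower₀ : 2 ^ A ≤ K
    K-lower₀ = *-cancelʳ-≤ (2 ^ A) K (2 ^ M) {{m^n≢0 2 M}} (begin
      2 ^ A * 2 ^ M               ≡⟨ trans (sym (2^-+ A M)) (cong (2 ^_) A+M) ⟩
      2 ^ m                       ≡⟨ sym (bin-sum m) ⟩
      sumTo (bin m) (suc m)       ≤⟨ sumTo-mono (suc m) (λ x _ → fibre≥ x) ⟩
      sumTo (λ x → c x * 2 ^ M) (suc m) ≡⟨ sumOf-*ʳ (2 ^ M) c (downFrom (suc m)) ⟩
      sumTo c (suc m) * 2 ^ M     ≤⟨ *-monoˡ-≤ (2 ^ M) (≤-trans (sum-fibres lab (downFrom K) (suc m)) (≤-reflexive (length-downFrom K))) ⟩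
      K * 2 ^ M                   ∎)
      where open ≤-Reasoning

    δ : ℕ
    δ = 2 ^ (A ∸ (1 + 2 * d))

    -- Shifting by M costs one unit of rounding, absorbed because the slope bound is below δ / 2.
    sh-close : ∀ {x y} → x ≤ y + 2 ^ (m ∸ (2 + 2 * d)) → sh M x ∸ τ ≤ sh M y ∸ τ + δ
    sh-close {x} {y} h = m≤n+o⇒m∸n≤o (sh M x) τ (≤-trans lt (≤-trans (+-monoˡ-≤ δ (m≤n+m∸n (sh M y) τ)) (≤-reflexive (+-assoc τ _ δ))))
      where
      e = A ∸ (2 + 2 * d)
      room : 2 + 2 * d ≤ A
      room = ≤-trans (+-monoˡ-≤ (2 * d) (m≤m+n 2 3)) d-room
      e+M : m ∸ (2 + 2 * d) ≡ e + M
      e+M = trans (cong (_∸ (2 + 2 * d)) (trans (sym A+M) (+-comm A M))) (trans (+-∸-assoc M room) (+-comm M e))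
      δ≡ : 2 ^ suc e ≡ δ
      δ≡ = cong (2 ^_) (sym (+-∸-assoc 1 {A} {2 + 2 * d} room))
      lt : sh M x ≤ sh M y + δ
      lt = begin
        sh M x                                   ≤⟨ sh-mono M h ⟩
        sh M (y + 2 ^ (m ∸ (2 + 2 * d)))         ≤⟨ sh-+ M y _ ⟩
        suc (sh M y + sh M (2 ^ (m ∸ (2 + 2 * d)))) ≤⟨ s≤s (+-monoʳ-≤ (sh M y) (sh-pow M e _ (≤-reflexive (cong (2 ^_) e+M)))) ⟩
        suc (sh M y + 2 ^ e)                     ≡⟨ trans (+-comm 1 _) (+-assoc (sh M y) (2 ^ e) 1) ⟩
        sh M y + (2 ^ e + 1)                     ≤⟨ +-monoʳ-≤ (sh M y) (+-monoʳ-≤ (2 ^ e) (2^>0 e)) ⟩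
        sh M y + (2 ^ e + 2 ^ e)                 ≡⟨ cong (sh M y +_) (trans (sym (2^-suc e)) δ≡) ⟩
        sh M y + δ                               ∎
        where open ≤-Reasoning

    g-close : ∀ x → Close δ (g x) (g (suc x))
    g-close x with bin-close m d (m ∸ (2 + 2 * d)) x m-lower (≤-trans (m≤n+m∸n m (2 + 2 * d)) (≤-reflexive (+-comm (2 + 2 * d) (m ∸ (2 + 2 * d)))))
    ... | p , q = sh-close p , sh-close q

    -- Makes the shifted function smooth at its left end, where it passes from the artificial
    -- argument 0 to label 0.
    g-0 : g 0 ≡ 0
    g-0 = m≤n⇒m∸n≡0 (≤-trans (sh-≤ M 1) (2^>0 (A ∸ 20 * w)))

    smooth₀ : ∀ z → Close δ (shift0 g z) (shift0 g (suc z))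
    smooth₀ zero = z≤n , ≤-trans (≤-reflexive g-0) z≤n
    smooth₀ (suc z) = g-close z

    -- A value above 2 ^ (A + 1 - d) would by smoothness persist over 2 ^ d labels and exceed the total mass.
    max₀ : ∀ z → shift0 g z ≤ 2 ^ (suc A ∸ d)
    max₀ z with shift0 g z ≤? 2 ^ (suc A ∸ d)
    ... | yes p = p
    ... | no p = ⊥-elim (<⇒≱ gt le)
      where
      h : ℕ → ℕ
      h = shift0 g
      d≤A : d ≤ A
      d≤A = ≤-trans (≤-trans (m≤m+n d (d + 0)) (m≤n+m (2 * d) 5)) d-room
      E = A ∸ d
      E-eq : 2 ^ (suc A ∸ d) ≡ 2 ^ E + 2 ^ E
      E-eq = trans (cong (2 ^_) (+-∸-assoc 1 d≤A)) (2^-suc E)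
      step≤ : ∀ i → i < 2 ^ d → i * δ ≤ 2 ^ E
      step≤ i i< = ≤-trans (*-monoˡ-≤ δ (<⇒≤ i<)) (2^*2^≤ d (A ∸ (1 + 2 * d)) ≤-refl ≤-refl
        (+-cancelʳ-≤ d _ _ (≤-trans (≤-trans (≤-reflexive (lem d (A ∸ (1 + 2 * d)))) (+-monoʳ-≤ (A ∸ (1 + 2 * d)) (n≤1+n (2 * d))))
          (≤-trans (≤-reflexive (m∸n+n≡m room)) (≤-reflexive (sym (m∸n+n≡m d≤A)))))))
        where
        room : 1 + 2 * d ≤ A
        room = ≤-trans (+-monoˡ-≤ (2 * d) (m≤m+n 1 4)) d-room
        lem : ∀ d x → d + x + d ≡ x + 2 * d
        lem = solve-∀
      each : ∀ i → i < 2 ^ d → suc (2 ^ E) ≤ h (i + z)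
      each i i< = +-cancelʳ-≤ (2 ^ E) _ _ (≤-trans (≤-reflexive (cong suc (sym E-eq))) (≤-trans (≰⇒> p)
        (≤-trans (proj₁ (Close-iter h δ smooth₀ z i)) (+-monoʳ-≤ (h (i + z)) (step≤ i i<)))))
      total-sum : sumTo h (z + 2 ^ d) ≤ 2 ^ A
      total-sum = ≤-trans (sum-shift0 g (suc m) g-out (z + 2 ^ d)) (*-cancelʳ-≤ _ _ (2 ^ M) {{m^n≢0 2 M}} (begin
        sumTo g (suc m) * 2 ^ M      ≡⟨ sym (sumOf-*ʳ (2 ^ M) g (downFrom (suc m))) ⟩
        sumTo (λ x → g x * 2 ^ M) (suc m) ≤⟨ sumTo-mono (suc m) (λ x _ → ≤-trans (*-monoˡ-≤ (2 ^ M) (m∸n≤m _ τ)) (sh-lower M (bin m x))) ⟩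
        sumTo (bin m) (suc m)        ≡⟨ bin-sum m ⟩
        2 ^ m                        ≡⟨ trans (cong (2 ^_) (sym A+M)) (2^-+ A M) ⟩
        2 ^ A * 2 ^ M                ∎))
        where open ≤-Reasoning
      le : 2 ^ d * suc (2 ^ E) ≤ 2 ^ A
      le = begin
        2 ^ d * suc (2 ^ E)                          ≡⟨ sym (trans (sumOf-const (suc (2 ^ E)) (downFrom (2 ^ d))) (cong (_* suc (2 ^ E)) (length-downFrom (2 ^ d)))) ⟩
        sumTo (λ _ → suc (2 ^ E)) (2 ^ d)            ≤⟨ sumTo-mono (2 ^ d) (λ i i< → ≤-trans (each i i<) (≤-reflexive (cong h (+-comm i z)))) ⟩
        sumTo (λ i → h (z + i)) (2 ^ d)              ≤⟨ m≤n+m _ (sumTo h z) ⟩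
        sumTo h z + sumTo (λ i → h (z + i)) (2 ^ d)  ≡⟨ sym (sumTo-+ h z (2 ^ d)) ⟩
        sumTo h (z + 2 ^ d)                          ≤⟨ total-sum ⟩
        2 ^ A                                        ∎
        where open ≤-Reasoning
      gt : 2 ^ A < 2 ^ d * suc (2 ^ E)
      gt = <-≤-trans (≤-<-trans (≤-reflexive (trans (cong (2 ^_) (sym (m+[n∸m]≡n d≤A))) (2^-+ d E)))
             (*-monoʳ-< (2 ^ d) {{m^n≢0 2 d}} (n<1+n (2 ^ E)))) ≤-refl

    -- The predecessor of s = 2^(d + 4), the distance over which tails halve: its square 2^(8 + 2d)
    -- is at least m, as the tail lemmas require.
    s₁ : ℕ
    s₁ = pred (2 ^ (d + 4))
    s≡ : suc s₁ ≡ 2 ^ (d + 4)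
    s≡ = suc-pred (2 ^ (d + 4)) {{m^n≢0 2 (d + 4)}}
    m≤s² : m ≤ suc s₁ * suc s₁
    m≤s² = ≤-trans m-upper (≤-reflexive (trans (trans (cong (2 ^_) (lem d)) (2^-+ (d + 4) (d + 4))) (sym (cong₂ _*_ s≡ s≡))))
      where
      lem : ∀ d → 8 + 2 * d ≡ (d + 4) + (d + 4)
      lem = solve-∀

    T₁ : ℕ
    T₁ = suc s₁ + 2 * (20 * w * suc s₁)
    T-eq : T₁ ≡ (640 * w + 16) * 2 ^ d + 0
    T-eq = trans (cong (λ s → s + 2 * (20 * w * s)) (trans s≡ (2^-+ d 4))) (lem w (2 ^ d))
      where
      lem : ∀ w p → p * 16 + 2 * (20 * w * (p * 16)) ≡ (640 * w + 16) * p + 0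
      lem = solve-∀

    -- Scaled down by 2^M, such a binomial is at most 2^(A - 20 w) = `τ`, exactly what `g`
    -- subtracts.
    zero-if : ∀ x → bin m x * 2 ^ (20 * w) ≤ 2 ^ m → g x ≡ 0
    zero-if x h = m≤n⇒m∸n≡0 (sh-pow M (A ∸ 20 * w) (bin m x) (*-cancelʳ-≤ _ _ (2 ^ (20 * w)) {{m^n≢0 2 (20 * w)}}
      (≤-trans h (≤-reflexive (trans (cong (2 ^_) (trans (sym A+M) (trans (cong (_+ M) (sym (m∸n+n≡m (kw≤A 20 (m≤m+n 20 280))))) (lem (A ∸ 20 * w) (20 * w) M))))
        (2^-+ ((A ∸ 20 * w) + M) (20 * w)))))))
      where
      lem : ∀ x y z → x + y + z ≡ x + z + y
      lem = solve-∀

    xl : ℕ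
    xl = ⌊ suc m ∸ T₁ /2⌋

    support₀ : ∀ x → 0 < g x → sh d xl ≤ sh d x × suc (sh d x) < sh d xl + W
    support₀ x pos = sh-mono d lower , ≤-trans (s≤s (s≤s sh-up)) (≤-add 1 (trans (cong (sh d xl +_) (width-≡ w)) (lem (sh d xl) (640 * w))))
      where
      right : suc (2 * x) < m + T₁
      right with suc (suc (2 * x)) ≤? m + T₁
      ... | yes p = p
      ... | no p = ⊥-elim (<⇒≢ pos (sym (zero-if x (bin-tail m s₁ m≤s² (20 * w) x
                     (≤-trans (≤-reflexive (+-assoc m (suc s₁) _)) (≤-pred (≰⇒> p)))))))
      left : suc m < 2 * x + T₁
      left with suc (suc m) ≤? 2 * x + T₁
      ... | yes p = p
      ... | no p = ⊥-elim (<⇒≢ pos (sym (zero-if x (bin-tail-left m s₁ m≤s² (20 * w) x (≤-pred (≰⇒> p))))))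
      lower : xl ≤ x
      lower = ≤-trans (⌊n/2⌋-mono (m≤n+o⇒m∸n≤o (suc m) T₁ (≤-trans (<⇒≤ left) (≤-reflexive (+-comm (2 * x) T₁))))) (≤-reflexive (half-double x))
      upper : x ≤ xl + T₁
      upper = ≤-trans (≤-trans (≤-reflexive (sym (half-double x))) (⌊n/2⌋-mono two)) (≤-reflexive split)
        where
        two : 2 * x ≤ 2 * T₁ + (suc m ∸ T₁)
        two = ≤-trans (≤-trans (n≤1+n (2 * x)) (<⇒≤ right)) (≤-trans (≤-trans (+-monoˡ-≤ T₁ (≤-trans (n≤1+n m) (m≤n+m∸n (suc m) T₁)))
                (≤-reflexive (l T₁ (suc m ∸ T₁)))) ≤-refl)
          where
          l : ∀ t y → t + y + t ≡ 2 * t + y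
          l = solve-∀
        split : ⌊ 2 * T₁ + (suc m ∸ T₁) /2⌋ ≡ xl + T₁
        split = go T₁ (suc m ∸ T₁)
          where
          go : ∀ t y → ⌊ 2 * t + y /2⌋ ≡ ⌊ y /2⌋ + t
          go zero y = sym (+-identityʳ ⌊ y /2⌋)
          go (suc t) y rewrite +-suc t (t + 0) = trans (cong suc (go t y)) (sym (+-suc ⌊ y /2⌋ t))
      sh-up : sh d x ≤ suc (sh d xl + (640 * w + 16))
      sh-up = ≤-trans (sh-mono d upper) (≤-trans (sh-+ d xl T₁) (s≤s (+-monoʳ-≤ (sh d xl)
        (≤-reflexive (trans (cong (sh d) T-eq) (sh-unique d (640 * w + 16) 0 (2^>0 d)))))))
      lem : ∀ a b → a + (b + 20) ≡ suc (suc (suc (a + (b + 16)))) + 1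
      lem = solve-∀

    -- The first `g` states of a fibre are taken as good and the remainder as bad; `pred` undoes the
    -- shift of the labels.
    state₀ : Bool → ℕ → ℕ → ℕ
    state₀ false z j = nth 0 (fib (pred z)) j
    state₀ true z j = nth 0 (fib (pred z)) (g (pred z) + j)

    fib-∈ : ∀ σ → σ < K → σ ∈ fib (lab σ)
    fib-∈ σ σ< = keep-∈ (λ σ′ → lab σ′ ≡ᵇ lab σ) (∈-downFrom⁺ σ<) (≡ᵇ-self (lab σ))

    classify₀ : ∀ σ → σ < K → lab σ ≤ m →
      (∃ λ j → j < shift0 g (suc (lab σ)) × state₀ false (suc (lab σ)) j ≡ σ) ⊎
      ((∃ λ j → j < shift0 b (suc (lab σ)) × state₀ true (suc (lab σ)) j ≡ σ) × (∃ λ ζ → ζ < Z₀ × nth 0 badList ζ ≡ σ))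
    classify₀ σ σ< lab≤ with ∈⇒nth 0 (fib-∈ σ σ<)
    ... | i , i< , eq with i <? g (lab σ)
    ...   | yes p = inj₁ (i , p , eq)
    ...   | no p = inj₂ ((i ∸ g (lab σ) , lt , trans (cong (nth 0 (fib (lab σ))) i≡) eq) , in-list)
      where
      g≤i = ≮⇒≥ p
      i≡ : g (lab σ) + (i ∸ g (lab σ)) ≡ i
      i≡ = m+[n∸m]≡n g≤i
      lt : i ∸ g (lab σ) < b (lab σ)
      lt = subst (i ∸ g (lab σ) <_) (sym (b-in (lab σ) lab≤)) (∸-monoˡ-< i< g≤i)
      mem : σ ∈ badList
      mem = ∈-concatMap (λ x → drop (g x) (fib x)) (∈-downFrom⁺ (s≤s lab≤))
              (subst (_∈ drop (g (lab σ)) (fib (lab σ))) (trans (nth-drop 0 (g (lab σ)) (fib (lab σ)) _) (trans (cong (nth 0 (fib (lab σ))) i≡) eq))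
                (nth-∈ 0 (drop (g (lab σ)) (fib (lab σ))) (subst (i ∸ g (lab σ) <_) (sym (length-drop (g (lab σ)) (fib (lab σ)))) (∸-monoˡ-< i< g≤i))))
      in-list : ∃ λ ζ → ζ < Z₀ × nth 0 badList ζ ≡ σ
      in-list with ∈⇒nth 0 mem
      ... | ζ , ζ< , eq′ = ζ , subst (ζ <_) badList-length ζ< , eq′

  child : Child d
  child = record
    { K = K ; m = m ; lab = lab ; good = shift0 g ; bad = shift0 b ; state = state₀ ; badState = nth 0 badList
    ; G = sumTo g (suc m) ; Z = Z₀ ; lo = sh d xl ; classify = classify₀ ; good-0 = refl ; bad-0 = refl
    ; good-sum = sum-shift0 g (suc m) g-out ; bad-sum = sum-shift0 b (suc m) b-out ; total = sums
    ; K-lower = K-lower₀ ; K-upper = K-upper₀ ; Z-small = Z-small₀ ; smooth = smooth₀ ; good-max = max₀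
    ; support = support₀ }

-- Typical tuples of states

minTo : (ℕ → ℕ) → ℕ → ℕ
minTo f zero = f 0
minTo f (suc n) = f n ⊓ minTo f n

minTo-≤ : ∀ f n i → i < n → minTo f n ≤ f i
minTo-≤ f (suc n) i (s≤s i≤) with m≤n⇒m<n∨m≡n i≤
... | inj₁ lt = ≤-trans (m⊓n≤n (f n) _) (minTo-≤ f n i lt)
... | inj₂ refl = m⊓n≤m (f n) _

minTo-attained : ∀ f n → 0 < n → ∃ λ i → i < n × minTo f n ≡ f i
minTo-attained f (suc zero) _ = 0 , ≤-refl , ⊓-idem (f 0)
minTo-attained f (suc (suc n)) _ with ⊓-sel (f (suc n)) (minTo f (suc n)) | minTo-attained f (suc n) (s≤s z≤n)
... | inj₁ e | _ = suc n , ≤-refl , e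
... | inj₂ e | i , i< , eq = i , m≤n⇒m≤1+n i< , trans e eq

sumFrom : (ℕ → ℕ) → ℕ → ℕ → ℕ
sumFrom f i zero = 0
sumFrom f i (suc r) = f i + sumFrom f (suc i) r

sumFrom-sumTo : ∀ f r → sumFrom f 0 r ≡ sumTo f r
sumFrom-sumTo f r = trans (go f 0 r) (sumTo-cong r λ _ _ → refl)
  where
  go : ∀ f i r → sumFrom f i r ≡ sumTo (λ k → f (i + k)) r
  go f i zero = refl
  go f i (suc r) = trans (cong₂ _+_ (cong f (sym (+-identityʳ i))) (trans (go f (suc i) r) (sumTo-cong r λ k _ → cong f (sym (+-suc i k)))))
    (sym (sumTo-left (λ k → f (i + k)) r))

sum-blocks : ∀ (φ : ℕ → ℕ) c P n → sumTo (λ h → sumTo (λ u → φ ((c + h) * P + u)) P) n ≡ sumTo (λ v → φ (c * P + v)) (n * P)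
sum-blocks φ c P zero = refl
sum-blocks φ c P (suc n) = trans (cong₂ _+_ (sumTo-cong P λ u _ → cong φ (lem c n P u)) (sum-blocks φ c P n))
  (trans (+-comm _ (sumTo (λ v → φ (c * P + v)) (n * P)))
  (trans (sym (sumTo-+ (λ v → φ (c * P + v)) (n * P) P)) (cong (sumTo (λ v → φ (c * P + v))) (+-comm (n * P) P))))
  where
  lem : ∀ c n P u → (c + n) * P + u ≡ c * P + (n * P + u)
  lem = solve-∀

-- The differences that are not truncated are distinct, and truncated ones hit 0, where `g`
-- vanishes.
sum-translate : ∀ (g : ℕ → ℕ) → g 0 ≡ 0 → ∀ c p n → sumTo (λ v → g (suc (c + v) ∸ p)) n ≤ sumTo g (suc (c + n) ∸ p)
sum-translate g g0 c p zero = z≤n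
sum-translate g g0 c p (suc n) with p ≤? suc (c + n)
... | yes q = ≤-trans (+-monoʳ-≤ (g (suc (c + n) ∸ p)) (sum-translate g g0 c p n))
                (≤-reflexive (cong (sumTo g) (sym (trans (cong (λ z → suc z ∸ p) (+-suc c n)) (+-∸-assoc 1 q)))))
... | no q = ≤-trans (+-mono-≤ (≤-reflexive (trans (cong g z0) g0)) (≤-trans (sum-translate g g0 c p n) (≤-reflexive (cong (sumTo g) z0)))) z≤n
  where
  z0 : suc (c + n) ∸ p ≡ 0
  z0 = m≤n⇒m∸n≡0 (<⇒≤ (≰⇒> q))

count-below : ∀ r n → sumTo (λ i → bit (i <ᵇ r)) n ≡ n ⊓ r
count-below r zero = refl
count-below r (suc n) with n <ᵇ r in eq
... | true rewrite count-below r n | m≤n⇒m⊓n≡m (<⇒≤ (<ᵇ-true⇒< {n} {r} eq)) = sym (m≤n⇒m⊓n≡m (<ᵇ-true⇒< {n} {r} eq))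
... | false = trans (count-below r n) (trans (m≥n⇒m⊓n≡n r≤n) (sym (m≥n⇒m⊓n≡n (m≤n⇒m≤1+n r≤n))))
  where
  r≤n : r ≤ n
  r≤n = <ᵇ-false⇒≥ {n} {r} eq

-- What a profile reveals of a prefix sum: its value, or the index of its block of length 2^d.
data Entry : Set where
  full block : ℕ → Entry

module Node (w a d b : ℕ) (cs : ℕ → Params.Child w a d) where
  open Params w a
  open Child

  R : ℕ
  R = fuel w

  -- The greatest height at which a box over block α of the sum after child i and block β of the sum
  -- before it still lies under the graph; both blocks have length 2^n.
  Gmin : ℕ → ℕ → ℕ → ℕ → ℕ
  Gmin n i α β = minTo (λ u → minTo (λ v → good (cs i) (suc (α * 2 ^ n + u) ∸ (β * 2 ^ n + v))) (2 ^ n)) (2 ^ n)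

  Gmin-≤ : ∀ n i y′ y → Gmin n i (sh n y′) (sh n y) ≤ good (cs i) (suc y′ ∸ y)
  Gmin-≤ n i y′ y = subst₂ (λ p q → Gmin n i (sh n y′) (sh n y) ≤ good (cs i) (suc p ∸ q)) (low-eq n y′) (low-eq n y)
    (≤-trans (minTo-≤ _ (2 ^ n) (low n y′) (low-< n y′))
      (minTo-≤ (λ v → good (cs i) (suc (sh n y′ * 2 ^ n + low n y′) ∸ (sh n y * 2 ^ n + v))) (2 ^ n) (low n y) (low-< n y)))

  top : Entry → ℕ
  top (full y) = sh d y
  top (block H) = H

  ys js : Entry → List ℕ
  ys (full y) = y ∷ []
  ys (block H) = map (λ u → H * 2 ^ d + u) (downFrom (2 ^ d))
  js (full y) = downFrom (2 ^ suc A)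
  js (block H) = downFrom (2 ^ (suc A ∸ d))

  boxOf : List Entry → Box
  boxOf [] = []
  boxOf (e ∷ p) = ys e ∷ js e ∷ boxOf p

  -- Two one-point coordinates stand for the sum 0 before the first child and a dummy index. Then
  -- coordinate 2k is prefix sum k, and coordinate 2i + 3 is the index of the state of child i.
  initBox : List Entry → Box
  initBox p = (0 ∷ []) ∷ (0 ∷ []) ∷ boxOf p

  -- Child i₀ (if i₀ < b) is in a bad state, all others are in good states.  The prefix sums on both sides of a
  -- bad child and the total are fully known, the others are known up to a block.
  module Typical (i₀ : ℕ) where

    flag : ℕ → Bool
    flag i = i ≡ᵇ i₀

    mass : ℕ → ℕ → ℕ
    mass i z = if flag i then bad (cs i) z else good (cs i) z

    isFull : ℕ → Bool
    isFull k = if k ≡ᵇ i₀ then true else (if k ≡ᵇ suc i₀ then true else (k ≡ᵇ b))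

    -- `H` is the block of the preceding sum. Describing the next block relative to it leaves only
    -- `W` choices.
    opts : ℕ → ℕ → List Entry
    opts i H = if isFull (suc i) then map full (downFrom (2 ^ w)) else map (λ h → block (H + lo (cs i) + h)) (downFrom W)

    profs : ℕ → ℕ → ℕ → List (List Entry)
    profs zero i H = [] ∷ []
    profs (suc r) i H = concatMap (λ e → map (e ∷_) (profs r (suc i) (top e))) (opts i H)

    posY posJ : ℕ → ℕ
    posY k = k * 2
    posJ i = suc (suc i * 2)

    isOdd : ℕ → ℕ → ℕ → Bool
    isOdd n α y = sh n y ≡ᵇ suc (2 * α)

    child : Bool → ℕ → ℕ
    child c α = if c then suc (2 * α) else 2 * α

    module Protocol (e : ℕ → Entry) where
      -- `f` is the number of refinements left for all remaining children together. The mass of a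
      -- bad child is not smooth, so both its sums are full and a single exact test settles it; the
      -- failing clause of `goBad` concerns only profiles of the wrong shape.
      go : ℕ → ℕ → ℕ → Prot
      goBad : ℕ → ℕ → ℕ → Entry → Entry → Prot
      lp refine : ℕ → ℕ → ℕ → ℕ → ℕ → ℕ → Prot
      go zero i f = ok
      go (suc r) i f = if flag i then goBad r i f (e (suc i)) (e i) else lp r i d (top (e (suc i))) (top (e i)) f
      goBad r i f (full y′) (full y) = ask (posJ i) (λ j → j <ᵇ bad (cs i) (suc y′ ∸ y)) (go r (suc i) f) fail
      goBad r i f _ _ = fail
      lp r i n α β f = ask (posJ i) (λ j → j <ᵇ Gmin n i α β) (go r (suc i) f) (refine r i n α β f)
      refine r i zero α β f = fail
      refine r i (suc n) α β zero = fail
      refine r i (suc n) α β (suc f) = ask (posY (suc i)) (isOdd n α)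
        (ask (posY i) (isOdd n β) (lp r i n (child true α) (child true β) f) (lp r i n (child true α) (child false β) f))
        (ask (posY i) (isOdd n β) (lp r i n (child false α) (child true β) f) (lp r i n (child false α) (child false β) f))

      run-refine : ∀ r i n α β f v → run? (refine r i (suc n) α β (suc f)) v ≡
        run? (lp r i n (child (isOdd n α (nth 0 v (posY (suc i)))) α) (child (isOdd n β (nth 0 v (posY i))) β) f) v
      run-refine r i n α β f v with isOdd n α (nth 0 v (posY (suc i))) | isOdd n β (nth 0 v (posY i))
      ... | true | true = refl
      ... | true | false = refl
      ... | false | true = refl
      ... | false | false = refl

      -- One test per remaining child, and three bits per refinement: two for the bits asked and one
      -- for the test that is repeated.
      go-count : ∀ r i f → leafCount (go r i f) ≤ 2 ^ (r + 3 * f)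
      lp-count : ∀ r i n α β f → leafCount (lp r i n α β f) ≤ 2 ^ (suc r + 3 * f)
      refine-count : ∀ r i n α β f → leafCount (refine r i n α β f) ≤ 2 ^ (r + 3 * f)
      go-count zero i f = 2^>0 (3 * f)
      go-count (suc r) i f with flag i
      ... | false = lp-count r i d (top (e (suc i))) (top (e i)) f
      ... | true with e (suc i) | e i
      ...   | full y′ | full y = 2^+2^≤ {m = r + 3 * f} {n = r + 3 * f} (go-count r (suc i) f) (2^>0 (r + 3 * f)) ≤-refl
      ...   | full _ | block _ = 2^>0 (suc (r + 3 * f))
      ...   | block _ | full _ = 2^>0 (suc (r + 3 * f))
      ...   | block _ | block _ = 2^>0 (suc (r + 3 * f))
      lp-count r i n α β f = 2^+2^≤ {m = r + 3 * f} {n = r + 3 * f} (go-count r (suc i) f) (refine-count r i n α β f) ≤-refl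
      refine-count r i zero α β f = 2^>0 (r + 3 * f)
      refine-count r i (suc n) α β zero = 2^>0 (r + 0)
      refine-count r i (suc n) α β (suc f) = ≤-trans (+-mono-≤ (+-mono-≤ (lp-count r i n _ _ f) (lp-count r i n _ _ f))
          (+-mono-≤ (lp-count r i n _ _ f) (lp-count r i n _ _ f)))
        (≤-reflexive (trans (lem (2 ^ (suc r + 3 * f))) (trans (sym (2^-+ 2 (suc r + 3 * f))) (cong (2 ^_) (lem₂ r f)))))
        where
        lem : ∀ x → x + x + (x + x) ≡ 4 * x
        lem = solve-∀
        lem₂ : ∀ r f → 2 + (suc r + 3 * f) ≡ r + 3 * suc f
        lem₂ = solve-∀

    entAt : List Entry → ℕ → Entry
    entAt p k = nth (full 0) (full 0 ∷ p) k

    protocol : List Entry → Prot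
    protocol p = Protocol.go (entAt p) b 0 R

    -- The indicator of the region under the graph, for the children from i on, given the prefix sum
    -- y before them.
    wt : ℕ → ℕ → ℕ → List ℕ → ℕ
    wt zero i y v = 1
    wt (suc r) i y (y′ ∷ j ∷ v) = bit (j <ᵇ mass i (suc y′ ∸ y)) * wt r (suc i) y′ v
    wt (suc r) i y _ = 0

    top-ys : ∀ e {y} → y ∈ ys e → sh d y ≡ top e
    top-ys (full y) (here refl) = refl
    top-ys (block H) y∈ with ∈-map⁻ (λ u → H * 2 ^ d + u) y∈
    ... | u , u∈ , refl = sh-unique d H u (∈-downFrom⁻ u∈)

    child-sh : ∀ n y → child (isOdd n (sh (suc n) y) y) (sh (suc n) y) ≡ sh n y
    child-sh n y with isOdd n (sh (suc n) y) y in eq | parity (sh n y)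
    ... | true | _ = sym (≡ᵇ-true⇒≡ {sh n y} eq)
    ... | false | inj₁ p = sym p
    ... | false | inj₂ p = ⊥-elim (subst T eq (≡⇒≡ᵇ (sh n y) _ p))

    module Soundness (e : ℕ → Entry) (v : List ℕ) where
      open Protocol e

      At : ℕ → List ℕ → Set
      At i s = ∀ k → nth 0 v (i * 2 + k) ≡ nth 0 s k

      Tail : ℕ → List Entry → Set
      Tail i p = ∀ k → e (i + k) ≡ nth (full 0) p k

      At-next : ∀ {i x x′ s} → At i (x ∷ x′ ∷ s) → At (suc i) s
      At-next {i} h k = trans (cong (nth 0 v) (sym (trans (+-suc (i * 2) (suc k)) (cong suc (+-suc (i * 2) k))))) (h (suc (suc k)))

      -- The block indices passed along always contain the actual sums, so an index accepted below
      -- the minimum over the blocks is below the mass at the sums themselves.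
      go-sound : ∀ r i f p y x s → At i (y ∷ x ∷ s) → Tail (suc i) p → length p ≡ r → y ∈ ys (e i) → InBox s (boxOf p) →
        run? (go r i f) v ≡ true → 1 ≤ wt r i y s
      go-sound zero i f p y x s _ _ _ _ _ _ = ≤-refl
      go-sound (suc r) i f [] y x s _ _ () _ _ _
      go-sound (suc r) i f (e′ ∷ p) y x [] _ _ _ _ () _
      go-sound (suc r) i f (e′ ∷ p) y x (_ ∷ []) _ _ _ _ (_ , ()) _
      go-sound (suc r) i f (e′ ∷ p) y x (y′ ∷ j ∷ s) at tl len y∈ (y′∈ , j∈ , s∈) h = main h
        where
        e≡ : e (suc i) ≡ e′
        e≡ = trans (cong e (sym (+-identityʳ (suc i)))) (tl 0)
        at′ : At (suc i) (y′ ∷ j ∷ s)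
        at′ = At-next {i} at
        y-at : nth 0 v (posY i) ≡ y
        y-at = trans (cong (nth 0 v) (sym (+-identityʳ (i * 2)))) (at 0)
        y′-at : nth 0 v (posY (suc i)) ≡ y′
        y′-at = trans (cong (nth 0 v) (sym (+-identityʳ (suc i * 2)))) (at′ 0)
        j-at : nth 0 v (posJ i) ≡ j
        j-at = trans (cong (nth 0 v) (sym (trans (+-comm (suc i * 2) 1) refl))) (at′ 1)
        rest : run? (go r (suc i) f) v ≡ true → 1 ≤ wt r (suc i) y′ s
        rest-gen : ∀ f → run? (go r (suc i) f) v ≡ true → 1 ≤ wt r (suc i) y′ s
        rest-gen f = go-sound r (suc i) f p y′ j s at′ (λ k → trans (cong e (sym (+-suc (suc i) k))) (tl (suc k)))
                       (suc-injective len) (subst (λ z → y′ ∈ ys z) (sym e≡) y′∈) s∈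
        rest = rest-gen f
        fin : j < mass i (suc y′ ∸ y) → 1 ≤ wt r (suc i) y′ s → 1 ≤ wt (suc r) i y (y′ ∷ j ∷ s)
        fin lt ih rewrite <⇒<ᵇ-true lt = ≤-trans ih (≤-reflexive (sym (+-identityʳ _)))
        lp-sound : ∀ n f → flag i ≡ false → run? (lp r i n (sh n y′) (sh n y) f) v ≡ true → 1 ≤ wt (suc r) i y (y′ ∷ j ∷ s)
        refine-sound : ∀ n f → flag i ≡ false → run? (refine r i n (sh n y′) (sh n y) f) v ≡ true → 1 ≤ wt (suc r) i y (y′ ∷ j ∷ s)
        lp-sound n f fl h with nth 0 v (posJ i) <ᵇ Gmin n i (sh n y′) (sh n y) in eq
        ... | true = fin (subst (λ c → j < (if c then bad (cs i) (suc y′ ∸ y) else good (cs i) (suc y′ ∸ y))) (sym fl)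
                       (<-≤-trans (subst (_< Gmin n i (sh n y′) (sh n y)) j-at (<ᵇ-true⇒< eq)) (Gmin-≤ n i y′ y))) (rest-gen f h)
        ... | false = refine-sound n f fl h
        refine-sound (suc n) (suc f) fl h = lp-sound n f fl (trans (sym (trans (run-refine r i n (sh (suc n) y′) (sh (suc n) y) f v)
          (cong₂ (λ α β → run? (lp r i n α β f) v)
            (trans (cong (λ z → child (isOdd n (sh (suc n) y′) z) (sh (suc n) y′)) y′-at) (child-sh n y′))
            (trans (cong (λ z → child (isOdd n (sh (suc n) y) z) (sh (suc n) y)) y-at) (child-sh n y))))) h)
        bad-sound : ∀ e₁ e₂ → y′ ∈ ys e₁ → y ∈ ys e₂ → flag i ≡ true → run? (goBad r i f e₁ e₂) v ≡ true → 1 ≤ wt (suc r) i y (y′ ∷ j ∷ s)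
        bad-sound (full _) (full _) (here refl) (here refl) fl h with nth 0 v (posJ i) <ᵇ bad (cs i) (suc y′ ∸ y) in eq
        ... | true = fin (subst (λ c → j < (if c then bad (cs i) (suc y′ ∸ y) else good (cs i) (suc y′ ∸ y))) (sym fl)
                       (subst (_< bad (cs i) (suc y′ ∸ y)) j-at (<ᵇ-true⇒< eq))) (rest h)
        main-case : ∀ c → flag i ≡ c →
          run? (if c then goBad r i f (e (suc i)) (e i) else lp r i d (top (e (suc i))) (top (e i)) f) v ≡ true →
          1 ≤ wt (suc r) i y (y′ ∷ j ∷ s)
        main-case true fl h = bad-sound (e (suc i)) (e i) (subst (λ z → y′ ∈ ys z) (sym e≡) y′∈) y∈ fl h
        main-case false fl h = lp-sound d f fl (subst₂ (λ α β → run? (lp r i d α β f) v ≡ true)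
              (sym (top-ys (e (suc i)) (subst (λ z → y′ ∈ ys z) (sym e≡) y′∈))) (sym (top-ys (e i) y∈)) h)
        main : run? (go (suc r) i f) v ≡ true → 1 ≤ wt (suc r) i y (y′ ∷ j ∷ s)
        main = main-case (flag i) refl

    I : ℕ → ℕ
    I i = if flag i then Z (cs i) else G (cs i)

    mass-0 : ∀ i → mass i 0 ≡ 0
    mass-0 i with flag i
    ... | true = bad-0 (cs i)
    ... | false = good-0 (cs i)

    mass-sum : ∀ i n → sumTo (mass i) n ≤ I i
    mass-sum i n with flag i
    ... | true = bad-sum (cs i) n
    ... | false = good-sum (cs i) n

    opts-sum : ∀ i H y → sumOf (λ e → sumOf (λ y′ → mass i (suc y′ ∸ y)) (ys e)) (opts i H) ≤ I i
    opts-sum i H y with isFull (suc i)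
    ... | true = ≤-trans (≤-reflexive (trans (sumOf-map (λ e → sumOf (λ y′ → mass i (suc y′ ∸ y)) (ys e)) full (downFrom (2 ^ w)))
                   (sumOf-cong (downFrom (2 ^ w)) λ y′ → +-identityʳ (mass i (suc y′ ∸ y)))))
                   (≤-trans (sum-translate (mass i) (mass-0 i) 0 y (2 ^ w)) (mass-sum i (suc (2 ^ w) ∸ y)))
    ... | false = ≤-trans (≤-reflexive (trans (sumOf-map (λ e → sumOf (λ y′ → mass i (suc y′ ∸ y)) (ys e)) (λ h → block (H + lo (cs i) + h)) (downFrom W))
                    (trans (sumOf-cong (downFrom W) λ h → sumOf-map (λ y′ → mass i (suc y′ ∸ y)) (λ u → (H + lo (cs i) + h) * 2 ^ d + u) (downFrom (2 ^ d)))
                    (sum-blocks (λ y′ → mass i (suc y′ ∸ y)) (H + lo (cs i)) (2 ^ d) W))))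
                    (≤-trans (sum-translate (mass i) (mass-0 i) ((H + lo (cs i)) * 2 ^ d) y (W * 2 ^ d)) (mass-sum i (suc ((H + lo (cs i)) * 2 ^ d + W * 2 ^ d) ∸ y)))

    js-sum : ∀ e g → sumOf (λ j → bit (j <ᵇ g)) (js e) ≤ g
    js-sum (full _) g = ≤-trans (≤-reflexive (count-below g (2 ^ suc A))) (m⊓n≤n _ g)
    js-sum (block _) g = ≤-trans (≤-reflexive (count-below g (2 ^ (suc A ∸ d)))) (m⊓n≤n _ g)

    -- Distinct profiles have disjoint boxes, so every tuple is counted once. The index is summed
    -- out first; then the sums y′, over all entries, run through translates of one mass function.
    profs-sum : ∀ r i H y → sumOf (λ p → sumB (boxOf p) (wt r i y)) (profs r i H) ≤ prodFrom I i r
    profs-sum zero i H y = ≤-refl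
    profs-sum (suc r) i H y = begin
      sumOf (λ p → sumB (boxOf p) (wt (suc r) i y)) (profs (suc r) i H)
        ≡⟨ sumOf-concatMap (λ p → sumB (boxOf p) (wt (suc r) i y)) (λ e → map (e ∷_) (profs r (suc i) (top e))) (opts i H) ⟩
      sumOf (λ e → sumOf (λ p → sumB (boxOf p) (wt (suc r) i y)) (map (e ∷_) (profs r (suc i) (top e)))) (opts i H)
        ≤⟨ sumOf-mono (opts i H) (λ e _ → per e) ⟩
      sumOf (λ e → sumOf (λ y′ → mass i (suc y′ ∸ y)) (ys e) * Π) (opts i H)
        ≡⟨ sumOf-*ʳ Π (λ e → sumOf (λ y′ → mass i (suc y′ ∸ y)) (ys e)) (opts i H) ⟩
      sumOf (λ e → sumOf (λ y′ → mass i (suc y′ ∸ y)) (ys e)) (opts i H) * Π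
        ≤⟨ *-monoˡ-≤ Π (opts-sum i H y) ⟩
      I i * Π ∎
      where
      open ≤-Reasoning
      Π = prodFrom I (suc i) r
      per : ∀ e → sumOf (λ p → sumB (boxOf p) (wt (suc r) i y)) (map (e ∷_) (profs r (suc i) (top e))) ≤
                  sumOf (λ y′ → mass i (suc y′ ∸ y)) (ys e) * Π
      per e = begin
        sumOf (λ p → sumB (boxOf p) (wt (suc r) i y)) (map (e ∷_) P)
          ≡⟨ sumOf-map (λ p → sumB (boxOf p) (wt (suc r) i y)) (e ∷_) P ⟩
        sumOf (λ p → sumOf (λ y′ → sumOf (λ j → sumB (boxOf p) (λ v → bit (j <ᵇ mass i (suc y′ ∸ y)) * wt r (suc i) y′ v)) (js e)) (ys e)) P
          ≡⟨ sumOf-cong P (λ p → sumOf-cong (ys e) λ y′ → trans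
               (sumOf-cong (js e) λ j → sumB-*ˡ (boxOf p) (bit (j <ᵇ mass i (suc y′ ∸ y))) (wt r (suc i) y′))
               (sumOf-*ʳ (sumB (boxOf p) (wt r (suc i) y′)) (λ j → bit (j <ᵇ mass i (suc y′ ∸ y))) (js e))) ⟩
        sumOf (λ p → sumOf (λ y′ → J y′ * sumB (boxOf p) (wt r (suc i) y′)) (ys e)) P
          ≡⟨ sumOf-swap (λ p y′ → J y′ * sumB (boxOf p) (wt r (suc i) y′)) P (ys e) ⟩
        sumOf (λ y′ → sumOf (λ p → J y′ * sumB (boxOf p) (wt r (suc i) y′)) P) (ys e)
          ≤⟨ sumOf-mono (ys e) (λ y′ _ → ≤-trans (≤-reflexive (sumOf-*ˡ (J y′) (λ p → sumB (boxOf p) (wt r (suc i) y′)) P))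
               (*-mono-≤ (js-sum e (mass i (suc y′ ∸ y))) (profs-sum r (suc i) (top e) y′))) ⟩
        sumOf (λ y′ → mass i (suc y′ ∸ y) * Π) (ys e)
          ≡⟨ sumOf-*ʳ Π (λ y′ → mass i (suc y′ ∸ y)) (ys e) ⟩
        sumOf (λ y′ → mass i (suc y′ ∸ y)) (ys e) * Π ∎
        where
        P = profs r (suc i) (top e)
        J : ℕ → ℕ
        J y′ = sumOf (λ j → bit (j <ᵇ mass i (suc y′ ∸ y))) (js e)

    profs-length : ∀ r i H {p} → p ∈ profs r i H → length p ≡ r
    profs-length zero i H (here refl) = refl
    profs-length (suc r) i H p∈ with ∈-concatMap⁻ (λ e → map (e ∷_) (profs r (suc i) (top e))) (opts i H) p∈
    ... | e , _ , q with ∈-map⁻ (e ∷_) q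
    ...   | p′ , p′∈ , refl = cong suc (profs-length r (suc i) (top e) p′∈)

    -- The boxes fit without loss, since only soundness enters; a tuple on which the fuel runs out
    -- is simply not counted.
    leaves-volume : sumOf (λ p → sumOf vol (okLeaves (protocol p) (initBox p))) (profs b 0 0) ≤ prodFrom I 0 b
    leaves-volume = ≤-trans (sumOf-mono (profs b 0 0) λ p p∈ → ≤-trans (≤-reflexive (okLeaves-vol (protocol p) (initBox p)))
        (≤-trans (sumB-mono (initBox p) {ψ = ψ} (λ v v∈ → sound p (profs-length b 0 0 p∈) v v∈))
          (≤-reflexive (trans (+-identityʳ _) (+-identityʳ _)))))
      (profs-sum b 0 0 0)
      where
      ψ : List ℕ → ℕ
      ψ (_ ∷ _ ∷ s) = wt b 0 0 s
      ψ _ = 0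
      sound : ∀ p → length p ≡ b → ∀ v → InBox v (initBox p) → bit (run? (protocol p) v) ≤ ψ v
      sound p len (x ∷ x′ ∷ s) (here refl , here refl , s∈) with run? (protocol p) (0 ∷ 0 ∷ s) in eq
      ... | false = z≤n
      ... | true = Soundness.go-sound (entAt p) (0 ∷ 0 ∷ s) b 0 R p 0 0 s (λ _ → refl) (λ _ → refl) len (here refl) s∈ eq

prodFrom-shift : ∀ f i r → prodFrom f (suc i) r ≡ prodFrom (f ∘ suc) i r
prodFrom-shift f i zero = refl
prodFrom-shift f i (suc r) = cong (f (suc i) *_) (prodFrom-shift f (suc i) r)

prodFrom-mono : ∀ {f g : ℕ → ℕ} i r → (∀ k → f k ≤ g k) → prodFrom f i r ≤ prodFrom g i r
prodFrom-mono i zero h = ≤-refl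
prodFrom-mono i (suc r) h = *-mono-≤ (h i) (prodFrom-mono (suc i) r h)

vol-pairs : ∀ r F → length F ≡ r * 2 → prodFrom (λ i → side F (i * 2) * side F (suc (i * 2))) 0 r ≡ vol F
vol-pairs zero [] _ = refl
vol-pairs (suc r) (l ∷ l′ ∷ F) h = trans (cong (length l * length l′ *_) (trans
    (prodFrom-shift (λ i → side (l ∷ l′ ∷ F) (i * 2) * side (l ∷ l′ ∷ F) (suc (i * 2))) 0 r)
    (vol-pairs r F (suc-injective (suc-injective h)))))
  (*-assoc (length l) (length l′) (vol F))

prod-single : ∀ N c n → 1 ≤ N → prodTo (λ k → if k ≡ᵇ c then N else 1) n ≤ N
prod-single N c n N≥ = proj₂ (go n)
  where
  f : ℕ → ℕ
  f k = if k ≡ᵇ c then N else 1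
  go : ∀ n → (n ≤ c → prodTo f n ≡ 1) × prodTo f n ≤ N
  go zero = (λ _ → refl) , N≥
  go (suc n) with go n | n ≡ᵇ c in eq
  ... | p , q | true = (λ n< → ⊥-elim (<⇒≢ n< (≡ᵇ-true⇒≡ eq))) ,
                       ≤-reflexive (trans (cong (_* N) (p (≤-reflexive (≡ᵇ-true⇒≡ eq)))) (*-identityˡ N))
  ... | p , q | false = (λ n< → trans (*-identityʳ _) (p (<⇒≤ n<))) , ≤-trans (≤-reflexive (*-identityʳ _)) q

prod-single-suc : ∀ N c n → 1 ≤ N → prodTo (λ k → if suc k ≡ᵇ c then N else 1) n ≤ N
prod-single-suc N zero n N≥ = ≤-trans (≤-reflexive (trans (prodTo-const 1 n) (^-zeroˡ n))) N≥
prod-single-suc N (suc c) n N≥ = prod-single N c n N≥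

-- Boxes of typical tuples: volume, number and completeness

module TypicalKeys (w a d b : ℕ) (cs : ℕ → Params.Child w a d) (d≤A : d ≤ suc (Params.A w a)) where
  open Params w a
  open Child
  open Node w a d b cs

  TKey : Set
  TKey = ℕ × List Entry × Box

  module T (i₀ : ℕ) = Typical i₀

  byProf : ℕ → List Entry → List TKey
  byProf i₀ p = map (λ F → i₀ , p , F) (okLeaves (T.protocol i₀ p) (initBox p))

  byFlag : ℕ → List TKey
  byFlag i₀ = concatMap (byProf i₀) (T.profs i₀ b 0 0)

  typKeys : List TKey
  typKeys = concatMap byFlag (downFrom (suc b))

  -- The box of a tuple is regular; other boxes get no room.
  regular : Box → Bool
  regular F = (length F ≡ᵇ suc b * 2) ∧ ((side F 0 ≡ᵇ 1) ∧ (side F 1 ≡ᵇ 1))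

  tsize : Box → ℕ → ℕ
  tsize F i = if regular F then side F (suc i * 2) * side F (suc (suc i * 2)) else 0

  tsize-volume : 1 ≤ b → ∀ F → prodTo (tsize F) b ≤ vol F
  tsize-volume b≥ F with length F ≡ᵇ suc b * 2 in e₁ | side F 0 ≡ᵇ 1 in e₂ | side F 1 ≡ᵇ 1 in e₃
  ... | true | true | true = go F (≡ᵇ-true⇒≡ e₁) (≡ᵇ-true⇒≡ e₂) (≡ᵇ-true⇒≡ e₃)
    where
    go : ∀ F → length F ≡ suc b * 2 → side F 0 ≡ 1 → side F 1 ≡ 1 →
         prodTo (λ i → side F (suc i * 2) * side F (suc (suc i * 2))) b ≤ vol F
    go (l ∷ l′ ∷ F) h h₁ h₂ rewrite h₁ | h₂ = ≤-reflexive (trans (sym (prodFrom-prodTo (λ i → side F (i * 2) * side F (suc (i * 2))) b))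
      (trans (vol-pairs b F (suc-injective (suc-injective h))) (sym (trans (+-identityʳ _) (+-identityʳ _)))))
  ... | false | _ | _ = ≤-trans (≤-reflexive (prodTo-zero b b≥)) z≤n
  ... | true | false | _ = ≤-trans (≤-reflexive (prodTo-zero b b≥)) z≤n
  ... | true | true | false = ≤-trans (≤-reflexive (prodTo-zero b b≥)) z≤n

  -- These are the terms with at most one factor Z in the expansion of the product on the right; i₀
  -- = n is the term without any.
  at-most-one-bad : ∀ n → sumTo (λ i₀ → prodTo (T.I i₀) n) (suc n) ≤ prodTo (λ i → G (cs i) + Z (cs i)) n
  at-most-one-bad zero = ≤-refl
  at-most-one-bad (suc n) = begin
    prodTo (T.I (suc n)) n * T.I (suc n) n + (prodTo (T.I n) n * T.I n n + sumTo (λ i₀ → prodTo (T.I i₀) n * T.I i₀ n) n)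
      ≡⟨ cong₂ _+_ (cong₂ _*_ same (I-good (suc n) n (<⇒≢ ≤-refl)))
           (cong₂ _+_ (cong (P *_) I-bad) (trans (sumTo-cong n λ i i< → cong (prodTo (T.I i) n *_) (I-good i n (λ e → <⇒≢ i< (sym e)))) (sumOf-*ʳ g (λ i₀ → prodTo (T.I i₀) n) (downFrom n)))) ⟩
    P * g + (P * z + S * g)
      ≡⟨ lem P g z S ⟩
    (P + S) * g + P * z
      ≤⟨ +-mono-≤ (*-monoˡ-≤ g (at-most-one-bad n)) (*-monoˡ-≤ z (≤-trans (m≤m+n P S) (at-most-one-bad n))) ⟩
    Q * g + Q * z
      ≡⟨ sym (*-distribˡ-+ Q g z) ⟩
    Q * (g + z) ∎
    where
    open ≤-Reasoning
    P = prodTo (T.I n) n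
    S = sumTo (λ i₀ → prodTo (T.I i₀) n) n
    Q = prodTo (λ i → G (cs i) + Z (cs i)) n
    g = G (cs n)
    z = Z (cs n)
    lem : ∀ p g z s → p * g + (p * z + s * g) ≡ (p + s) * g + p * z
    lem = solve-∀
    I-good : ∀ i₀ i → i ≢ i₀ → T.I i₀ i ≡ G (cs i)
    I-good i₀ i h rewrite ≡ᵇ-false h = refl
    I-bad : T.I n n ≡ z
    I-bad rewrite ≡ᵇ-self n = refl
    same : prodTo (T.I (suc n)) n ≡ P
    same = prodTo-cong n λ i i< → trans (I-good (suc n) i (<⇒≢ (m≤n⇒m≤1+n i<))) (sym (I-good n i (<⇒≢ i<)))

  typKeys-volume : 1 ≤ b → sumOf (λ κ → prodTo (tsize (proj₂ (proj₂ κ))) b) typKeys ≤ prodTo (λ i → K (cs i)) b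
  typKeys-volume b≥ = begin
    sumOf sz typKeys
      ≡⟨ trans (sumOf-concatMap sz byFlag (downFrom (suc b))) (sumTo-cong (suc b) λ i₀ _ → sumOf-concatMap sz (byProf i₀) (T.profs i₀ b 0 0)) ⟩
    sumTo (λ i₀ → sumOf (λ p → sumOf sz (byProf i₀ p)) (T.profs i₀ b 0 0)) (suc b)
      ≤⟨ sumTo-mono (suc b) (λ i₀ _ → sumOf-mono (T.profs i₀ b 0 0) λ p _ →
           ≤-trans (≤-reflexive (sumOf-map sz (λ F → i₀ , p , F) (okLeaves (T.protocol i₀ p) (initBox p))))
             (sumOf-mono (okLeaves (T.protocol i₀ p) (initBox p)) λ F _ → tsize-volume b≥ F)) ⟩
    sumTo (λ i₀ → sumOf (λ p → sumOf vol (okLeaves (T.protocol i₀ p) (initBox p))) (T.profs i₀ b 0 0)) (suc b)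
      ≤⟨ sumTo-mono (suc b) (λ i₀ _ → ≤-trans (T.leaves-volume i₀) (≤-reflexive (prodFrom-prodTo (T.I i₀) b))) ⟩
    sumTo (λ i₀ → prodTo (T.I i₀) b) (suc b)
      ≤⟨ at-most-one-bad b ⟩
    prodTo (λ i → G (cs i) + Z (cs i)) b
      ≤⟨ prodTo-mono b (λ i _ → total (cs i)) ⟩
    prodTo (λ i → K (cs i)) b ∎
    where
    open ≤-Reasoning
    sz : TKey → ℕ
    sz κ = prodTo (tsize (proj₂ (proj₂ κ))) b

  profs-count : ∀ i₀ r i H → length (T.profs i₀ r i H) ≤ prodFrom (λ k → if T.isFull i₀ (suc k) then 2 ^ w else W) i r
  profs-count i₀ zero i H = ≤-refl
  profs-count i₀ (suc r) i H = ≤-trans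
    (length-concatMap-≤ (λ e → map (e ∷_) (T.profs i₀ r (suc i) (top e))) (T.opts i₀ i H) _ λ e →
      ≤-trans (≤-reflexive (length-map (e ∷_) (T.profs i₀ r (suc i) (top e)))) (profs-count i₀ r (suc i) (top e)))
    (*-monoˡ-≤ _ opts-count)
    where
    opts-count : length (T.opts i₀ i H) ≤ (if T.isFull i₀ (suc i) then 2 ^ w else W)
    opts-count with T.isFull i₀ (suc i)
    ... | true = ≤-reflexive (trans (length-map full (downFrom (2 ^ w))) (length-downFrom (2 ^ w)))
    ... | false = ≤-reflexive (trans (length-map (λ h → block (H + lo (cs i) + h)) (downFrom W)) (length-downFrom W))

  -- At most three sums are full, the two around the bad child and the total, whence three factors
  -- 2^w.
  full-count : ∀ i₀ → prodTo (λ k → if T.isFull i₀ (suc k) then 2 ^ w else W) b ≤ W ^ b * (2 ^ w * (2 ^ w * 2 ^ w))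
  full-count i₀ = begin
    prodTo (λ k → if T.isFull i₀ (suc k) then 2 ^ w else W) b
      ≤⟨ prodTo-mono b (λ k _ → pointwise k) ⟩
    prodTo (λ k → W * (e₁ k * (e₂ k * e₃ k))) b
      ≡⟨ trans (prodTo-* (λ _ → W) (λ k → e₁ k * (e₂ k * e₃ k)) b) (cong₂ _*_ (prodTo-const W b)
           (trans (prodTo-* e₁ (λ k → e₂ k * e₃ k) b) (cong (prodTo e₁ b *_) (prodTo-* e₂ e₃ b)))) ⟩
    W ^ b * (prodTo e₁ b * (prodTo e₂ b * prodTo e₃ b))
      ≤⟨ *-monoʳ-≤ (W ^ b) (*-mono-≤ (prod-single-suc (2 ^ w) i₀ b (2^>0 w)) (*-mono-≤ (prod-single-suc (2 ^ w) (suc i₀) b (2^>0 w)) (prod-single-suc (2 ^ w) b b (2^>0 w)))) ⟩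
    W ^ b * (2 ^ w * (2 ^ w * 2 ^ w)) ∎
    where
    open ≤-Reasoning
    e₁ e₂ e₃ : ℕ → ℕ
    e₁ k = if suc k ≡ᵇ i₀ then 2 ^ w else 1
    e₂ k = if suc k ≡ᵇ suc i₀ then 2 ^ w else 1
    e₃ k = if suc k ≡ᵇ b then 2 ^ w else 1
    W≥ : 1 ≤ W
    W≥ = subst (1 ≤_) (sym (width-≡ w)) (≤-trans (m≤m+n 1 19) (m≤n+m 20 (640 * w)))
    sel≥ : ∀ c → 1 ≤ (if c then 2 ^ w else 1)
    sel≥ true = 2^>0 w
    sel≥ false = ≤-refl
    pointwise : ∀ k → (if T.isFull i₀ (suc k) then 2 ^ w else W) ≤ W * (e₁ k * (e₂ k * e₃ k))
    pointwise k with suc k ≡ᵇ i₀ | suc k ≡ᵇ suc i₀ | suc k ≡ᵇ b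
    ... | true | c | c′ = ≤-trans (≤-reflexive (sym (trans (+-identityʳ _) (*-identityʳ (2 ^ w))))) (*-mono-≤ W≥ (*-monoʳ-≤ (2 ^ w) (*-mono-≤ (sel≥ c) (sel≥ c′))))
    ... | false | true | c′ = ≤-trans (≤-reflexive (sym (trans (+-identityʳ _) (trans (+-identityʳ _) (*-identityʳ (2 ^ w)))))) (*-mono-≤ W≥ (*-monoʳ-≤ 1 (*-monoʳ-≤ (2 ^ w) (sel≥ c′))))
    ... | false | false | true = ≤-trans (≤-reflexive (sym (trans (+-identityʳ _) (trans (+-identityʳ _) (+-identityʳ _))))) (*-monoˡ-≤ (1 * (1 * 2 ^ w)) W≥)
    ... | false | false | false = ≤-reflexive (sym (*-identityʳ W))

  typKeys-count : length typKeys ≤ suc b * (W ^ b * (2 ^ w * (2 ^ w * 2 ^ w)) * 2 ^ (b + 3 * R))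
  typKeys-count = ≤-trans (length-concatMap-≤ byFlag (downFrom (suc b)) _ λ i₀ →
      ≤-trans (length-concatMap-≤ (byProf i₀) (T.profs i₀ b 0 0) (2 ^ (b + 3 * R)) λ p →
        ≤-trans (≤-reflexive (length-map (λ F → i₀ , p , F) (okLeaves (T.protocol i₀ p) (initBox p))))
          (≤-trans (length-okLeaves (T.protocol i₀ p) (initBox p)) (T.Protocol.go-count i₀ (T.entAt i₀ p) b 0 R)))
        (*-monoˡ-≤ (2 ^ (b + 3 * R)) (≤-trans (profs-count i₀ b 0 0) (≤-trans (≤-reflexive (prodFrom-prodTo (λ k → if T.isFull i₀ (suc k) then 2 ^ w else W) b)) (full-count i₀)))))
    (≤-reflexive (cong (_* (W ^ b * (2 ^ w * (2 ^ w * 2 ^ w)) * 2 ^ (b + 3 * R))) (length-downFrom (suc b))))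

  boxOf-side : ∀ p i → side (boxOf p) (i * 2) * side (boxOf p) (suc (i * 2)) ≤ 2 ^ suc A
  boxOf-side [] i = z≤n
  boxOf-side (full y ∷ p) zero = ≤-reflexive (trans (*-identityˡ (length (downFrom (2 ^ suc A)))) (length-downFrom (2 ^ suc A)))
  boxOf-side (block H ∷ p) zero = ≤-reflexive (trans (cong₂ _*_ (trans (length-map (λ u → H * 2 ^ d + u) (downFrom (2 ^ d))) (length-downFrom (2 ^ d))) (length-downFrom (2 ^ (suc A ∸ d))))
    (trans (sym (2^-+ d (suc A ∸ d))) (cong (2 ^_) (m+[n∸m]≡n d≤A))))
  boxOf-side (e ∷ p) (suc i) = boxOf-side p i

  tsize-≤ : ∀ {κ} → κ ∈ typKeys → ∀ i → tsize (proj₂ (proj₂ κ)) i ≤ 2 ^ suc A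
  tsize-≤ {κ} κ∈ i with ∈-concatMap⁻ byFlag (downFrom (suc b)) κ∈
  ... | i₀ , _ , κ∈₁ with ∈-concatMap⁻ (byProf i₀) (T.profs i₀ b 0 0) κ∈₁
  ...   | p , _ , κ∈₂ with ∈-map⁻ (λ F → i₀ , p , F) κ∈₂
  ...     | F , F∈ , refl with regular F
  ...       | true = ≤-trans (*-mono-≤ (side-okLeaves (T.protocol i₀ p) (initBox p) F∈ (suc i * 2)) (side-okLeaves (T.protocol i₀ p) (initBox p) F∈ (suc (suc i * 2)))) (boxOf-side p i)
  ...       | false = z≤n

  entryValue : Entry → ℕ
  entryValue (full y) = y
  entryValue (block _) = 0

  tlabel : TKey → ℕ
  tlabel (i₀ , p , F) = entryValue (T.entAt i₀ p b)

  ydec jdec : Box → ℕ → ℕ → ℕ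
  ydec F i v = nth 0 (nth [] F (suc i * 2)) (pfst (side F (suc i * 2)) v)
  jdec F i v = nth 0 (nth [] F (suc (suc i * 2))) (psnd (side F (suc i * 2)) v)

  -- The number of refinements the protocol spends on child i when it starts at scale n. None is
  -- needed at scale 0, where the blocks are single points.
  level : ℕ → ℕ → ℕ → ℕ → ℕ → ℕ
  level i y′ y j zero = 0
  level i y′ y j (suc n) = if j <ᵇ Gmin (suc n) i (sh (suc n) y′) (sh (suc n) y) then 0 else suc (level i y′ y j n)

  -- Block indices add up to a carry of one, and the bound in `support` leaves one block free for
  -- that carry.
  block-step : ∀ i {y y′} → y ≤ y′ → 0 < good (cs i) (suc (y′ ∸ y)) → ∃ λ h → h < W × sh d y′ ≡ sh d y + lo (cs i) + h
  block-step i {y} {y′} y≤ pos with support (cs i) (y′ ∸ y) pos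
  ... | lo≤ , <W = h , +-cancelˡ-< (sh d y + lo (cs i)) h W (subst (_< sh d y + lo (cs i) + W) (sym h-eq)
                     (≤-<-trans upper (subst (_< sh d y + lo (cs i) + W) (+-suc (sh d y) (sh d x))
                       (subst (sh d y + suc (sh d x) <_) (sym (+-assoc (sh d y) (lo (cs i)) W)) (+-monoʳ-< (sh d y) <W))))) , sym h-eq
    where
    x = y′ ∸ y
    y′≡ : y + x ≡ y′
    y′≡ = m+[n∸m]≡n y≤
    lower : sh d y + lo (cs i) ≤ sh d y′
    lower = ≤-trans (+-monoʳ-≤ (sh d y) lo≤) (≤-trans (sh-+-≥ d y x) (≤-reflexive (cong (sh d) y′≡)))
    upper : sh d y′ ≤ suc (sh d y + sh d x)
    upper = ≤-trans (≤-reflexive (cong (sh d) (sym y′≡))) (sh-+ d y x)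
    h = sh d y′ ∸ (sh d y + lo (cs i))
    h-eq : sh d y + lo (cs i) + h ≡ sh d y′
    h-eq = m+[n∸m]≡n lower

  module Real (b≥ : 1 ≤ b) (i₀ : ℕ) (i₀≤ : i₀ ≤ b) (y j : ℕ → ℕ) (y0 : y 0 ≡ 0) (yb : y b < 2 ^ w)
              (mono : ∀ i → y i ≤ y (suc i))
              (j< : ∀ i → i < b → j i < T.mass i₀ i (suc (y (suc i)) ∸ y i)) where
    open T i₀

    Gat : ℕ → ℕ → ℕ
    Gat n i = Gmin n i (sh n (y (suc i))) (sh n (y i))

    lv : ℕ → ℕ → ℕ
    lv i n = level i (y (suc i)) (y i) (j i) n

    lev : ℕ → ℕ
    lev i = if flag i then 0 else lv i d

    private
      mono* : ∀ {i k} → i ≤ k → y i ≤ y k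
      mono* = stepwise-mono y mono

      diff : ∀ i → suc (y (suc i)) ∸ y i ≡ suc (y (suc i) ∸ y i)
      diff i = +-∸-assoc 1 (mono i)

      j<good : ∀ i → i < b → flag i ≡ false → j i < good (cs i) (suc (y (suc i)) ∸ y i)
      j<good i i< fl = subst (λ c → j i < (if c then bad (cs i) (suc (y (suc i)) ∸ y i) else good (cs i) (suc (y (suc i)) ∸ y i))) fl (j< i i<)

      j<bad : ∀ i → i < b → flag i ≡ true → j i < bad (cs i) (suc (y (suc i)) ∸ y i)
      j<bad i i< fl = subst (λ c → j i < (if c then bad (cs i) (suc (y (suc i)) ∸ y i) else good (cs i) (suc (y (suc i)) ∸ y i))) fl (j< i i<)

      ent : ℕ → Entry
      ent k = if isFull k then full (y k) else block (sh d (y k))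

      rp : ℕ → ℕ → List Entry
      rp zero i = []
      rp (suc r) i = ent (suc i) ∷ rp r (suc i)

      pts : ℕ → ℕ → List ℕ
      pts zero i = []
      pts (suc r) i = y (suc i) ∷ j i ∷ pts r (suc i)

      top-ent : ∀ k → top (ent k) ≡ sh d (y k)
      top-ent k with isFull k
      ... | true = refl
      ... | false = refl

      not-full⇒good : ∀ i → isFull (suc i) ≡ false → flag i ≡ false
      not-full⇒good i h with suc i ≡ᵇ i₀ | i ≡ᵇ i₀
      not-full⇒good i () | true | _
      not-full⇒good i () | false | true
      ... | false | false = refl

      ent∈opts : ∀ i → i < b → ent (suc i) ∈ opts i (sh d (y i))
      ent∈opts i i< with isFull (suc i) in eq
      ... | true = ∈-map⁺ full (∈-downFrom⁺ (≤-<-trans (mono* i<) yb))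
      ... | false with block-step i (mono i) (subst (λ z → 0 < good (cs i) z) (diff i) (≤-<-trans z≤n (j<good i i< (not-full⇒good i eq))))
      ...   | h , h< , e rewrite e = ∈-map⁺ (λ h → block (sh d (y i) + lo (cs i) + h)) (∈-downFrom⁺ h<)

      rp∈profs : ∀ r i H → i + r ≡ b → H ≡ sh d (y i) → rp r i ∈ profs r i H
      rp∈profs zero i H _ _ = here refl
      rp∈profs (suc r) i H eq refl = ∈-concatMap (λ e → map (e ∷_) (profs r (suc i) (top e))) (ent∈opts i i<)
        (∈-map⁺ (ent (suc i) ∷_) (rp∈profs r (suc i) (top (ent (suc i))) (trans (sym (+-suc i r)) eq) (top-ent (suc i))))
        where
        i< : i < b
        i< = subst (i <_) eq (m<m+n i (s≤s z≤n))

      j-bound : ∀ i → i < b → j i < 2 ^ (suc A ∸ (if isFull (suc i) then 0 else d))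
      j-bound i i< = go (isFull (suc i)) refl (flag i) refl
        where
        go : ∀ c → isFull (suc i) ≡ c → ∀ c′ → flag i ≡ c′ → j i < 2 ^ (suc A ∸ (if c then 0 else d))
        go false eq true fl = ⊥-elim (true≢false (trans (sym fl) (not-full⇒good i eq)))
        go false eq false fl = <-≤-trans (j<good i i< fl) (good-max (cs i) _)
        go true eq false fl = <-≤-trans (j<good i i< fl) (≤-trans (good-max (cs i) _) (2^-mono (m∸n≤m (suc A) d)))
        go true eq true fl = <-≤-trans (j<bad i i< fl) (≤-trans (≤-trans (sumTo-term (bad (cs i)) {n = suc (suc (y (suc i)) ∸ y i)} ≤-refl) (bad-sum (cs i) _))
          (≤-trans (m≤n+m (Z (cs i)) (G (cs i))) (≤-trans (total (cs i)) (K-upper (cs i)))))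

      pts-InBox : ∀ r i → i + r ≡ b → InBox (pts r i) (boxOf (rp r i))
      pts-InBox zero i _ = tt
      pts-InBox (suc r) i eq with isFull (suc i) | j-bound i (subst (i <_) eq (m<m+n i (s≤s z≤n)))
      ... | true | jb = here refl , ∈-downFrom⁺ jb , pts-InBox r (suc i) (trans (sym (+-suc i r)) eq)
      ... | false | jb = subst (_∈ map (λ u → sh d (y (suc i)) * 2 ^ d + u) (downFrom (2 ^ d))) (low-eq d (y (suc i)))
                           (∈-map⁺ (λ u → sh d (y (suc i)) * 2 ^ d + u) (∈-downFrom⁺ (low-< d (y (suc i))))) ,
                         ∈-downFrom⁺ jb , pts-InBox r (suc i) (trans (sym (+-suc i r)) eq)

      prof : List Entry
      prof = rp b 0

      v : List ℕ
      v = 0 ∷ 0 ∷ pts b 0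

      pts-y : ∀ r i k → k < r → nth 0 (pts r i) (k * 2) ≡ y (suc (i + k))
      pts-y (suc r) i zero _ = cong (y ∘ suc) (sym (+-identityʳ i))
      pts-y (suc r) i (suc k) (s≤s k<) = trans (pts-y r (suc i) k k<) (cong (y ∘ suc) (sym (+-suc i k)))

      pts-j : ∀ r i k → k < r → nth 0 (pts r i) (suc (k * 2)) ≡ j (i + k)
      pts-j (suc r) i zero _ = cong j (sym (+-identityʳ i))
      pts-j (suc r) i (suc k) (s≤s k<) = trans (pts-j r (suc i) k k<) (cong j (sym (+-suc i k)))

      v-y : ∀ k → k ≤ b → nth 0 v (posY k) ≡ y k
      v-y zero _ = sym y0
      v-y (suc k) k< = pts-y b 0 k k<

      v-j : ∀ i → i < b → nth 0 v (posJ i) ≡ j i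
      v-j i i< = pts-j b 0 i i<

      e : ℕ → Entry
      e = entAt prof

      rp-nth : ∀ r i k → k < r → nth (full 0) (rp r i) k ≡ ent (suc (i + k))
      rp-nth (suc r) i zero _ = cong (ent ∘ suc) (sym (+-identityʳ i))
      rp-nth (suc r) i (suc k) (s≤s k<) = trans (rp-nth r (suc i) k k<) (cong (ent ∘ suc) (sym (+-suc i k)))

      e-suc : ∀ k → k < b → e (suc k) ≡ ent (suc k)
      e-suc k k< = rp-nth b 0 k k<

      e-top : ∀ k → k ≤ b → top (e k) ≡ sh d (y k)
      e-top zero _ = cong (sh d) (sym y0)
      e-top (suc k) k< = trans (cong top (e-suc k k<)) (top-ent (suc k))

      e-full : ∀ k → k ≤ b → isFull k ≡ true → e k ≡ full (y k)
      e-full zero _ _ = cong full (sym y0)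
      e-full (suc k) k< h rewrite e-suc k k< | h = refl

      open Protocol e

      lv-0 : ∀ i → i < b → flag i ≡ false → (j i <ᵇ Gat 0 i) ≡ true
      lv-0 i i< fl = <⇒<ᵇ-true (<-≤-trans (j<good i i< fl) (≤-reflexive (sym (lem (λ u v → good (cs i) (suc (y (suc i) * 1 + u) ∸ (y i * 1 + v)))
          (cong₂ (λ p q → good (cs i) (suc p ∸ q)) (trans (+-identityʳ (y (suc i) * 1)) (*-identityʳ (y (suc i)))) (trans (+-identityʳ (y i * 1)) (*-identityʳ (y i))))))))
        where
        lem : ∀ {g} (f : ℕ → ℕ → ℕ) → f 0 0 ≡ g → (f 0 0 ⊓ f 0 0) ⊓ (f 0 0 ⊓ f 0 0) ≡ g
        lem f h rewrite ⊓-idem (f 0 0) = trans (⊓-idem (f 0 0)) h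

      -- Child i consumes exactly `lev i` units of fuel, so the protocol fails on an actual tuple
      -- only if the sum of the levels exceeds the fuel.
      go-complete : ∀ r i f → i + r ≡ b → sumFrom lev i r ≤ f → run? (go r i f) v ≡ true
      go-complete zero i f _ _ = refl
      go-complete (suc r) i f eq le = main (flag i) refl
        where
        i< : i < b
        i< = subst (i <_) eq (m<m+n i (s≤s z≤n))
        eq′ : suc i + r ≡ b
        eq′ = trans (sym (+-suc i r)) eq
        rest : ∀ f → sumFrom lev (suc i) r ≤ f → run? (go r (suc i) f) v ≡ true
        rest f = go-complete r (suc i) f eq′
        lp-complete : ∀ n f → flag i ≡ false → lv i n + sumFrom lev (suc i) r ≤ f →
          run? (lp r i n (sh n (y (suc i))) (sh n (y i)) f) v ≡ true
        lp-complete zero f fl le rewrite v-j i i< | lv-0 i i< fl = rest f le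
        lp-complete (suc n) f fl le rewrite v-j i i< with j i <ᵇ Gat (suc n) i
        ... | true = rest f le
        lp-complete (suc n) (suc f) fl (s≤s le) | false = trans (run-refine r i n (sh (suc n) (y (suc i))) (sh (suc n) (y i)) f v)
          (trans (cong₂ (λ α β → run? (lp r i n α β f) v)
            (trans (cong (λ z → child (isOdd n (sh (suc n) (y (suc i))) z) (sh (suc n) (y (suc i)))) (v-y (suc i) i<)) (child-sh n (y (suc i))))
            (trans (cong (λ z → child (isOdd n (sh (suc n) (y i)) z) (sh (suc n) (y i))) (v-y i (<⇒≤ i<))) (child-sh n (y i))))
          (lp-complete n f fl le))
        full-i : flag i ≡ true → isFull i ≡ true
        full-i fl rewrite fl = refl
        full-suc : flag i ≡ true → isFull (suc i) ≡ true
        full-suc fl with suc i ≡ᵇ i₀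
        ... | true = refl
        ... | false rewrite fl = refl
        main : ∀ c → flag i ≡ c → run? (if c then goBad r i f (e (suc i)) (e i) else lp r i d (top (e (suc i))) (top (e i)) f) v ≡ true
        main true fl rewrite e-full (suc i) i< (full-suc fl) | e-full i (<⇒≤ i<) (full-i fl) | v-j i i< | <⇒<ᵇ-true (j<bad i i< fl) =
          rest f (≤-trans (m≤n+m _ (lev i)) le)
        main false fl rewrite e-top (suc i) i< | e-top i (<⇒≤ i<) =
          lp-complete d f fl (subst (λ c → (if c then 0 else lv i d) + sumFrom lev (suc i) r ≤ f) fl le)

    -- The key is the leaf reached by the tuple. Within a box the coordinates are independent, so
    -- field i is the position of its sum and its index in the two coordinate lists.
    encode : sumTo lev b ≤ R → ∃ λ κ → κ ∈ typKeys × proj₁ κ ≡ i₀ × tlabel κ ≡ y b ×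
      ∃ λ (u : ℕ → ℕ) → ∀ i → i < b → u i < tsize (proj₂ (proj₂ κ)) i ×
        ydec (proj₂ (proj₂ κ)) i (u i) ≡ y (suc i) × jdec (proj₂ (proj₂ κ)) i (u i) ≡ j i
    encode le with okLeaves-run (protocol prof) v (initBox prof) v∈
                     (go-complete b 0 R refl (≤-trans (≤-reflexive (sumFrom-sumTo lev b)) le))
      where
      v∈ : InBox v (initBox prof)
      v∈ = here refl , here refl , pts-InBox b 0 refl
    ... | F , F∈ , v∈F = (i₀ , prof , F) , κ∈ , refl , label-eq , u , fields
      where
      κ∈ : (i₀ , prof , F) ∈ typKeys
      κ∈ = ∈-concatMap byFlag (∈-downFrom⁺ (s≤s i₀≤)) (∈-concatMap (byProf i₀) (rp∈profs b 0 0 refl (trans (sym (n≤0⇒n≡0 (sh-≤ d 0))) (cong (sh d) (sym y0))))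
             (∈-map⁺ (λ F → i₀ , prof , F) F∈))
      full-b : isFull b ≡ true
      full-b with b ≡ᵇ i₀ | b ≡ᵇ suc i₀
      ... | true | _ = refl
      ... | false | true = refl
      ... | false | false = ≡ᵇ-self b
      label-eq : entryValue (e b) ≡ y b
      label-eq rewrite e-full b ≤-refl full-b = refl
      len-pts : ∀ r i → length (pts r i) ≡ r * 2
      len-pts zero i = refl
      len-pts (suc r) i = cong (suc ∘ suc) (len-pts r (suc i))
      len : length F ≡ suc b * 2
      len = trans (sym (InBox-length v F v∈F)) (cong (suc ∘ suc) (len-pts b 0))
      mem : ∀ c → c < suc b * 2 → nth 0 v c ∈ nth [] F c
      mem c c< = InBox-nth v F c v∈F (subst (c <_) (sym len) c<)
      pos : ∀ c → c < suc b * 2 → 0 < side F c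
      pos c c< with ∈⇒nth 0 (mem c c<)
      ... | k , k< , _ = ≤-<-trans z≤n k<
      -- A side only shrinks along the protocol, and it still contains the coordinate of the point,
      -- so length one is preserved.
      one : ∀ c → c < suc b * 2 → side (initBox prof) c ≡ 1 → side F c ≡ 1
      one c c< h = ≤-antisym (≤-trans (side-okLeaves (protocol prof) (initBox prof) F∈ c) (≤-reflexive h)) (pos c c<)
      reg : regular F ≡ true
      reg rewrite len | one 0 (s≤s z≤n) refl | one 1 (s≤s (s≤s z≤n)) refl | ≡ᵇ-self (b * 2) = refl
      posY< : ∀ i → i < b → suc i * 2 < suc b * 2
      posY< i i< = *-monoˡ-< 2 (s≤s i<)
      posJ< : ∀ i → i < b → suc (suc i * 2) < suc b * 2
      posJ< i i< = *-monoˡ-≤ 2 (s≤s i<)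
      iy ij : ∀ i → i < b → ℕ
      iy i i< = proj₁ (∈⇒nth 0 (mem (suc i * 2) (posY< i i<)))
      ij i i< = proj₁ (∈⇒nth 0 (mem (suc (suc i * 2)) (posJ< i i<)))
      u : ℕ → ℕ
      u i with i <? b
      ... | yes i< = pair (side F (suc i * 2)) (iy i i<) (ij i i<)
      ... | no _ = 0
      fields : ∀ i → i < b → u i < tsize F i × ydec F i (u i) ≡ y (suc i) × jdec F i (u i) ≡ j i
      fields i i<′ with i <? b
      ... | no p = ⊥-elim (p i<′)
      ... | yes i< = lt , yd , jd
        where
        Y = ∈⇒nth 0 (mem (suc i * 2) (posY< i i<))
        J = ∈⇒nth 0 (mem (suc (suc i * 2)) (posJ< i i<))
        lt : pair (side F (suc i * 2)) (iy i i<) (ij i i<) < tsize F i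
        lt rewrite reg = pair-< (proj₁ (proj₂ Y)) (proj₁ (proj₂ J))
        yd : ydec F i (pair (side F (suc i * 2)) (iy i i<) (ij i i<)) ≡ y (suc i)
        yd rewrite pfst-pair (side F (suc i * 2)) (iy i i<) (ij i i<) (proj₁ (proj₂ Y)) = trans (proj₂ (proj₂ Y)) (v-y (suc i) i<)
        jd : jdec F i (pair (side F (suc i * 2)) (iy i i<) (ij i i<)) ≡ j i
        jd rewrite psnd-pair (side F (suc i * 2)) (iy i i<) (ij i i<) (proj₁ (proj₂ Y)) = trans (proj₂ (proj₂ J)) (v-j i i<)

-- Exceptional tuples of states

-- What an exceptional key says of a child: that its state is bad, or the block step h and the
-- number e of refinements of a good one.
data EItem : Set where
  ebad  : EItem
  egood : ℕ → ℕ → EItem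

module Escape (w a d b : ℕ) (cs : ℕ → Params.Child w a d)
              (d≤w : 1 + 2 * d ≤ w) (300w≤A : 300 * w ≤ Params.A w a) where
  open Params w a
  open Child
  open Node w a d b cs
  private
    w≤A : w ≤ A
    w≤A = ≤-trans (m≤m+n w (299 * w)) 300w≤A
    2d<A : 1 + 2 * d ≤ A
    2d<A = ≤-trans d≤w w≤A
    d≤A : d ≤ A
    d≤A = ≤-trans (≤-trans (m≤m+n d (d + 0)) (n≤1+n (2 * d))) 2d<A
  open TypicalKeys w a d b cs (m≤n⇒m≤1+n d≤A)

  EKey : Set
  EKey = ℕ × List EItem

  eopts : List EItem
  eopts = ebad ∷ concatMap (λ h → map (egood h) (downFrom (suc d))) (downFrom W)

  eopts-count : length eopts ≡ suc (W * suc d)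
  eopts-count = cong suc (trans (length-concatMap (λ h → map (egood h) (downFrom (suc d))) (downFrom W))
    (trans (sumTo-cong W λ h _ → trans (length-map (egood h) (downFrom (suc d))) (length-downFrom (suc d)))
      (trans (sumOf-const (suc d) (downFrom W)) (cong (_* suc d) (length-downFrom W)))))

  lists : ℕ → List (List EItem)
  lists zero = [] ∷ []
  lists (suc r) = concatMap (λ x → map (x ∷_) (lists r)) eopts

  lists-count : ∀ r → length (lists r) ≤ suc (W * suc d) ^ r
  lists-count zero = ≤-refl
  lists-count (suc r) = ≤-trans (length-concatMap-≤ (λ x → map (x ∷_) (lists r)) eopts (suc (W * suc d) ^ r) λ x →
      ≤-trans (≤-reflexive (length-map (x ∷_) (lists r))) (lists-count r))
    (≤-reflexive (cong (_* suc (W * suc d) ^ r) eopts-count))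

  escKeys : List EKey
  escKeys = concatMap (λ X → map (X ,_) (lists b)) (downFrom (2 ^ w))

  escKeys-count : length escKeys ≤ 2 ^ w * suc (W * suc d) ^ b
  escKeys-count = ≤-trans (length-concatMap-≤ (λ X → map (X ,_) (lists b)) (downFrom (2 ^ w)) (suc (W * suc d) ^ b) λ X →
      ≤-trans (≤-reflexive (length-map (X ,_) (lists b))) (lists-count b))
    (≤-reflexive (cong (_* suc (W * suc d) ^ b) (length-downFrom (2 ^ w))))

  item : EKey → ℕ → EItem
  item (X , xs) i = nth ebad xs i

  -- A bad state is one of 2^(A - 18 w), and 2 w bits go to an absolute record of the prefix sum, so
  -- 16 w are saved. A good state saves one bit per refinement.
  saving : EItem → ℕ
  saving ebad = 16 * w
  saving (egood h e) = e

  savings : EKey → ℕ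
  savings κ = sumTo (λ i → saving (item κ i)) b

  -- Every field begins with the low d bits of the sum after the child. A bad child adds the
  -- absolute block index and the number of its state, a good child the position of its index within
  -- a window.
  isize : ℕ → EItem → ℕ
  isize i ebad = 2 ^ d * (2 ^ w * Z (cs i))
  isize i (egood h e) = 2 ^ d * 2 ^ (suc A ∸ (d + e))

  -- Keys that save fewer than R bits do not occur and get no room.
  esize : EKey → ℕ → ℕ
  esize κ i = if R <ᵇ suc (savings κ) then isize i (item κ i) else 0

  Fits : EItem → Set
  Fits ebad = ⊤
  Fits (egood h e) = e ≤ d

  private
    eopts-fits : ∀ {x} → x ∈ eopts → Fits x
    eopts-fits (here refl) = tt
    eopts-fits (there x∈) with ∈-concatMap⁻ (λ h → map (egood h) (downFrom (suc d))) (downFrom W) x∈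
    ... | h , _ , x∈₁ with ∈-map⁻ (egood h) x∈₁
    ...   | e , e∈ , refl = ≤-pred (∈-downFrom⁻ e∈)

    lists-fits : ∀ r {xs} → xs ∈ lists r → ∀ i → Fits (nth ebad xs i)
    lists-fits zero (here refl) i = tt
    lists-fits (suc r) xs∈ i with ∈-concatMap⁻ (λ x → map (x ∷_) (lists r)) eopts xs∈
    ... | x , x∈ , xs∈₁ with ∈-map⁻ (x ∷_) xs∈₁
    lists-fits (suc r) xs∈ zero | x , x∈ , xs∈₁ | xs′ , xs′∈ , refl = eopts-fits x∈
    lists-fits (suc r) xs∈ (suc i) | x , x∈ , xs∈₁ | xs′ , xs′∈ , refl = lists-fits r xs′∈ i

    key-fits : ∀ {κ} → κ ∈ escKeys → ∀ i → Fits (item κ i)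
    key-fits κ∈ i with ∈-concatMap⁻ (λ X → map (X ,_) (lists b)) (downFrom (2 ^ w)) κ∈
    ... | X , _ , κ∈₁ with ∈-map⁻ (X ,_) κ∈₁
    ...   | xs , xs∈ , refl = lists-fits b xs∈ i

    saving≤A : ∀ x → Fits x → saving x ≤ suc A
    saving≤A ebad _ = m≤n⇒m≤1+n (≤-trans (*-monoˡ-≤ w (m≤m+n 16 284)) 300w≤A)
    saving≤A (egood h e) e≤ = m≤n⇒m≤1+n (≤-trans e≤ d≤A)

    d+e≤ : ∀ {e} → e ≤ d → d + e ≤ A
    d+e≤ {e} e≤ = ≤-trans (≤-trans (+-monoʳ-≤ d (≤-trans e≤ (≤-reflexive (sym (+-identityʳ d))))) (n≤1+n (2 * d))) 2d<A

    isize-≤ : ∀ i x → Fits x → isize i x ≤ 2 ^ (suc A ∸ saving x)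
    isize-≤ i ebad _ = 2^*2^≤ d (w + (A ∸ 18 * w)) ≤-refl (2^*2^≤ w (A ∸ 18 * w) ≤-refl (Z-small (cs i)) ≤-refl)
      (m≤n⇒m≤n∸o (≤-trans (+-monoˡ-≤ (16 * w) (+-monoˡ-≤ (w + (A ∸ 18 * w)) d≤w′))
        (≤-trans (≤-reflexive (trans (lem w (A ∸ 18 * w)) (m∸n+n≡m (≤-trans (*-monoˡ-≤ w (m≤m+n 18 282)) 300w≤A)))) (n≤1+n A))))
      where
      d≤w′ : d ≤ w
      d≤w′ = ≤-trans (≤-trans (m≤m+n d (d + 0)) (n≤1+n (2 * d))) d≤w
      lem : ∀ w x → w + (w + x) + 16 * w ≡ x + 18 * w
      lem = solve-∀
      m≤n⇒m≤n∸o : ∀ {m n o} → m + o ≤ n → m ≤ n ∸ o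
      m≤n⇒m≤n∸o {m} {n} {o} h = ≤-trans (≤-reflexive (sym (m+n∸n≡m m o))) (∸-monoˡ-≤ o h)
    isize-≤ i (egood h e) e≤ = ≤-reflexive (trans (sym (2^-+ d (suc A ∸ (d + e)))) (cong (2 ^_)
      (trans (cong (d +_) (sym (∸-+-assoc (suc A) d e))) (trans (sym (+-∸-assoc d (≤-trans e≤d′ (≤-reflexive refl)))) (cong (_∸ e) (m+[n∸m]≡n (m≤n⇒m≤1+n d≤A)))))))
      where
      e≤d′ : e ≤ suc A ∸ d
      e≤d′ = ≤-trans (≤-reflexive (sym (m+n∸m≡n d e))) (∸-monoˡ-≤ d (m≤n⇒m≤1+n (d+e≤ e≤)))

  esize-≤ : ∀ {κ} → κ ∈ escKeys → ∀ i → esize κ i ≤ 2 ^ suc A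
  esize-≤ {κ} κ∈ i with R <ᵇ suc (savings κ)
  ... | true = ≤-trans (isize-≤ i (item κ i) (key-fits κ∈ i)) (2^-mono (m∸n≤m (suc A) (saving (item κ i))))
  ... | false = z≤n

  esize-volume : 1 ≤ b → ∀ {κ} → κ ∈ escKeys → prodTo (esize κ) b * 2 ^ R ≤ 2 ^ (suc A * b)
  esize-volume b≥ {κ} κ∈ with R <ᵇ suc (savings κ) in eq
  ... | false = ≤-trans (≤-reflexive (cong (_* 2 ^ R) (prodTo-zero b b≥))) z≤n
  ... | true = begin
    prodTo (λ i → isize i (item κ i)) b * 2 ^ R
      ≤⟨ *-mono-≤ (prodTo-mono b λ i _ → isize-≤ i (item κ i) (key-fits κ∈ i)) (2^-mono {R} {savings κ} (≤-pred (<ᵇ-true⇒< {R} {suc (savings κ)} eq))) ⟩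
    prodTo (λ i → 2 ^ (suc A ∸ s i)) b * 2 ^ sumTo s b
      ≡⟨ cong (prodTo (λ i → 2 ^ (suc A ∸ s i)) b *_) (sym (sumTo-pow 2 s b)) ⟩
    prodTo (λ i → 2 ^ (suc A ∸ s i)) b * prodTo (λ i → 2 ^ s i) b
      ≡⟨ sym (prodTo-* (λ i → 2 ^ (suc A ∸ s i)) (λ i → 2 ^ s i) b) ⟩
    prodTo (λ i → 2 ^ (suc A ∸ s i) * 2 ^ s i) b
      ≡⟨ prodTo-cong b (λ i _ → trans (sym (2^-+ (suc A ∸ s i) (s i))) (cong (2 ^_) (m∸n+n≡m (saving≤A (item κ i) (key-fits κ∈ i))))) ⟩
    prodTo (λ _ → 2 ^ suc A) b
      ≡⟨ trans (prodTo-const (2 ^ suc A) b) (^-*-assoc 2 (suc A) b) ⟩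
    2 ^ (suc A * b) ∎
    where
    open ≤-Reasoning
    s : ℕ → ℕ
    s i = saving (item κ i)

  escKeys-volume : 1 ≤ b → sumOf (λ κ → prodTo (esize κ) b) escKeys * 2 ^ R ≤ length escKeys * 2 ^ (suc A * b)
  escKeys-volume b≥ = ≤-trans (≤-reflexive (sym (sumOf-*ʳ (2 ^ R) (λ κ → prodTo (esize κ) b) escKeys)))
    (sumOf-≤ (2 ^ (suc A * b)) escKeys λ κ κ∈ → esize-volume b≥ κ∈)

  -- lastBad is junk unless someBad holds.
  lastBad offset : EKey → ℕ → ℕ
  someBad : EKey → ℕ → Bool
  lastBad κ zero = 0
  lastBad κ (suc i) with item κ i
  ... | ebad = i
  ... | egood _ _ = lastBad κ i
  someBad κ zero = false
  someBad κ (suc i) with item κ i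
  ... | ebad = true
  ... | egood _ _ = someBad κ i
  offset κ zero = 0
  offset κ (suc i) with item κ i
  ... | ebad = 0
  ... | egood h _ = offset κ i + lo (cs i) + h

  lastBad-≤ : ∀ κ i → lastBad κ i ≤ i
  lastBad-≤ κ zero = ≤-refl
  lastBad-≤ κ (suc i) with item κ i
  ... | ebad = n≤1+n i
  ... | egood _ _ = m≤n⇒m≤1+n (lastBad-≤ κ i)

  -- Block steps in the key accumulate from the last bad child on, whose field `vp` records the
  -- block absolutely. Without a bad child they accumulate from 0.
  eH : EKey → ℕ → ℕ → ℕ
  eH κ i vp = (if someBad κ i then pfst (2 ^ w) (psnd (2 ^ d) vp) else 0) + offset κ i

  ey : EKey → ℕ → ℕ → ℕ → ℕ
  ey κ zero v₋ vp = 0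
  ey κ (suc i) v₋ vp = eH κ (suc i) vp * 2 ^ d + pfst (2 ^ d) v₋

  -- The minimum in the last test that failed, from which the index is measured; both sides know it
  -- once the two sums are decoded.
  floor : ℕ → ℕ → ℕ → ℕ → ℕ
  floor i y′ y zero = 0
  floor i y′ y (suc k) = Gmin (d ∸ k) i (sh (d ∸ k) y′) (sh (d ∸ k) y)

  eσ : EKey → ℕ → ℕ → ℕ → ℕ → ℕ
  eσ κ i v₋ v vp with item κ i
  ... | ebad = badState (cs i) (psnd (2 ^ w) (psnd (2 ^ d) v))
  ... | egood h e = state (cs i) false (suc y′ ∸ y) (psnd (2 ^ d) v + floor i y′ y e)
    where
    y = ey κ i v₋ vp
    y′ = (eH κ i vp + lo (cs i) + h) * 2 ^ d + pfst (2 ^ d) v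

  level-≤ : ∀ i y′ y j n → level i y′ y j n ≤ n
  level-≤ i y′ y j zero = z≤n
  level-≤ i y′ y j (suc n) with j <ᵇ Gmin (suc n) i (sh (suc n) y′) (sh (suc n) y)
  ... | true = z≤n
  ... | false = s≤s (level-≤ i y′ y j n)

  level-spec : ∀ i y′ y j n k → level i y′ y j n ≡ suc k → Gmin (n ∸ k) i (sh (n ∸ k) y′) (sh (n ∸ k) y) ≤ j
  level-spec i y′ y j (suc n) k h with j <ᵇ Gmin (suc n) i (sh (suc n) y′) (sh (suc n) y) in eq
  level-spec i y′ y j (suc n) zero h | false = <ᵇ-false⇒≥ eq
  level-spec i y′ y j (suc n) (suc k) h | false = level-spec i y′ y j n k (suc-injective h)

  private
    good-close : ∀ i z₁ z₂ k → z₁ ≤ z₂ + k → z₂ ≤ z₁ + k → good (cs i) z₁ ≤ good (cs i) z₂ + k * 2 ^ (A ∸ (1 + 2 * d))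
    good-close i z₁ z₂ k h₁ h₂ with ≤-total z₁ z₂
    ... | inj₁ le = ≤-trans (proj₁ (Close-iter (good (cs i)) _ (smooth (cs i)) z₁ (z₂ ∸ z₁)))
          (+-mono-≤ (≤-reflexive (cong (good (cs i)) (m∸n+n≡m le))) (*-monoˡ-≤ (2 ^ (A ∸ (1 + 2 * d))) (m≤n+o⇒m∸n≤o z₂ z₁ h₂)))
    ... | inj₂ le = ≤-trans (≤-reflexive (cong (good (cs i)) (sym (m∸n+n≡m le)))) (≤-trans (proj₂ (Close-iter (good (cs i)) _ (smooth (cs i)) z₂ (z₁ ∸ z₂)))
          (+-monoʳ-≤ (good (cs i) z₂) (*-monoˡ-≤ (2 ^ (A ∸ (1 + 2 * d))) (m≤n+o⇒m∸n≤o z₁ z₂ h₁))))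

    diff-close : ∀ P y′ y x′ x → y′ ≤ x′ + P → x ≤ y + P → suc y′ ∸ y ≤ suc x′ ∸ x + 2 * P
    diff-close P y′ y x′ x h₁ h₂ = m≤n+o⇒m∸n≤o (suc y′) y (≤-trans (s≤s h₁) (≤-trans (+-monoˡ-≤ P (m≤n+m∸n (suc x′) x))
      (≤-trans (+-monoˡ-≤ P (+-monoˡ-≤ (suc x′ ∸ x) h₂)) (≤-reflexive (lem y P (suc x′ ∸ x))))))
      where
      lem : ∀ y P z → y + P + z + P ≡ y + (z + 2 * P)
      lem = solve-∀

    block-close : ∀ n y u → u < 2 ^ n → y ≤ sh n y * 2 ^ n + u + 2 ^ n × sh n y * 2 ^ n + u ≤ y + 2 ^ n
    block-close n y u u< = ≤-trans (<⇒≤ (sh-upper n y)) (+-monoˡ-≤ (2 ^ n) (m≤m+n (sh n y * 2 ^ n) u)) ,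
                           +-mono-≤ (sh-lower n y) (<⇒≤ u<)

  -- Within blocks of length 2^n the difference of the two sums varies by at most 2 * 2^n, and
  -- smoothness bounds the change per unit.
  window : ∀ i y′ y n → good (cs i) (suc y′ ∸ y) ≤ Gmin n i (sh n y′) (sh n y) + 2 * 2 ^ n * 2 ^ (A ∸ (1 + 2 * d))
  window i y′ y n with minTo-attained (λ u → minTo (λ v → good (cs i) (suc (sh n y′ * 2 ^ n + u) ∸ (sh n y * 2 ^ n + v))) (2 ^ n)) (2 ^ n) (2^>0 n)
  ... | u , u< , e₁ with minTo-attained (λ v → good (cs i) (suc (sh n y′ * 2 ^ n + u) ∸ (sh n y * 2 ^ n + v))) (2 ^ n) (2^>0 n)
  ...   | v , v< , e₂ rewrite trans e₁ e₂ with block-close n y′ u u< | block-close n y v v<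
  ...     | p₁ , p₂ | q₁ , q₂ = good-close i _ _ (2 * 2 ^ n) (diff-close (2 ^ n) y′ y _ _ p₁ q₂) (diff-close (2 ^ n) _ _ y′ y p₂ q₁)

  -- After e ≥ 1 refinements the last failed test was at scale d - e + 1, where the window has width
  -- 2^(A + 1 - d - e). For e = 0 the bound is `good-max`.
  payload-< : ∀ i y′ y j → j < good (cs i) (suc y′ ∸ y) →
    floor i y′ y (level i y′ y j d) ≤ j × j ∸ floor i y′ y (level i y′ y j d) < 2 ^ (suc A ∸ (d + level i y′ y j d))
  payload-< i y′ y j j< with level i y′ y j d in eq
  ... | zero = z≤n , <-≤-trans j< (≤-trans (good-max (cs i) _) (≤-reflexive (cong (λ z → 2 ^ (suc A ∸ z)) (sym (+-identityʳ d)))))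
  ... | suc k = fl≤ , +-cancelˡ-< (floor i y′ y (suc k)) _ _ (subst (_< floor i y′ y (suc k) + 2 ^ (suc A ∸ (d + suc k))) (sym (m+[n∸m]≡n fl≤))
      (<-≤-trans j< (≤-trans (window i y′ y (d ∸ k)) (+-monoʳ-≤ _ (≤-reflexive pow)))))
    where
    fl≤ = level-spec i y′ y j d k eq
    k<d : suc k ≤ d
    k<d = subst (_≤ d) eq (level-≤ i y′ y j d)
    pow : 2 * 2 ^ (d ∸ k) * 2 ^ (A ∸ (1 + 2 * d)) ≡ 2 ^ (suc A ∸ (d + suc k))
    pow = trans (sym (2^-+ (suc (d ∸ k)) (A ∸ (1 + 2 * d)))) (cong (2 ^_) (+-cancelʳ-≡ (d + suc k) (suc (d ∸ k) + (A ∸ (1 + 2 * d))) (suc A ∸ (d + suc k)) (trans (trans (lem₁ (d ∸ k) (A ∸ (1 + 2 * d)) d k)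
        (trans (cong (λ z → A ∸ (1 + 2 * d) + (2 + z + d)) (m∸n+n≡m (<⇒≤ k<d))) (trans (lem₂ (A ∸ (1 + 2 * d)) d) (cong suc (m∸n+n≡m 2d<A)))))
        (sym (m∸n+n≡m (m≤n⇒m≤1+n (d+e≤ k<d)))))))
      where
      lem₁ : ∀ x A′ d k → suc x + A′ + (d + suc k) ≡ A′ + (2 + (x + k) + d)
      lem₁ = solve-∀
      lem₂ : ∀ A′ d → A′ + (2 + d + d) ≡ suc (A′ + (1 + 2 * d))
      lem₂ = solve-∀

  module RealEscape (y j ζ : ℕ → ℕ) (isBad : ℕ → Bool) (σ : ℕ → ℕ) (y0 : y 0 ≡ 0) (yb : y b < 2 ^ w) (mono : ∀ i → y i ≤ y (suc i))
              (good-case : ∀ i → i < b → isBad i ≡ false →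
                 j i < good (cs i) (suc (y (suc i)) ∸ y i) × state (cs i) false (suc (y (suc i)) ∸ y i) (j i) ≡ σ i)
              (bad-case : ∀ i → i < b → isBad i ≡ true → ζ i < Z (cs i) × badState (cs i) (ζ i) ≡ σ i) where

    lev : ℕ → ℕ
    lev i = level i (y (suc i)) (y i) (j i) d

    step : ℕ → ℕ
    step i = sh d (y (suc i)) ∸ (sh d (y i) + lo (cs i))

    it : ℕ → EItem
    it i = if isBad i then ebad else egood (step i) (lev i)

    private
      mono* : ∀ {i k} → i ≤ k → y i ≤ y k
      mono* = stepwise-mono y mono

      its : ℕ → ℕ → List EItem
      its zero i = []
      its (suc r) i = it i ∷ its r (suc i)

      its-nth : ∀ r i k → k < r → nth ebad (its r i) k ≡ it (i + k)
      its-nth (suc r) i zero _ = cong it (sym (+-identityʳ i))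
      its-nth (suc r) i (suc k) (s≤s k<) = trans (its-nth r (suc i) k k<) (cong it (sym (+-suc i k)))

      step-spec : ∀ i → i < b → isBad i ≡ false → step i < W × sh d (y (suc i)) ≡ sh d (y i) + lo (cs i) + step i
      step-spec i i< fl with block-step i (mono i) (subst (λ z → 0 < good (cs i) z) (+-∸-assoc 1 (mono i)) (≤-<-trans z≤n (proj₁ (good-case i i< fl))))
      ... | h , h< , e = subst (_< W) (sym h≡) h< , trans e (cong (sh d (y i) + lo (cs i) +_) (sym h≡))
        where
        h≡ : step i ≡ h
        h≡ = trans (cong (_∸ (sh d (y i) + lo (cs i))) e) (m+n∸m≡n (sh d (y i) + lo (cs i)) h)

      it∈ : ∀ i → i < b → it i ∈ eopts
      it∈ i i< with isBad i in eq
      ... | true = here refl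
      ... | false = there (∈-concatMap (λ h → map (egood h) (downFrom (suc d))) (∈-downFrom⁺ (proj₁ (step-spec i i< eq)))
                      (∈-map⁺ (egood (step i)) (∈-downFrom⁺ (s≤s (level-≤ i (y (suc i)) (y i) (j i) d)))))

      its∈ : ∀ r i → i + r ≡ b → its r i ∈ lists r
      its∈ zero i _ = here refl
      its∈ (suc r) i eq = ∈-concatMap (λ x → map (x ∷_) (lists r)) (it∈ i (subst (i <_) eq (m<m+n i (s≤s z≤n))))
        (∈-map⁺ (it i ∷_) (its∈ r (suc i) (trans (sym (+-suc i r)) eq)))

    κ : EKey
    κ = y b , its b 0

    κ∈ : κ ∈ escKeys
    κ∈ = ∈-concatMap (λ X → map (X ,_) (lists b)) (∈-downFrom⁺ yb) (∈-map⁺ (y b ,_) (its∈ b 0 refl))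

    κ-item : ∀ i → i < b → item κ i ≡ it i
    κ-item i i< = its-nth b 0 i i<

    u : ℕ → ℕ
    u i = pair (2 ^ d) (low d (y (suc i)))
            (if isBad i then pair (2 ^ w) (sh d (y (suc i))) (ζ i) else j i ∸ floor i (y (suc i)) (y i) (lev i))

    private
      u-low : ∀ i → pfst (2 ^ d) (u i) ≡ low d (y (suc i))
      u-low i = pfst-pair (2 ^ d) (low d (y (suc i))) (if isBad i then pair (2 ^ w) (sh d (y (suc i))) (ζ i) else j i ∸ floor i (y (suc i)) (y i) (lev i)) (low-< d (y (suc i)))

      u-pay : ∀ i → psnd (2 ^ d) (u i) ≡ (if isBad i then pair (2 ^ w) (sh d (y (suc i))) (ζ i) else j i ∸ floor i (y (suc i)) (y i) (lev i))
      u-pay i = psnd-pair (2 ^ d) (low d (y (suc i))) (if isBad i then pair (2 ^ w) (sh d (y (suc i))) (ζ i) else j i ∸ floor i (y (suc i)) (y i) (lev i)) (low-< d (y (suc i)))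

      shy< : ∀ i → i < b → sh d (y (suc i)) < 2 ^ w
      shy< i i< = ≤-<-trans (sh-≤ d (y (suc i))) (≤-<-trans (mono* i<) yb)

      isize-u : ∀ i → i < b → u i < isize i (it i)
      isize-u i i< with isBad i in eq
      ... | true = pair-< (low-< d (y (suc i))) (pair-< (shy< i i<) (proj₁ (bad-case i i< eq)))
      ... | false = pair-< (low-< d (y (suc i))) (proj₂ (payload-< i (y (suc i)) (y i) (j i) (proj₁ (good-case i i< eq))))

      eH-spec : ∀ i → i ≤ b → eH κ i (u (lastBad κ i)) ≡ sh d (y i)
      eH-spec zero _ = trans (sym (n≤0⇒n≡0 (sh-≤ d 0))) (cong (sh d) (sym y0))
      eH-spec (suc i) i< = go (isBad i) refl
        where
        go : ∀ c → isBad i ≡ c → eH κ (suc i) (u (lastBad κ (suc i))) ≡ sh d (y (suc i))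
        go true eq rewrite trans (κ-item i i<) (cong (λ c → if c then ebad else egood (step i) (lev i)) eq)
          | u-pay i | eq | pfst-pair (2 ^ w) (sh d (y (suc i))) (ζ i) (shy< i i<) = +-identityʳ _
        go false eq rewrite trans (κ-item i i<) (cong (λ c → if c then ebad else egood (step i) (lev i)) eq) =
          trans (lem B (offset κ i) (lo (cs i)) (step i)) (trans (cong (λ z → z + lo (cs i) + step i) (eH-spec i (<⇒≤ i<))) (sym (proj₂ (step-spec i i< eq))))
          where
          B = if someBad κ i then pfst (2 ^ w) (psnd (2 ^ d) (u (lastBad κ i))) else 0
          lem : ∀ a b c d → a + (b + c + d) ≡ a + b + c + d
          lem = solve-∀

    y-spec : ∀ i → i < b → ey κ i (u (pred i)) (u (lastBad κ i)) ≡ y i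
    y-spec zero _ = sym y0
    y-spec (suc i) i< = trans (cong₂ (λ p q → p * 2 ^ d + q) (eH-spec (suc i) (<⇒≤ i<)) (u-low i)) (low-eq d (y (suc i)))

    σ-spec : ∀ i → i < b → eσ κ i (u (pred i)) (u i) (u (lastBad κ i)) ≡ σ i
    σ-spec i i< = go (isBad i) refl
      where
      go : ∀ c → isBad i ≡ c → eσ κ i (u (pred i)) (u i) (u (lastBad κ i)) ≡ σ i
      go true eq rewrite trans (κ-item i i<) (cong (λ c → if c then ebad else egood (step i) (lev i)) eq)
        | u-pay i | eq | psnd-pair (2 ^ w) (sh d (y (suc i))) (ζ i) (shy< i i<) = proj₂ (bad-case i i< eq)
      go false eq rewrite trans (κ-item i i<) (cong (λ c → if c then ebad else egood (step i) (lev i)) eq)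
        | u-pay i | u-low i | eH-spec i (<⇒≤ i<) | sym (proj₂ (step-spec i i< eq)) | low-eq d (y (suc i)) | y-spec i i< | eq
        | m∸n+n≡m (proj₁ (payload-< i (y (suc i)) (y i) (j i) (proj₁ (good-case i i< eq)))) = proj₂ (good-case i i< eq)

    savings-spec : savings κ ≡ sumTo (λ i → if isBad i then 16 * w else lev i) b
    savings-spec = sumTo-cong b λ i i< → trans (cong saving (κ-item i i<)) (sel (isBad i) i)
      where
      sel : ∀ c i → saving (if c then ebad else egood (step i) (lev i)) ≡ (if c then 16 * w else lev i)
      sel true i = refl
      sel false i = refl

    size-spec : R ≤ savings κ → ∀ i → i < b → u i < esize κ i
    size-spec h i i< rewrite <⇒<ᵇ-true (s≤s h) = subst (λ x → u i < isize i x) (sym (κ-item i i<)) (isize-u i i<)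

-- Packing the states of the children of a node

-- The third alternative means at least two positions, in the form in which it bounds the savings
-- from below.
at-most-one? : ∀ (q : ℕ → Bool) n →
  (∀ i → i < n → q i ≡ false) ⊎
  (∃ λ i₀ → i₀ < n × (∀ i → i < n → q i ≡ (i ≡ᵇ i₀))) ⊎
  (∀ c (f : ℕ → ℕ) → c + c ≤ sumTo (λ i → if q i then c else f i) n)
at-most-one? q zero = inj₁ λ i ()
at-most-one? q (suc n) with at-most-one? q n | q n in eq
... | inj₁ h | false = inj₁ go
  where
  go : ∀ i → i < suc n → q i ≡ false
  go i (s≤s i≤) with m≤n⇒m<n∨m≡n i≤
  ... | inj₁ lt = h i lt
  ... | inj₂ refl = eq
... | inj₁ h | true = inj₂ (inj₁ (n , ≤-refl , go))
  where
  go : ∀ i → i < suc n → q i ≡ (i ≡ᵇ n)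
  go i (s≤s i≤) with m≤n⇒m<n∨m≡n i≤
  ... | inj₁ lt = trans (h i lt) (sym (≡ᵇ-false (<⇒≢ lt)))
  ... | inj₂ refl = trans eq (sym (≡ᵇ-self i))
... | inj₂ (inj₁ (i₀ , i₀< , h)) | false = inj₂ (inj₁ (i₀ , m≤n⇒m≤1+n i₀< , go))
  where
  go : ∀ i → i < suc n → q i ≡ (i ≡ᵇ i₀)
  go i (s≤s i≤) with m≤n⇒m<n∨m≡n i≤
  ... | inj₁ lt = h i lt
  ... | inj₂ refl = trans eq (sym (≡ᵇ-false (λ e → <⇒≢ i₀< (sym e))))
... | inj₂ (inj₁ (i₀ , i₀< , h)) | true = inj₂ (inj₂ λ c f → +-monoʳ-≤ c
    (≤-trans (≤-reflexive (cong (λ b → if b then c else f i₀) (sym (trans (h i₀ i₀<) (≡ᵇ-self i₀))))) (sumTo-term (λ i → if q i then c else f i) i₀<)))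
... | inj₂ (inj₂ h) | t = inj₂ (inj₂ λ c f → ≤-trans (h c f) (m≤n+m _ (if t then c else f n)))

module Pack (w a d b b′ : ℕ) (b≡ : b ≡ suc b′) (cs : ℕ → Params.Child w a d)
            (d≤w : 1 + 2 * d ≤ w) (a≥ : 150 * w ≤ a) (b-small : 3 * b + 2 ≤ w)
            (wl : ℕ) (W≤ : width w ≤ 2 ^ wl) (d≤wl : suc d ≤ 2 ^ wl) (wl-small : b * (2 * wl + 2) ≤ w) where
  open Params w a
  open Child
  private
    300w≤A : 300 * w ≤ A
    300w≤A = 300w≤2a w a a≥
    1≤b : 1 ≤ b
    1≤b = subst (1 ≤_) (sym b≡) (s≤s z≤n)
    b′<b : b′ < b
    b′<b = ≤-reflexive (sym b≡)
    ≤b′ : ∀ {i} → i < b → i ≤ b′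
    ≤b′ {i} i< = ≤-pred (subst (i <_) b≡ i<)
    b′-small : 3 * suc b′ + 2 ≤ w
    b′-small = subst (λ b → 3 * b + 2 ≤ w) b≡ b-small
    w≤a : w ≤ a
    w≤a = ≤-trans (m≤m+n w (149 * w)) a≥
    d≤sA : d ≤ suc A
    d≤sA = ≤-trans (≤-trans (m≤m+n d (d + 0)) (n≤1+n (2 * d))) (≤-trans d≤w (≤-trans w≤a (≤-trans (m≤m+n a a) (n≤1+n A))))

  open Node w a d b cs using (R; module Typical)
  module TK = TypicalKeys w a d b cs d≤sA
  module EK = Escape w a d b cs d≤w 300w≤A

  Key : Set
  Key = TK.TKey ⊎ EK.EKey

  keys : List Key
  keys = map inj₁ TK.typKeys ++ map inj₂ EK.escKeys

  size : Key → ℕ → ℕ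
  size (inj₁ (i₀ , p , F)) = TK.tsize F
  size (inj₂ κ) = EK.esize κ

  label : Key → ℕ
  label (inj₁ κ) = TK.tlabel κ
  label (inj₂ (X , _)) = X

  -- The third field a query needs: under an exceptional key the one that holds the absolute block
  -- index, under a typical key a placeholder.
  aux : Key → ℕ → ℕ
  aux (inj₁ _) i = i
  aux (inj₂ κ) i = EK.lastBad κ i

  decY : Key → ℕ → ℕ → ℕ → ℕ
  decY (inj₁ (i₀ , p , F)) zero v₋ vp = 0
  decY (inj₁ (i₀ , p , F)) (suc i) v₋ vp = TK.ydec F i v₋
  decY (inj₂ κ) i v₋ vp = EK.ey κ i v₋ vp

  decS : Key → ℕ → ℕ → ℕ → ℕ → ℕ
  decS (inj₁ (i₀ , p , F)) i v₋ v vp = state (cs i) (i ≡ᵇ i₀) (suc (TK.ydec F i v) ∸ decY (inj₁ (i₀ , p , F)) i v₋ vp) (TK.jdec F i v)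
  decS (inj₂ κ) i v₋ v vp = EK.eσ κ i v₋ v vp

  aux-≤ : ∀ κ i → aux κ i ≤ i
  aux-≤ (inj₁ _) i = ≤-refl
  aux-≤ (inj₂ κ) i = EK.lastBad-≤ κ i

  size-≤ : ∀ {κ} → κ ∈ keys → ∀ i → size κ i ≤ 2 ^ suc A
  size-≤ {κ} κ∈ i with ∈-++⁻ (map inj₁ TK.typKeys) κ∈
  ... | inj₁ p with ∈-map⁻ inj₁ p
  ...   | κ′ , κ′∈ , refl = TK.tsize-≤ κ′∈ i
  size-≤ {κ} κ∈ i | inj₂ p with ∈-map⁻ inj₂ p
  ...   | κ′ , κ′∈ , refl = EK.esize-≤ κ′∈ i

  record Encoded (σ y : ℕ → ℕ) : Set where
    field
      κ     : Key
      κ∈    : κ ∈ keys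
      u     : ℕ → ℕ
      u<    : ∀ i → i < b → u i < size κ i
      lab-≡ : label κ ≡ y b
      y-≡   : ∀ i → i < b → decY κ i (u (pred i)) (u (aux κ i)) ≡ y i
      σ-≡   : ∀ i → i < b → decS κ i (u (pred i)) (u i) (u (aux κ i)) ≡ σ i

  module Encode (σ : ℕ → ℕ)
                (σ< : ∀ i → i < b → σ i < K (cs i)) (lab≤ : ∀ i → i < b → lab (cs i) (σ i) ≤ m (cs i))
                (yb : sumTo (λ i → lab (cs i) (σ i)) b < 2 ^ w) where

    private
      y : ℕ → ℕ
      y = sumTo (λ i → lab (cs i) (σ i))

      z : ℕ → ℕ
      z i = suc (y (suc i)) ∸ y i

      z≡ : ∀ i → z i ≡ suc (lab (cs i) (σ i))
      z≡ i = m+n∸n≡m (suc (lab (cs i) (σ i))) (y i)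

      mono : ∀ i → y i ≤ y (suc i)
      mono i = m≤n+m (y i) (lab (cs i) (σ i))

      Info : ℕ → Set
      Info i = (∃ λ j → j < good (cs i) (z i) × state (cs i) false (z i) j ≡ σ i) ⊎
               ((∃ λ j → j < bad (cs i) (z i) × state (cs i) true (z i) j ≡ σ i) × (∃ λ ζ → ζ < Z (cs i) × badState (cs i) ζ ≡ σ i))

      info : ∀ i → i < b → Info i
      info i i< rewrite z≡ i = classify (cs i) (σ i) (σ< i i<) (lab≤ i i<)

      badI : ∀ {i} → Info i → Bool
      badI (inj₁ _) = false
      badI (inj₂ _) = true
      jI ζI : ∀ {i} → Info i → ℕ
      jI (inj₁ (j , _)) = j
      jI (inj₂ ((j , _) , _)) = j
      ζI (inj₁ _) = 0
      ζI (inj₂ (_ , (ζ , _))) = ζ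

      isBad : ℕ → Bool
      isBad i with i <? b
      ... | yes i< = badI (info i i<)
      ... | no _ = false
      j ζ : ℕ → ℕ
      j i with i <? b
      ... | yes i< = jI (info i i<)
      ... | no _ = 0
      ζ i with i <? b
      ... | yes i< = ζI (info i i<)
      ... | no _ = 0

      good-case : ∀ i → i < b → isBad i ≡ false → j i < good (cs i) (z i) × state (cs i) false (z i) (j i) ≡ σ i
      good-case i i<′ h with i <? b
      ... | no p = ⊥-elim (p i<′)
      ... | yes i< with info i i<
      ...   | inj₁ (_ , p , q) = p , q

      bad-case : ∀ i → i < b → isBad i ≡ true → ζ i < Z (cs i) × badState (cs i) (ζ i) ≡ σ i
      bad-case i i<′ h with i <? b
      ... | no p = ⊥-elim (p i<′)
      ... | yes i< with info i i<
      ...   | inj₂ (_ , (_ , p , q)) = p , q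

      bad-case′ : ∀ i → i < b → isBad i ≡ true → j i < bad (cs i) (z i) × state (cs i) true (z i) (j i) ≡ σ i
      bad-case′ i i<′ h with i <? b
      ... | no p = ⊥-elim (p i<′)
      ... | yes i< with info i i<
      ...   | inj₂ ((_ , p , q) , _) = p , q

      module E = EK.RealEscape y j ζ isBad σ refl yb mono good-case bad-case

      escape : R ≤ EK.savings E.κ → Encoded σ y
      escape h = record
        { κ = inj₂ E.κ ; κ∈ = ∈-++⁺ʳ (map inj₁ TK.typKeys) (∈-map⁺ inj₂ E.κ∈) ; u = E.u ; u< = E.size-spec h
        ; lab-≡ = refl ; y-≡ = E.y-spec ; σ-≡ = E.σ-spec }

      module _ (i₀ : ℕ) (i₀≤ : i₀ ≤ b) (flags : ∀ i → i < b → isBad i ≡ (i ≡ᵇ i₀)) where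

        state-ok : ∀ i → i < b → j i < Typical.mass i₀ i (z i) × state (cs i) (i ≡ᵇ i₀) (z i) (j i) ≡ σ i
        state-ok i i< with i ≡ᵇ i₀ | flags i i<
        ... | true | fl = bad-case′ i i< fl
        ... | false | fl = good-case i i< fl

        module Ty = TK.Real 1≤b i₀ i₀≤ y j refl yb mono (λ i i< → proj₁ (state-ok i i<))

        typical : sumTo Ty.lev b ≤ R → Encoded σ y
        typical le with Ty.encode le
        ... | (i₀ , p , F) , κ∈ , refl , lab≡ , u , fields = record
          { κ = inj₁ (i₀ , p , F) ; κ∈ = ∈-++⁺ˡ (∈-map⁺ inj₁ κ∈) ; u = u ; u< = λ i i< → proj₁ (fields i i<)
          ; lab-≡ = lab≡ ; y-≡ = yy ; σ-≡ = λ i i< → trans (cong₂ (λ p q → state (cs i) (i ≡ᵇ i₀) p q)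
              (cong₂ (λ p q → suc p ∸ q) (proj₁ (proj₂ (fields i i<))) (yy i i<)) (proj₂ (proj₂ (fields i i<)))) (proj₂ (state-ok i i<)) }
          where
          yy : ∀ i → i < b → decY (inj₁ (i₀ , p , F)) i (u (pred i)) (u (aux (inj₁ (i₀ , p , F)) i)) ≡ y i
          yy zero _ = refl
          yy (suc i) i< = proj₁ (proj₂ (fields i (<-trans (n<1+n i) i<)))

        by-level : Encoded σ y
        by-level with sumTo Ty.lev b ≤? R
        -- With at most one bad child, the sum of the levels decides; beyond the fuel, the levels
        -- themselves are the savings of the exceptional key.
        ... | yes p = typical p
        ... | no p = escape (≤-trans (<⇒≤ (≰⇒> p)) (≤-trans (sumTo-mono b λ i i< →
                subst (λ c → (if i ≡ᵇ i₀ then 0 else E.lev i) ≤ (if c then 16 * w else E.lev i)) (sym (flags i i<)) (le (i ≡ᵇ i₀) (E.lev i)))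
              (≤-reflexive (sym E.savings-spec))))
          where
          le : ∀ c x → (if c then 0 else x) ≤ (if c then 16 * w else x)
          le true x = z≤n
          le false x = ≤-refl

    encoded : Encoded σ y
    encoded with at-most-one? isBad b
    ... | inj₁ h = by-level b ≤-refl (λ i i< → trans (h i i<) (sym (≡ᵇ-false (<⇒≢ i<))))
    ... | inj₂ (inj₁ (i₀ , i₀< , h)) = by-level i₀ (<⇒≤ i₀<) h
    ... | inj₂ (inj₂ h) = escape (≤-trans (≤-reflexive (trans (fuel-≡ w) (lem w))) (≤-trans (h (16 * w) E.lev) (≤-reflexive (sym E.savings-spec))))
      where
      lem : ∀ w → 32 * w ≡ 16 * w + 16 * w
      lem = solve-∀

  module C (κ : Key) = Chain a (size κ)

  -- The part of the packed fields that no word holds: a low bits of field 0 and the high part of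
  -- the last field.
  room : Key → ℕ
  room κ = 2 ^ a * suc (C.hi-bound κ b′)

  states : List (Key × ℕ)
  states = concatMap (λ κ → map (κ ,_) (downFrom (room κ))) keys

  K′ : ℕ
  K′ = length states

  at : ℕ → Key × ℕ
  at s = nth (inj₂ (0 , []) , 0) states s

  lab′ : ℕ → ℕ
  lab′ s = label (proj₁ (at s))

  fld : ℕ → ℕ → ℕ → ℕ → ℕ
  fld s p x₋ x = C.field-of (proj₁ (at s)) b′ (pfst (2 ^ a) (proj₂ (at s))) (psnd (2 ^ a) (proj₂ (at s))) p x₋ x

  -- Fields i - 1, i and `aux` are needed, each spread over two adjacent words; the first two share
  -- a word, so five words suffice.
  access : ℕ → ℕ → ℕ → ℕ → ℕ → ℕ → ℕ → ℕ × ℕ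
  access s i x₁ x₂ x₃ x₄ x₅ = decY κ i v₋ vp , decS κ i v₋ (fld s i x₂ x₃) vp
    where
    κ = proj₁ (at s)
    v₋ = fld s (pred i) x₁ x₂
    vp = fld s (aux κ i) x₄ x₅

  auxAt : ℕ → ℕ → ℕ
  auxAt s i = aux (proj₁ (at s)) i

  record Packed (σ y : ℕ → ℕ) : Set where
    field
      s       : ℕ
      s<      : s < K′
      word    : ℕ → ℕ
      word<   : ∀ k → k < b′ → word k < 2 ^ A
      lab-≡   : lab′ s ≡ y b
      correct : ∀ (r : ℕ → ℕ) → (∀ k → k < b′ → r k ≡ word k) → ∀ i → i < b →
                access s i (r (pred (pred i))) (r (pred i)) (r i) (r (pred (auxAt s i))) (r (auxAt s i)) ≡ (y i , σ i)

  pack : ∀ {σ y} → Encoded σ y → Packed σ y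
  pack {σ} {y} E with ∈⇒nth (inj₂ (0 , []) , 0) mem
    where
    open Encoded E
    mem : (κ , pair (2 ^ a) (low a (u 0)) (C.Fields.hi κ u b′)) ∈ states
    mem = ∈-concatMap (λ κ → map (κ ,_) (downFrom (room κ))) κ∈ (∈-map⁺ (κ ,_) (∈-downFrom⁺
            (pair-< (low-< a (u 0)) (s≤s (C.Fields.hi-≤ κ u b′ (<⇒≤ (u< b′ b′<b)))))))
  ... | s , s< , eq = record { s = s ; s< = s< ; word = C.Fields.word κ u
      ; word< = λ k k< → C.Bounds.word-< κ w b′ b′-small w≤a (λ i _ → size-≤ κ∈ i) u k k< (<⇒≤ (u< k (<-trans k< b′<b)))
      ; lab-≡ = trans (cong (λ e → label (proj₁ e)) eq) lab-≡ ; correct = ok′ }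
    where
    open Encoded E
    fld-ok : ∀ (r : ℕ → ℕ) → (∀ k → k < b′ → r k ≡ C.Fields.word κ u k) → ∀ p → p ≤ b′ → fld s p (r (pred p)) (r p) ≡ u p
    fld-ok r h p p≤ rewrite eq | pfst-pair (2 ^ a) (low a (u 0)) (C.Fields.hi κ u b′) (low-< a (u 0))
      | psnd-pair (2 ^ a) (low a (u 0)) (C.Fields.hi κ u b′) (low-< a (u 0)) =
      C.field-of-correct κ u b′ p (r (pred p)) (r p) p≤ (λ { k refl → h k p≤ }) (h p)
    pred≤ : ∀ i → i < b → pred i ≤ b′
    pred≤ i i< = ≤-trans pred[n]≤n (≤b′ i<)
    ok′ : ∀ (r : ℕ → ℕ) → (∀ k → k < b′ → r k ≡ C.Fields.word κ u k) → ∀ i → i < b →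
          access s i (r (pred (pred i))) (r (pred i)) (r i) (r (pred (auxAt s i))) (r (auxAt s i)) ≡ (y i , σ i)
    ok′ r h i i< rewrite fld-ok r h (pred i) (pred≤ i i<) | fld-ok r h i (≤b′ i<)
      | fld-ok r h (auxAt s i) (≤-trans (aux-≤ (proj₁ (at s)) i) (≤b′ i<)) | eq = cong₂ _,_ (y-≡ i i<) (σ-≡ i i<)

  private
    ΠK : ℕ
    ΠK = prodTo (λ i → K (cs i)) b

    sz : Key → ℕ
    sz κ = prodTo (size κ) b

    esc : ℕ
    esc = sumOf (λ κ → prodTo (EK.esize κ) b) EK.escKeys

    sz-sum : sumOf sz keys ≤ ΠK + esc
    sz-sum = ≤-trans (≤-reflexive (trans (sumOf-++ sz (map inj₁ TK.typKeys) (map inj₂ EK.escKeys))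
        (cong₂ _+_ (sumOf-map sz inj₁ TK.typKeys) (sumOf-map sz inj₂ EK.escKeys))))
      (+-monoˡ-≤ esc (TK.typKeys-volume 1≤b))

    E₁ : ℕ
    E₁ = a + 4 * w + A * b′

    K′-sum : K′ * 2 ^ (A * b′) ≤ ΠK + (esc + length keys * 2 ^ E₁)
    K′-sum = begin
      K′ * 2 ^ (A * b′)
        ≡⟨ cong (_* 2 ^ (A * b′)) (trans (length-concatMap (λ κ → map (κ ,_) (downFrom (room κ))) keys)
             (sumOf-cong keys λ κ → trans (length-map (κ ,_) (downFrom (room κ))) (length-downFrom (room κ)))) ⟩
      sumOf room keys * 2 ^ (A * b′)
        ≡⟨ sym (sumOf-*ʳ (2 ^ (A * b′)) room keys) ⟩
      sumOf (λ κ → room κ * 2 ^ (A * b′)) keys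
        ≤⟨ sumOf-mono keys (λ κ κ∈ → subst (λ b → room κ * 2 ^ (A * b′) ≤ prodTo (size κ) b + 2 ^ E₁) (sym b≡) (C.Bounds.volume κ w b′ b′-small w≤a (λ i _ → size-≤ κ∈ i))) ⟩
      sumOf (λ κ → sz κ + 2 ^ E₁) keys
        ≡⟨ trans (sumOf-add sz (λ _ → 2 ^ E₁) keys) (cong (sumOf sz keys +_) (sumOf-const (2 ^ E₁) keys)) ⟩
      sumOf sz keys + length keys * 2 ^ E₁
        ≤⟨ +-monoˡ-≤ (length keys * 2 ^ E₁) sz-sum ⟩
      ΠK + esc + length keys * 2 ^ E₁
        ≡⟨ +-assoc ΠK esc (length keys * 2 ^ E₁) ⟩
      ΠK + (esc + length keys * 2 ^ E₁) ∎
      where open ≤-Reasoning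

    b≤w : b ≤ w
    b≤w = ≤-trans (≤-trans (m≤m+n b (2 * b)) (m≤m+n (3 * b) 2)) b-small

    pow-wl : ∀ {x} k → x ≤ 2 ^ k → k ≤ 2 * wl + 2 → x ^ b ≤ 2 ^ w
    pow-wl {x} k h k≤ = ≤-trans (^-monoˡ-≤ b h) (≤-trans (≤-reflexive (^-*-assoc 2 k b)) (2^-mono (≤-trans (*-monoˡ-≤ b k≤)
      (≤-trans (≤-reflexive (*-comm (2 * wl + 2) b)) wl-small))))

    esc-count : length EK.escKeys ≤ 2 ^ (2 * w)
    esc-count = ≤-trans EK.escKeys-count (2^*2^≤ w w ≤-refl (pow-wl (suc (2 * wl)) opt (≤-trans (n≤1+n _) (≤-reflexive (+-comm 2 (2 * wl))))) (≤-reflexive (lem w)))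
      where
      lem : ∀ w → w + w ≡ 2 * w
      lem = solve-∀
      opt : suc (W * suc d) ≤ 2 ^ suc (2 * wl)
      opt = ≤-trans (+-mono-≤ (2^>0 (2 * wl)) (2^*2^≤ wl wl W≤ d≤wl (≤-reflexive (lem wl)))) (≤-reflexive (sym (2^-suc (2 * wl))))

    -- The exponents: w for the place of the bad child, w for all block choices, 3w for the full
    -- sums, and b + 96 w ≤ 97 w for the protocol.
    typ-count : length TK.typKeys ≤ 2 ^ (102 * w)
    typ-count = ≤-trans TK.typKeys-count (2^*2^≤ w (101 * w) sb≤ (2^*2^≤ (4 * w) (97 * w)
        (2^*2^≤ w (3 * w) (pow-wl wl W≤ (≤-trans (m≤m+n wl (wl + 0)) (m≤m+n (2 * wl) 2))) (2^*2^≤ w (2 * w) ≤-refl (2^*2^≤ w w ≤-refl ≤-refl (≤-reflexive (l₂ w))) (≤-reflexive (l₃ w))) (≤-reflexive (l₄ w)))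
        (2^-mono (≤-trans (+-mono-≤ b≤w (≤-reflexive (cong (3 *_) (fuel-≡ w)))) (≤-reflexive (l₁ w)))) (≤-reflexive (l₅ w))) (≤-reflexive (l₆ w)))
      where
      sb≤ : suc b ≤ 2 ^ w
      sb≤ = ≤-trans (n<2^n b) (2^-mono b≤w)
      l₁ : ∀ w → w + 3 * (32 * w) ≡ 97 * w
      l₁ = solve-∀
      l₂ : ∀ w → w + w ≡ 2 * w
      l₂ = solve-∀
      l₃ : ∀ w → w + 2 * w ≡ 3 * w
      l₃ = solve-∀
      l₄ : ∀ w → w + 3 * w ≡ 4 * w
      l₄ = solve-∀
      l₅ : ∀ w → 4 * w + 97 * w ≡ 101 * w
      l₅ = solve-∀
      l₆ : ∀ w → w + 101 * w ≡ 102 * w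
      l₆ = solve-∀

    1≤w : 1 ≤ w
    1≤w = ≤-trans 1≤b b≤w

    keys-count : length keys ≤ 2 ^ (103 * w)
    keys-count = ≤-trans (≤-reflexive (trans (length-++ (map inj₁ TK.typKeys)) (trans (cong₂ _+_ (length-map inj₁ TK.typKeys) (length-map inj₂ EK.escKeys)) (+-comm (length TK.typKeys) _))))
      (≤-trans (2^+2^≤ {m = 2 * w} {n = 102 * w} esc-count typ-count (*-monoˡ-≤ w (m≤m+n 2 100))) (2^-mono (+-monoˡ-≤ (102 * w) 1≤w)))

    -- Of the 32 w bits saved, 2w pay for the number of keys and b ≤ w for fields that are measured
    -- against 2^(A + 1) instead of 2^A.
    esc-small : esc * 2 ^ suc (20 * w) ≤ 2 ^ (A * b)
    esc-small = *-cancelʳ-≤ _ _ (2 ^ (3 * w)) {{m^n≢0 2 (3 * w)}} (begin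
      esc * 2 ^ suc (20 * w) * 2 ^ (3 * w)    ≡⟨ trans (*-assoc esc _ _) (cong (esc *_) (sym (2^-+ (suc (20 * w)) (3 * w)))) ⟩
      esc * 2 ^ (suc (20 * w) + 3 * w)        ≤⟨ *-monoʳ-≤ esc (2^-mono (≤-trans (+-monoˡ-≤ (3 * w) (+-monoˡ-≤ (20 * w) 1≤w)) (≤-add (8 * w) (trans (fuel-≡ w) (l₁ w))))) ⟩
      esc * 2 ^ R                             ≤⟨ EK.escKeys-volume 1≤b ⟩
      length EK.escKeys * 2 ^ (suc A * b)     ≤⟨ *-monoˡ-≤ (2 ^ (suc A * b)) esc-count ⟩
      2 ^ (2 * w) * 2 ^ (suc A * b)           ≡⟨ sym (2^-+ (2 * w) (suc A * b)) ⟩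
      2 ^ (2 * w + (b + A * b))               ≤⟨ 2^-mono (≤-trans (+-monoʳ-≤ (2 * w) (+-monoˡ-≤ (A * b) b≤w)) (≤-reflexive (l₂ w (A * b)))) ⟩
      2 ^ (A * b + 3 * w)                     ≡⟨ 2^-+ (A * b) (3 * w) ⟩
      2 ^ (A * b) * 2 ^ (3 * w)               ∎)
      where
      open ≤-Reasoning
      l₁ : ∀ w → 32 * w ≡ w + 20 * w + 3 * w + 8 * w
      l₁ = solve-∀
      l₂ : ∀ w x → 2 * w + (w + x) ≡ x + 3 * w
      l₂ = solve-∀

    -- The size of a is decided here: 103 w for the keys, 4w for packing and at most 21 w for twice
    -- `D` must not exceed it.
    keys-small : length keys * 2 ^ E₁ * 2 ^ suc (20 * w) ≤ 2 ^ (A * b)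
    keys-small = 2^*2^≤ (103 * w + E₁) (suc (20 * w)) (2^*2^≤ (103 * w) E₁ keys-count ≤-refl ≤-refl) ≤-refl (begin
      103 * w + (a + 4 * w + A * b′) + suc (20 * w)   ≤⟨ +-monoʳ-≤ (103 * w + (a + 4 * w + A * b′)) (+-monoˡ-≤ (20 * w) 1≤w) ⟩
      103 * w + (a + 4 * w + A * b′) + (w + 20 * w)   ≡⟨ l w a (A * b′) ⟩
      a + 128 * w + A * b′                            ≤⟨ +-monoˡ-≤ (A * b′) (+-monoʳ-≤ a (≤-trans (*-monoˡ-≤ w (m≤m+n 128 22)) a≥)) ⟩
      A + A * b′                                      ≡⟨ trans (sym (*-suc A b′)) (cong (A *_) (sym b≡)) ⟩
      A * b                                           ∎)
      where
      open ≤-Reasoning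
      l : ∀ w a x → 103 * w + (a + 4 * w + x) + (w + 20 * w) ≡ a + 128 * w + x
      l = solve-∀

  -- Wasteful storage and rounding each cost at most half of `ΠK / D`.
  K′-bound : K′ * 2 ^ (A * b′) * D ≤ suc D * ΠK
  K′-bound = begin
    K′ * 2 ^ (A * b′) * D                                   ≤⟨ *-monoˡ-≤ D K′-sum ⟩
    (ΠK + (esc + length keys * 2 ^ E₁)) * D                 ≡⟨ l₁ ΠK (esc + length keys * 2 ^ E₁) D ⟩
    (esc + length keys * 2 ^ E₁) * D + D * ΠK               ≤⟨ +-monoˡ-≤ (D * ΠK) err ⟩
    ΠK + D * ΠK                                             ∎
    where
    open ≤-Reasoning
    l₁ : ∀ p e d → (p + e) * d ≡ e * d + d * p
    l₁ = solve-∀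
    ΠK-lower : 2 ^ (A * b) ≤ ΠK
    ΠK-lower = ≤-trans (≤-reflexive (trans (sym (^-*-assoc 2 A b)) (sym (prodTo-const (2 ^ A) b)))) (prodTo-mono b λ i _ → K-lower (cs i))
    l₂ : ∀ e k d → (e + k) * d * 2 ≡ e * (2 * d) + k * (2 * d)
    l₂ = solve-∀
    err : (esc + length keys * 2 ^ E₁) * D ≤ ΠK
    err = *-cancelʳ-≤ _ _ 2 (≤-trans (≤-reflexive (l₂ esc (length keys * 2 ^ E₁) D)) (≤-trans (+-mono-≤ (≤-trans esc-small ΠK-lower) (≤-trans keys-small ΠK-lower))
            (≤-reflexive (l₃ ΠK))))
      where
      l₃ : ∀ p → p + p ≡ p * 2
      l₃ = solve-∀

-- Programs that read `A` bits at arbitrary positions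

data Prog (X : Set) : ℕ → Set where
  ret : ∀ {c} → X → Prog X c
  rd  : ∀ {c} → ℕ → (ℕ → Prog X c) → Prog X (suc c)

mapP : ∀ {X Y : Set} {c} → (X → Y) → Prog X c → Prog Y c
mapP f (ret x) = ret (f x)
mapP f (rd p k) = rd p λ v → mapP f (k v)

shift : ∀ {X c} → ℕ → Prog X c → Prog X c
shift o (ret x) = ret x
shift o (rd p k) = rd (o + p) λ v → shift o (k v)

weaken : ∀ {X c c′} → c ≤ c′ → Prog X c → Prog X c′
weaken h (ret x) = ret x
weaken (s≤s h) (rd p k) = rd p λ v → weaken h (k v)

module Eval (A : ℕ) where
  eval : ∀ {X c} → Prog X c → (ℕ → Bool) → X
  eval (ret x) mem = x
  eval (rd p k) mem = eval (k (num A λ i → mem (p + i))) mem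

  eval-mapP : ∀ {X Y : Set} {c} (f : X → Y) (P : Prog X c) mem → eval (mapP f P) mem ≡ f (eval P mem)
  eval-mapP f (ret x) mem = refl
  eval-mapP f (rd p k) mem = eval-mapP f (k _) mem

  eval-shift : ∀ {X c} o (P : Prog X c) mem → eval (shift o P) mem ≡ eval P (λ i → mem (o + i))
  eval-shift o (ret x) mem = refl
  eval-shift o (rd p k) mem = trans (eval-shift o (k (num A λ i → mem (o + p + i))) mem)
    (cong (λ v → eval (k v) (λ i → mem (o + i))) (num-cong A λ i _ → cong mem (+-assoc o p i)))

  eval-weaken : ∀ {X c c′} (h : c ≤ c′) (P : Prog X c) mem → eval (weaken h P) mem ≡ eval P mem
  eval-weaken h (ret x) mem = refl
  eval-weaken (s≤s h) (rd p k) mem = eval-weaken h (k _) mem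

-- Enumerative coding of arrays with a given number of ones

cons : Bool → (ℕ → Bool) → ℕ → Bool
cons c f zero = c
cons c f (suc i) = f i

unrank : ℕ → ℕ → ℕ → ℕ → Bool
unrank zero x i = λ _ → false
unrank (suc m) zero i = λ _ → false
unrank (suc m) (suc x) i = if i <ᵇ bin m x then cons true (unrank m x i) else cons false (unrank m (suc x) (i ∸ bin m x))

index : ℕ → ℕ → (ℕ → Bool) → ℕ
index m zero f = 0
index zero (suc x) f = 0
index (suc m) (suc x) f = if f 0 then index m x (f ∘ suc) else bin m x + index m (suc x) (f ∘ suc)

index-cong : ∀ m x {f g : ℕ → Bool} → (∀ i → i < m → f i ≡ g i) → index m x f ≡ index m x g
index-cong m zero h = refl
index-cong zero (suc x) h = refl
index-cong (suc m) (suc x) {f} {g} h rewrite h 0 (s≤s z≤n) with g 0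
... | true = index-cong m x λ i i< → h (suc i) (s≤s i<)
... | false = cong (bin m x +_) (index-cong m (suc x) λ i i< → h (suc i) (s≤s i<))

rk-false : ∀ m → rk (λ _ → false) m ≡ 0
rk-false zero = refl
rk-false (suc m) = rk-false m

unrank-rk : ∀ m x i → i < bin m x → rk (unrank m x i) m ≡ x
unrank-rk zero zero i _ = refl
unrank-rk (suc m) zero i _ = rk-false m
unrank-rk (suc m) (suc x) i i< with i <ᵇ bin m x in eq
... | true = cong suc (unrank-rk m x i (<ᵇ-true⇒< eq))
... | false = unrank-rk m (suc x) (i ∸ bin m x) (+-cancelˡ-< (bin m x) _ _ (subst (_< bin m x + bin m (suc x)) (sym (m+[n∸m]≡n le)) i<))
  where
  le : bin m x ≤ i
  le = <ᵇ-false⇒≥ {i} {bin m x} eq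

index-unrank : ∀ m x i → i < bin m x → index m x (unrank m x i) ≡ i
index-unrank m zero zero _ = refl
index-unrank m zero (suc i) (s≤s ())
index-unrank (suc m) (suc x) i i< with i <ᵇ bin m x in eq
... | true = index-unrank m x i (<ᵇ-true⇒< eq)
... | false = trans (cong (bin m x +_) (index-unrank m (suc x) (i ∸ bin m x)
                (+-cancelˡ-< (bin m x) _ _ (subst (_< bin m x + bin m (suc x)) (sym (m+[n∸m]≡n le)) i<)))) (m+[n∸m]≡n le)
  where
  le : bin m x ≤ i
  le = <ᵇ-false⇒≥ {i} {bin m x} eq

index-< : ∀ m x f → rk f m ≡ x → index m x f < bin m x
index-< m zero f _ = s≤s z≤n
index-< (suc m) (suc x) f h with f 0
... | true = <-≤-trans (index-< m x (f ∘ suc) (suc-injective h)) (m≤m+n (bin m x) _)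
... | false = +-monoʳ-< (bin m x) (index-< m (suc x) (f ∘ suc) h)

rk-zero : ∀ m (f : ℕ → Bool) → rk f m ≡ 0 → ∀ i → i < m → false ≡ f i
rk-zero (suc m) f h zero _ with f 0
... | false = refl
rk-zero (suc m) f h (suc i) (s≤s i<) with f 0
... | false = rk-zero m (f ∘ suc) h i i<

unrank-index : ∀ m x f → rk f m ≡ x → ∀ i → i < m → unrank m x (index m x f) i ≡ f i
unrank-index (suc m) zero f h i i< = rk-zero (suc m) f h i i<
unrank-index (suc m) (suc x) f h i i< with f 0 in eq
... | true rewrite <⇒<ᵇ-true (index-< m x (f ∘ suc) (suc-injective h)) = go i i<
  where
  go : ∀ i → i < suc m → cons true (unrank m x (index m x (f ∘ suc))) i ≡ f i
  go zero _ = sym eq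
  go (suc i) (s≤s i<) = unrank-index m x (f ∘ suc) (suc-injective h) i i<
... | false = trans (cong (λ c → (if c then cons true (unrank m x j) else cons false (unrank m (suc x) (j ∸ bin m x))) i) j≥)
                (trans (cong (λ z → cons false (unrank m (suc x) z) i) (m+n∸m≡n (bin m x) _)) (go i i<))
  where
  j = bin m x + index m (suc x) (f ∘ suc)
  j≥ : (j <ᵇ bin m x) ≡ false
  j≥ with j <ᵇ bin m x in e
  ... | true = ⊥-elim (<⇒≱ (<ᵇ-true⇒< e) (m≤m+n (bin m x) _))
  ... | false = refl
  go : ∀ i → i < suc m → cons false (unrank m (suc x) (index m (suc x) (f ∘ suc))) i ≡ f i
  go zero _ = sym eq
  go (suc i) (s≤s i<) = unrank-index m (suc x) (f ∘ suc) h i i<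

-- Subtree encodings

module Levels (w a : ℕ) where
  open Params w a
  open Eval A public

  -- An encoding of m bits by a state below K and m ∸ A memory bits, in which the state determines the number
  -- of ones and wastes a factor at most (1 + 1/D)^k.
  record Level (m c : ℕ) : Set where
    field
      K k     : ℕ
      lab     : ℕ → ℕ
      encS    : (ℕ → Bool) → ℕ
      encM    : (ℕ → Bool) → ℕ → Bool
      qry     : ℕ → ℕ → Prog ℕ c
      encS<   : ∀ f → encS f < K
      lab-≡   : ∀ f → lab (encS f) ≡ rk f m
      correct : ∀ f mem → (∀ i → i < m ∸ A → mem i ≡ encM f i) → ∀ u → u ≤ m → eval (qry (encS f) u) mem ≡ rk f u
      k<m     : k < m
      K-bound : K * D ^ k ≤ 2 ^ A * suc D ^ k

  -- The position of the state in its fibre and the memory bits determine all answers, hence the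
  -- array, so arrays with x ones are coded injectively.
  fibre-lower : ∀ {m c} (L : Level m c) → let open Level L in
    ∀ x → bin m x ≤ length (keep (λ σ → lab σ ≡ᵇ x) (downFrom K)) * 2 ^ (m ∸ A)
  fibre-lower {m} L x = FinP.injective⇒≤ {f = code} inj
    where
    open Level L
    M = m ∸ A
    fib = keep (λ σ → lab σ ≡ᵇ x) (downFrom K)
    arr : Fin (bin m x) → ℕ → Bool
    arr i = unrank m x (toℕ i)
    in-fib : ∀ i → encS (arr i) ∈ fib
    in-fib i = keep-∈ (λ σ → lab σ ≡ᵇ x) (∈-downFrom⁺ (encS< (arr i)))
      (subst (λ z → (z ≡ᵇ x) ≡ true) (sym (trans (lab-≡ (arr i)) (unrank-rk m x (toℕ i) (FinP.toℕ<n i)))) (≡ᵇ-self x))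
    pos : Fin (bin m x) → ℕ
    pos i = proj₁ (∈⇒nth 0 (in-fib i))
    code# : Fin (bin m x) → ℕ
    code# i = pair (2 ^ M) (num M (encM (arr i))) (pos i)
    code< : ∀ i → code# i < length fib * 2 ^ M
    code< i = subst (code# i <_) (*-comm (2 ^ M) (length fib)) (pair-< (num-< M (encM (arr i))) (proj₁ (proj₂ (∈⇒nth 0 (in-fib i)))))
    code : Fin (bin m x) → Fin (length fib * 2 ^ M)
    code i = fromℕ< (code< i)
    inj : ∀ {i j} → code i ≡ code j → i ≡ j
    inj {i} {j} eq = FinP.toℕ-injective (begin
      toℕ i                  ≡⟨ sym (index-unrank m x (toℕ i) (FinP.toℕ<n i)) ⟩
      index m x (arr i)      ≡⟨ index-cong m x (rk-injective m (arr i) (arr j) same-rk) ⟩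
      index m x (arr j)      ≡⟨ index-unrank m x (toℕ j) (FinP.toℕ<n j) ⟩
      toℕ j                  ∎)
      where
      open ≡-Reasoning
      eq# : code# i ≡ code# j
      eq# = trans (sym (FinP.toℕ-fromℕ< (code< i))) (trans (cong toℕ eq) (FinP.toℕ-fromℕ< (code< j)))
      same-num : num M (encM (arr i)) ≡ num M (encM (arr j))
      same-num = trans (sym (pfst-pair (2 ^ M) _ (pos i) (num-< M (encM (arr i))))) (trans (cong (pfst (2 ^ M)) eq#) (pfst-pair (2 ^ M) _ (pos j) (num-< M (encM (arr j)))))
      same-pos : pos i ≡ pos j
      same-pos = trans (sym (psnd-pair (2 ^ M) _ (pos i) (num-< M (encM (arr i))))) (trans (cong (psnd (2 ^ M)) eq#) (psnd-pair (2 ^ M) _ (pos j) (num-< M (encM (arr j)))))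
      same-S : encS (arr i) ≡ encS (arr j)
      same-S = trans (sym (proj₂ (proj₂ (∈⇒nth 0 (in-fib i))))) (trans (cong (nth 0 fib) same-pos) (proj₂ (proj₂ (∈⇒nth 0 (in-fib j)))))
      same-M : ∀ t → t < M → encM (arr i) t ≡ encM (arr j) t
      same-M t t< = trans (sym (bitOf-num M (encM (arr i)) t t<)) (trans (cong (λ z → bitOf z t) same-num) (bitOf-num M (encM (arr j)) t t<))
      same-rk : ∀ u → u ≤ m → rk (arr i) u ≡ rk (arr j) u
      same-rk u u≤ = trans (sym (correct (arr i) (encM (arr i)) (λ _ _ → refl) u u≤))
        (trans (cong (λ s → eval (qry s u) (encM (arr i))) same-S) (correct (arr j) (encM (arr i)) same-M u u≤))

  -- The linear bound (1 + 1/N)^k ≤ 1 + 2k/N: the quadratic term of each step is absorbed because 2k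
  -- ≤ N.
  pow-linear : ∀ N k → 2 * k ≤ N → suc N ^ k * N ≤ N ^ k * (N + 2 * k)
  pow-linear N zero h = ≤-reflexive (trans (+-identityʳ N) (sym (trans (+-identityʳ (N + 0)) (+-identityʳ N))))
  pow-linear N (suc k) h = begin
    suc N * suc N ^ k * N             ≡⟨ *-assoc (suc N) (suc N ^ k) N ⟩
    suc N * (suc N ^ k * N)           ≤⟨ *-monoʳ-≤ (suc N) (pow-linear N k (≤-trans (*-monoʳ-≤ 2 (n≤1+n k)) h)) ⟩
    suc N * (N ^ k * (N + 2 * k))     ≡⟨ lem N (N ^ k) k ⟩
    N ^ k * (N * (N + 2 * k) + N + 2 * k) ≤⟨ *-monoʳ-≤ (N ^ k) (+-monoʳ-≤ (N * (N + 2 * k) + N) (≤-trans (*-monoʳ-≤ 2 (n≤1+n k)) h)) ⟩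
    N ^ k * (N * (N + 2 * k) + N + N) ≡⟨ lem₂ N (N ^ k) k ⟩
    N * N ^ k * (N + 2 * suc k)       ∎
    where
    open ≤-Reasoning
    lem : ∀ N p k → suc N * (p * (N + 2 * k)) ≡ p * (N * (N + 2 * k) + N + 2 * k)
    lem = solve-∀
    lem₂ : ∀ N p k → p * (N * (N + 2 * k) + N + N) ≡ N * p * (N + 2 * suc k)
    lem₂ = solve-∀

  -- The form in which the parent needs the waste of a child; k < m keeps the accumulated power in
  -- the linear range.
  waste-linear : ∀ {m c} (L : Level m c) → 1 ≤ w → m < 2 ^ w → Level.K L * D ≤ 2 ^ A * (D + 2 * m)
  waste-linear {m} L w≥ m< = *-cancelʳ-≤ _ _ (D ^ k) {{m^n≢0 D k {{m^n≢0 2 (20 * w)}}}} (begin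
    K * D * D ^ k                    ≡⟨ lem K D (D ^ k) ⟩
    K * D ^ k * D                    ≤⟨ *-monoˡ-≤ D K-bound ⟩
    2 ^ A * suc D ^ k * D            ≡⟨ *-assoc (2 ^ A) (suc D ^ k) D ⟩
    2 ^ A * (suc D ^ k * D)          ≤⟨ *-monoʳ-≤ (2 ^ A) (pow-linear D k 2k≤D) ⟩
    2 ^ A * (D ^ k * (D + 2 * k))    ≤⟨ *-monoʳ-≤ (2 ^ A) (*-monoʳ-≤ (D ^ k) (+-monoʳ-≤ D (*-monoʳ-≤ 2 (<⇒≤ k<m)))) ⟩
    2 ^ A * (D ^ k * (D + 2 * m))    ≡⟨ lem₂ (2 ^ A) (D ^ k) (D + 2 * m) ⟩
    2 ^ A * (D + 2 * m) * D ^ k      ∎)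
    where
    open Level L
    open ≤-Reasoning
    lem : ∀ a b c → a * b * c ≡ a * c * b
    lem = solve-∀
    lem₂ : ∀ a b c → a * (b * c) ≡ a * c * b
    lem₂ = solve-∀
    2k≤D : 2 * k ≤ D
    2k≤D = ≤-trans (*-monoʳ-≤ 2 (<⇒≤ (<-trans k<m m<))) (2^-mono {suc w} {20 * w} (≤-trans (+-monoˡ-≤ w w≥) (≤-trans (≤-reflexive (cong (w +_) (sym (+-identityʳ w)))) (*-monoˡ-≤ w (m≤m+n 2 18)))))

  module Base (m : ℕ) (A≤m : A ≤ m) (m≤2A : m ≤ A + A) (m< : m < 2 ^ w) (2≤m : 2 ≤ m) (21w≤A : 21 * w ≤ A) where
    private
      M : ℕ
      M = m ∸ A
      M≤A : M ≤ A
      M≤A = m≤n+o⇒m∸n≤o m A m≤2A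

      states : List (ℕ × ℕ)
      states = concatMap (λ x → map (x ,_) (downFrom (suc (sh M (bin m x))))) (downFrom (suc m))

      at : ℕ → ℕ × ℕ
      at s = nth (0 , 0) states s

      idx : (ℕ → Bool) → ℕ
      idx f = index m (rk f m) f

      mem-state : ∀ f → (rk f m , sh M (idx f)) ∈ states
      mem-state f = ∈-concatMap (λ x → map (x ,_) (downFrom (suc (sh M (bin m x))))) (∈-downFrom⁺ (s≤s (rk-≤ f m)))
        (∈-map⁺ (rk f m ,_) (∈-downFrom⁺ (s≤s (sh-mono M (<⇒≤ (index-< m (rk f m) f refl))))))

      S : (ℕ → Bool) → ℕ
      S f = proj₁ (∈⇒nth (0 , 0) (mem-state f))

      S-≡ : ∀ f → at (S f) ≡ (rk f m , sh M (idx f))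
      S-≡ f = proj₂ (proj₂ (∈⇒nth (0 , 0) (mem-state f)))

      -- Cutting the low M bits off the index wastes at most one state per label, and m + 1 ≤ 2^w is
      -- far below 2^A / `D`.
      K-sum : length states ≤ 2 ^ A + suc m
      K-sum = *-cancelʳ-≤ _ _ (2 ^ M) {{m^n≢0 2 M}} (begin
        length states * 2 ^ M
          ≡⟨ cong (_* 2 ^ M) (trans (length-concatMap (λ x → map (x ,_) (downFrom (suc (sh M (bin m x))))) (downFrom (suc m)))
               (sumTo-cong (suc m) λ x _ → trans (length-map (x ,_) (downFrom (suc (sh M (bin m x))))) (length-downFrom (suc (sh M (bin m x)))))) ⟩
        sumTo (λ x → suc (sh M (bin m x))) (suc m) * 2 ^ M
          ≡⟨ sym (sumOf-*ʳ (2 ^ M) (λ x → suc (sh M (bin m x))) (downFrom (suc m))) ⟩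
        sumTo (λ x → 2 ^ M + sh M (bin m x) * 2 ^ M) (suc m)
          ≤⟨ sumTo-mono (suc m) (λ x _ → +-monoʳ-≤ (2 ^ M) (sh-lower M (bin m x))) ⟩
        sumTo (λ x → 2 ^ M + bin m x) (suc m)
          ≡⟨ trans (sumOf-add (λ _ → 2 ^ M) (bin m) (downFrom (suc m))) (cong₂ _+_
               (trans (sumOf-const (2 ^ M) (downFrom (suc m))) (cong (_* 2 ^ M) (length-downFrom (suc m)))) (bin-sum m)) ⟩
        suc m * 2 ^ M + 2 ^ m
          ≡⟨ cong (suc m * 2 ^ M +_) (trans (cong (2 ^_) (sym (m+[n∸m]≡n A≤m))) (2^-+ A M)) ⟩
        suc m * 2 ^ M + 2 ^ A * 2 ^ M
          ≡⟨ lem (suc m) (2 ^ M) (2 ^ A) ⟩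
        (2 ^ A + suc m) * 2 ^ M ∎)
        where
        open ≤-Reasoning
        lem : ∀ a b c → a * b + c * b ≡ (c + a) * b
        lem = solve-∀

      answer : ℕ → ℕ → ℕ → ℕ
      answer s u v = rk (unrank m (proj₁ (at s)) (proj₂ (at s) * 2 ^ M + num M (bitOf v))) u

      answer-ok : ∀ f mem → (∀ i → i < m ∸ A → mem i ≡ bitOf (low M (idx f)) i) → ∀ u → u ≤ m → answer (S f) u (num A (λ i → mem (0 + i))) ≡ rk f u
      answer-ok f mem h u u≤ rewrite S-≡ f = trans (cong (λ z → rk (unrank m (rk f m) (sh M (idx f) * 2 ^ M + z)) u)
          (trans (num-cong M λ i i< → trans (bitOf-num A mem i (<-≤-trans i< M≤A)) (h i i<)) (num-bitOf M (low M (idx f)) (low-< M (idx f)))))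
        (trans (cong (λ z → rk (unrank m (rk f m) z) u) (low-eq M (idx f)))
          (rk-cong u λ i i< → unrank-index m (rk f m) f refl i (<-≤-trans i< u≤)))

    base : Level m 1
    base = record
      { K = length states ; k = 1 ; lab = λ s → proj₁ (at s) ; encS = S ; encM = λ f → bitOf (low M (idx f))
      ; qry = λ s u → rd 0 λ v → ret (answer s u v)
      ; encS< = λ f → proj₁ (proj₂ (∈⇒nth (0 , 0) (mem-state f)))
      ; lab-≡ = λ f → cong proj₁ (S-≡ f)
      ; correct = answer-ok
      ; k<m = 2≤m
      ; K-bound = ≤-trans (*-mono-≤ K-sum (≤-reflexive (*-identityʳ D))) (≤-trans (≤-reflexive (*-distribʳ-+ D (2 ^ A) (suc m)))
          (≤-trans (+-monoʳ-≤ (2 ^ A * D) (2^*2^≤ w (20 * w) m< ≤-refl 21w≤A)) (≤-reflexive (lem (2 ^ A) D)))) }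
      where
      lem : ∀ p d → p * d + p ≡ p * (suc d * 1)
      lem = solve-∀

-- Concatenated segments

cat : (ℕ → ℕ) → (ℕ → ℕ → Bool) → ℕ → ℕ → Bool
cat len f zero p = false
cat len f (suc b) p with sumTo len b ≤? p
... | yes _ = f b (p ∸ sumTo len b)
... | no _ = cat len f b p

cat-≡ : ∀ len f b i k → i < b → k < len i → cat len f b (sumTo len i + k) ≡ f i k
cat-≡ len f (suc b) i k (s≤s i≤) k< with sumTo len b ≤? sumTo len i + k | m≤n⇒m<n∨m≡n i≤
... | yes _ | inj₂ refl = cong (f i) (m+n∸m≡n (sumTo len i) k)
... | no p | inj₂ refl = ⊥-elim (p (m≤m+n _ k))
... | no _ | inj₁ lt = cat-≡ len f b i k lt k<
... | yes p | inj₁ lt = ⊥-elim (<⇒≱ (<-≤-trans (+-monoʳ-< (sumTo len i) k<) (≤-trans (≤-reflexive (+-comm (sumTo len i) (len i))) (sumTo-≤-total len lt))) p)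

locate : (ℕ → ℕ) → ℕ → ℕ → ℕ
locate len zero u = 0
locate len (suc b) u with sumTo len b ≤? u
... | yes _ = b
... | no _ = locate len b u

-- The last inequality is not strict because the query at the very end of the array belongs to the
-- last segment.
locate-spec : ∀ len b u → 1 ≤ b → u ≤ sumTo len b →
  locate len b u < b × sumTo len (locate len b u) ≤ u × u ∸ sumTo len (locate len b u) ≤ len (locate len b u)
locate-spec len (suc b) u _ u≤ with sumTo len b ≤? u
... | yes p = ≤-refl , p , m≤n+o⇒m∸n≤o u (sumTo len b) (≤-trans u≤ (≤-reflexive (+-comm (len b) (sumTo len b))))
locate-spec len (suc zero) u _ u≤ | no p = ⊥-elim (p z≤n)
locate-spec len (suc (suc b)) u _ u≤ | no p with locate-spec len (suc b) u (s≤s z≤n) (<⇒≤ (≰⇒> p))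
... | q₁ , q₂ , q₃ = m≤n⇒m≤1+n q₁ , q₂ , q₃

sumTo-const : ∀ c n → sumTo (λ _ → c) n ≡ n * c
sumTo-const c n = trans (sumOf-const c (downFrom n)) (cong (_* c) (length-downFrom n))

rk-prefix : ∀ len (f : ℕ → Bool) i → sumTo (λ k → rk (λ t → f (sumTo len k + t)) (len k)) i ≡ rk f (sumTo len i)
rk-prefix len f zero = refl
rk-prefix len f (suc i) = trans (cong (rk (λ t → f (sumTo len i + t)) (len i) +_) (rk-prefix len f i))
  (trans (+-comm _ (rk f (sumTo len i))) (trans (sym (rk-+ f (sumTo len i) (len i))) (cong (rk f) (+-comm (sumTo len i) (len i)))))

-- The encoding at an inner node

module NodeLevel (w a d b b′ : ℕ) (b≡ : b ≡ suc b′)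
                 (w≥ : 2 ≤ w) (d≤w : 1 + 2 * d ≤ w) (a≥ : 150 * w ≤ a) (b≥ : 2 ≤ b) (b-small : 3 * b + 2 ≤ w)
                 (wl : ℕ) (W≤ : width w ≤ 2 ^ wl) (d≤wl : suc d ≤ 2 ^ wl) (wl-small : b * (2 * wl + 2) ≤ w)
                 (m c : ℕ) (ms : ℕ → ℕ) (sum≡ : sumTo ms b ≡ m) (m< : m < 2 ^ w) (ms≤m : ∀ i → ms i ≤ m)
                 (A≤ms : ∀ i → Params.A w a ≤ ms i) (lower : ∀ i → 2 ^ (5 + 2 * d) ≤ ms i) (upper : ∀ i → ms i ≤ 2 ^ (8 + 2 * d))
                 (lv : ∀ i → Levels.Level w a (ms i) c) where
  open Params w a
  open Levels w a

  opaque
    cs : ℕ → Child d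
    cs i = ChildBuild.child w a w≥ a≥ d (ms i) (Level.K (lv i)) (Level.lab (lv i)) (A≤ms i) (≤-<-trans (ms≤m i) m<) (lower i) (upper i)
             (waste-linear (lv i) (≤-trans (s≤s z≤n) w≥) (≤-<-trans (ms≤m i) m<)) (fibre-lower (lv i))

    cs-K : ∀ i → Child.K (cs i) ≡ Level.K (lv i)
    cs-K i = refl

    cs-lab : ∀ i σ → Child.lab (cs i) σ ≡ Level.lab (lv i) σ
    cs-lab i σ = refl

    cs-m : ∀ i → Child.m (cs i) ≡ ms i
    cs-m i = refl

  module P = Pack w a d b b′ b≡ cs d≤w a≥ b-small wl W≤ d≤wl wl-small

  private
    sub : (ℕ → Bool) → ℕ → ℕ → Bool
    sub f i t = f (sumTo ms i + t)

    σ : (ℕ → Bool) → ℕ → ℕ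
    σ f i = Level.encS (lv i) (sub f i)

    y : (ℕ → Bool) → ℕ → ℕ
    y f = sumTo (λ i → Child.lab (cs i) (σ f i))

    lab-rk : ∀ f i → Child.lab (cs i) (σ f i) ≡ rk (sub f i) (ms i)
    lab-rk f i = trans (cs-lab i (σ f i)) (Level.lab-≡ (lv i) (sub f i))

    y-rk : ∀ f i → y f i ≡ rk f (sumTo ms i)
    y-rk f i = trans (sumTo-cong i λ k _ → lab-rk f k) (rk-prefix ms f i)

    y-b : ∀ f → y f b ≡ rk f m
    y-b f = trans (y-rk f b) (cong (rk f) sum≡)

    packed : ∀ f → P.Packed (σ f) (y f)
    packed f = P.pack (P.Encode.encoded (σ f)
      (λ i _ → subst (σ f i <_) (sym (cs-K i)) (Level.encS< (lv i) (sub f i)))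
      (λ i _ → subst₂ _≤_ (sym (lab-rk f i)) (sym (cs-m i)) (rk-≤ (sub f i) (ms i)))
      (subst (_< 2 ^ w) (sym (y-b f)) (≤-<-trans (rk-≤ f m) m<)))

    memLen : ℕ → ℕ
    memLen i = ms i ∸ A

    off : ℕ
    off = sumTo (λ _ → A) b′

    memory : (ℕ → Bool) → ℕ → Bool
    memory f p with off ≤? p
    ... | yes _ = cat memLen (λ i → Level.encM (lv i) (sub f i)) b (p ∸ off)
    ... | no _ = cat (λ _ → A) (λ k → bitOf (P.Packed.word (packed f) k)) b′ p

    -- The children leave b * A bits to their states; b - 1 words of A bits are stored here and the
    -- remaining A bits are left to the state of the node.
    total-len : m ∸ A ≡ off + sumTo memLen b
    total-len = trans (cong (_∸ A) (trans m≡ (+-comm A _))) (m+n∸n≡m (off + sumTo memLen b) A)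
      where
      sum-split : sumTo ms b ≡ sumTo memLen b + b * A
      sum-split = trans (sumTo-cong b λ i _ → sym (m∸n+n≡m (A≤ms i))) (trans (sumOf-add memLen (λ _ → A) (downFrom b)) (cong (sumTo memLen b +_) (sumTo-const A b)))
      lem : ∀ x b A → x + (A + b * A) ≡ A + (b * A + x)
      lem = solve-∀
      m≡ : m ≡ A + (off + sumTo memLen b)
      m≡ = trans (sym sum≡) (trans sum-split (trans (cong (λ z → sumTo memLen b + z * A) b≡) (trans (lem (sumTo memLen b) b′ A) (cong (λ z → A + (z + sumTo memLen b)) (sym (sumTo-const A b′))))))

    memory-word : ∀ f k t → k < b′ → t < A → memory f (k * A + t) ≡ bitOf (P.Packed.word (packed f) k) t
    memory-word f k t k< t< with off ≤? k * A + t
    ... | yes p = ⊥-elim (<⇒≱ (<-≤-trans (+-monoʳ-< (k * A) t<) (≤-trans (≤-reflexive (+-comm (k * A) A)) (≤-trans (*-monoˡ-≤ A k<) (≤-reflexive (sym (sumTo-const A b′)))))) p)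
    ... | no _ = trans (cong (λ z → cat (λ _ → A) (λ k → bitOf (P.Packed.word (packed f) k)) b′ (z + t)) (sym (sumTo-const A k)))
                   (cat-≡ (λ _ → A) (λ k → bitOf (P.Packed.word (packed f) k)) b′ k t k< t<)

    memory-child : ∀ f i t → i < b → t < memLen i → memory f (off + sumTo memLen i + t) ≡ Level.encM (lv i) (sub f i) t
    memory-child f i t i< t< with off ≤? off + sumTo memLen i + t
    ... | no p = ⊥-elim (p (≤-trans (m≤m+n off (sumTo memLen i)) (m≤m+n _ t)))
    ... | yes _ = trans (cong (cat memLen (λ i → Level.encM (lv i) (sub f i)) b) (trans (cong (_∸ off) (+-assoc off (sumTo memLen i) t)) (m+n∸m≡n off (sumTo memLen i + t))))
                    (cat-≡ memLen (λ i → Level.encM (lv i) (sub f i)) b i t i< t<)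

    word-range : ∀ k t → k < b′ → t < A → k * A + t < m ∸ A
    word-range k t k< t< = subst (k * A + t <_) (sym total-len) (<-≤-trans (+-monoʳ-< (k * A) t<)
      (≤-trans (≤-reflexive (+-comm (k * A) A)) (≤-trans (*-monoˡ-≤ A k<) (≤-trans (≤-reflexive (sym (sumTo-const A b′))) (m≤m+n off _)))))

    child-range : ∀ i t → i < b → t < memLen i → off + sumTo memLen i + t < m ∸ A
    child-range i t i< t< = subst (off + sumTo memLen i + t <_) (sym total-len) (subst (_< off + sumTo memLen b) (sym (+-assoc off (sumTo memLen i) t))
      (+-monoʳ-< off (<-≤-trans (+-monoʳ-< (sumTo memLen i) t<) (≤-trans (≤-reflexive (+-comm (sumTo memLen i) (memLen i))) (sumTo-≤-total memLen i<)))))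

    finish : ℕ → ℕ → ℕ × ℕ → Prog ℕ c
    finish u i r = mapP (proj₁ r +_) (shift (off + sumTo memLen i) (Level.qry (lv i) (proj₂ r) (u ∸ sumTo ms i)))

    -- For the last child the word at its own position does not exist; whatever is read there is
    -- ignored, as the high part comes from the state.
    query-child : ℕ → ℕ → ℕ → Prog ℕ (5 + c)
    query-child s u i =
      rd (pred (pred i) * A) λ x₁ → rd (pred i * A) λ x₂ → rd (i * A) λ x₃ → rd (pred (P.auxAt s i) * A) λ x₄ → rd (P.auxAt s i * A) λ x₅ →
        finish u i (P.access s i x₁ x₂ x₃ x₄ x₅)

    query-ok : ∀ f mem → (∀ i → i < m ∸ A → mem i ≡ memory f i) → ∀ u i → i < b → sumTo ms i ≤ u → u ∸ sumTo ms i ≤ ms i →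
      eval (query-child (P.Packed.s (packed f)) u i) mem ≡ rk f u
    query-ok f mem h u i i< le₁ le₂ = begin
      eval (finish u i (P.access s i (r (pred (pred i))) (r (pred i)) (r i) (r (pred (P.auxAt s i))) (r (P.auxAt s i)))) mem
        ≡⟨ cong (λ z → eval (finish u i z) mem) (P.Packed.correct (packed f) r words i i<) ⟩
      eval (finish u i (y f i , σ f i)) mem
        ≡⟨ eval-mapP (y f i +_) (shift (off + sumTo memLen i) (Level.qry (lv i) (σ f i) (u ∸ sumTo ms i))) mem ⟩
      y f i + eval (shift (off + sumTo memLen i) (Level.qry (lv i) (σ f i) (u ∸ sumTo ms i))) mem
        ≡⟨ cong (y f i +_) (eval-shift (off + sumTo memLen i) (Level.qry (lv i) (σ f i) (u ∸ sumTo ms i)) mem) ⟩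
      y f i + eval (Level.qry (lv i) (σ f i) (u ∸ sumTo ms i)) (λ t → mem (off + sumTo memLen i + t))
        ≡⟨ cong (y f i +_) (Level.correct (lv i) (sub f i) _ (λ t t< → trans (h _ (child-range i t i< t<)) (memory-child f i t i< t<)) (u ∸ sumTo ms i) le₂) ⟩
      y f i + rk (sub f i) (u ∸ sumTo ms i)
        ≡⟨ cong (_+ rk (sub f i) (u ∸ sumTo ms i)) (y-rk f i) ⟩
      rk f (sumTo ms i) + rk (sub f i) (u ∸ sumTo ms i)
        ≡⟨ sym (rk-+ f (sumTo ms i) (u ∸ sumTo ms i)) ⟩
      rk f (sumTo ms i + (u ∸ sumTo ms i))
        ≡⟨ cong (rk f) (m+[n∸m]≡n le₁) ⟩
      rk f u ∎
      where
      open ≡-Reasoning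
      s = P.Packed.s (packed f)
      r : ℕ → ℕ
      r k = num A (λ t → mem (k * A + t))
      words : ∀ k → k < b′ → r k ≡ P.Packed.word (packed f) k
      words k k< = trans (num-cong A λ t t< → trans (h _ (word-range k t k< t<)) (memory-word f k t k< t<))
        (num-bitOf A _ (P.Packed.word< (packed f) k k<))

    1≤b : 1 ≤ b
    1≤b = ≤-trans (s≤s z≤n) b≥

    ks : ℕ → ℕ
    ks i = Level.k (lv i)

    -- Wasted factors multiply, so the exponent counts the nodes of the subtree: one for this node
    -- plus those of the children.
    bound : P.K′ * D ^ suc (sumTo ks b) ≤ 2 ^ A * suc D ^ suc (sumTo ks b)
    bound = *-cancelʳ-≤ _ _ (2 ^ (A * b′)) {{m^n≢0 2 (A * b′)}} (begin
      P.K′ * (D * D ^ sumTo ks b) * 2 ^ (A * b′)             ≡⟨ l₁ P.K′ D (D ^ sumTo ks b) (2 ^ (A * b′)) ⟩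
      P.K′ * 2 ^ (A * b′) * D * D ^ sumTo ks b               ≤⟨ *-monoˡ-≤ (D ^ sumTo ks b) P.K′-bound ⟩
      suc D * prodTo (λ i → Child.K (cs i)) b * D ^ sumTo ks b ≡⟨ *-assoc (suc D) (prodTo (λ i → Child.K (cs i)) b) (D ^ sumTo ks b) ⟩
      suc D * (prodTo (λ i → Child.K (cs i)) b * D ^ sumTo ks b)
        ≡⟨ cong (suc D *_) (trans (cong₂ _*_ (prodTo-cong b λ i _ → cs-K i) (sym (sumTo-pow D ks b))) (sym (prodTo-* (λ i → Level.K (lv i)) (λ i → D ^ ks i) b))) ⟩
      suc D * prodTo (λ i → Level.K (lv i) * D ^ ks i) b     ≤⟨ *-monoʳ-≤ (suc D) (prodTo-mono b λ i _ → Level.K-bound (lv i)) ⟩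
      suc D * prodTo (λ i → 2 ^ A * suc D ^ ks i) b
        ≡⟨ cong (suc D *_) (trans (prodTo-* (λ _ → 2 ^ A) (λ i → suc D ^ ks i) b) (cong₂ _*_ (trans (prodTo-const (2 ^ A) b) (^-*-assoc 2 A b)) (sumTo-pow (suc D) ks b))) ⟩
      suc D * (2 ^ (A * b) * suc D ^ sumTo ks b)
        ≡⟨ cong (λ z → suc D * (z * suc D ^ sumTo ks b)) (trans (cong (2 ^_) (trans (cong (A *_) b≡) (*-suc A b′))) (2^-+ A (A * b′))) ⟩
      suc D * (2 ^ A * 2 ^ (A * b′) * suc D ^ sumTo ks b)    ≡⟨ l₂ (suc D) (2 ^ A) (2 ^ (A * b′)) (suc D ^ sumTo ks b) ⟩
      2 ^ A * (suc D * suc D ^ sumTo ks b) * 2 ^ (A * b′)    ∎)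
      where
      open ≤-Reasoning
      l₁ : ∀ a b c d → a * (b * c) * d ≡ a * d * b * c
      l₁ = solve-∀
      l₂ : ∀ a b c d → a * (b * c * d) ≡ b * (a * d) * c
      l₂ = solve-∀

    k-small : suc (suc (sumTo ks b)) ≤ m
    k-small = begin
      2 + sumTo ks b                       ≤⟨ +-monoˡ-≤ (sumTo ks b) b≥ ⟩
      b + sumTo ks b                       ≡⟨ cong (_+ sumTo ks b) (sym (trans (sumTo-const 1 b) (*-identityʳ b))) ⟩
      sumTo (λ _ → 1) b + sumTo ks b       ≡⟨ sym (sumOf-add (λ _ → 1) ks (downFrom b)) ⟩
      sumTo (λ i → suc (ks i)) b           ≤⟨ sumTo-mono b (λ i _ → Level.k<m (lv i)) ⟩
      sumTo ms b                           ≡⟨ sum≡ ⟩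
      m                                    ∎
      where open ≤-Reasoning

  node : Level m (5 + c)
  node = record
    { K = P.K′ ; k = suc (sumTo ks b) ; lab = P.lab′ ; encS = λ f → P.Packed.s (packed f) ; encM = memory
    ; qry = λ s u → query-child s u (locate ms b u)
    ; encS< = λ f → P.Packed.s< (packed f)
    ; lab-≡ = λ f → trans (P.Packed.lab-≡ (packed f)) (y-b f)
    ; correct = λ f mem h u u≤ → let q = locate-spec ms b u 1≤b (≤-trans u≤ (≤-reflexive (sym sum≡))) in
        query-ok f mem h u (locate ms b u) (proj₁ q) (proj₁ (proj₂ q)) (proj₂ (proj₂ q))
    ; k<m = k-small
    ; K-bound = bound }

part : ℕ → ℕ → ℕ → ℕ
part q r i = q + bit (i <ᵇ r)

part-sum : ∀ m b q r → m ≡ r + q * b → r ≤ b → sumTo (part q r) b ≡ m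
part-sum m b q r m≡ r≤ = trans (sumOf-add (λ _ → q) (λ i → bit (i <ᵇ r)) (downFrom b))
  (trans (cong₂ _+_ (sumTo-const q b) (trans (count-below r b) (m≥n⇒m⊓n≡n r≤)))
  (trans (trans (cong (_+ r) (*-comm b q)) (+-comm (q * b) r)) (sym m≡)))

part-≥ : ∀ q r i → q ≤ part q r i
part-≥ q r i = m≤m+n q _

part-≤ : ∀ q r i X → q ≤ X → (1 ≤ r → suc q ≤ X) → part q r i ≤ X
part-≤ q r i X h₁ h₂ with i <ᵇ r in eq
... | true = ≤-trans (≤-reflexive (+-comm q 1)) (h₂ (≤-<-trans z≤n (<ᵇ-true⇒< {i} {r} eq)))
... | false = ≤-trans (≤-reflexive (+-identityʳ q)) h₁

-- The tree

-- One scale must serve all children, whose lengths are q or q + 1.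
scale : ∀ q → 32 ≤ q → ∃ λ d → 2 ^ (5 + 2 * d) ≤ q × suc q ≤ 2 ^ (8 + 2 * d)
scale q h = go q 0 h (≤-trans (n<2^n q) (2^-mono (≤-trans (m≤m+n q (q + 0)) (m≤n+m (2 * q) 5))))
  where
  go : ∀ f d → 2 ^ (5 + 2 * d) ≤ q → suc q ≤ 2 ^ (5 + 2 * (d + f)) → ∃ λ d → 2 ^ (5 + 2 * d) ≤ q × suc q ≤ 2 ^ (8 + 2 * d)
  go zero d p r = ⊥-elim (<⇒≱ (≤-trans r (≤-reflexive (cong (λ z → 2 ^ (5 + 2 * z)) (+-identityʳ d)))) p)
  go (suc f) d p r with 2 ^ (5 + 2 * suc d) ≤? q
  ... | yes p′ = go f (suc d) p′ (≤-trans r (≤-reflexive (cong (λ z → 2 ^ (5 + 2 * z)) (+-suc d f))))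
  ... | no p′ = d , p , ≤-trans (≰⇒> p′) (2^-mono {5 + 2 * suc d} {8 + 2 * d} (≤-add 1 (lem d)))
    where
    lem : ∀ d → 8 + 2 * d ≡ 5 + 2 * suc d + 1
    lem = solve-∀

module Tree (w a B wl : ℕ)
            (w≥ : 2 ≤ w) (a≥ : 150 * w ≤ a) (B≥ : 2 ≤ B) (B-small : 3 * B + 2 ≤ w)
            (W≤ : width w ≤ 2 ^ wl) (w≤wl : w ≤ 2 ^ wl) (wl-small : B * (2 * wl + 2) ≤ w) where
  open Params w a
  open Levels w a

  private
    300w≤A : 300 * w ≤ A
    300w≤A = 300w≤2a w a a≥

    opaque
      32≤A : 32 ≤ A
      32≤A = ≤-trans (≤-trans (m≤m+n 32 568) (*-monoʳ-≤ 300 w≥)) 300w≤A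

    instance
      A≢0 : NonZero A
      A≢0 = >-nonZero (≤-trans (s≤s z≤n) 32≤A)

  level-weaken : ∀ {m c c′} → c ≤ c′ → Level m c → Level m c′
  level-weaken h L = record
    { K = K ; k = k ; lab = lab ; encS = encS ; encM = encM ; qry = λ s u → weaken h (qry s u) ; encS< = encS< ; lab-≡ = lab-≡
    ; correct = λ f mem p u u≤ → trans (eval-weaken h (qry (encS f) u) mem) (correct f mem p u u≤)
    ; k<m = k<m ; K-bound = K-bound }
    where open Level L

  base-level : ∀ m → A ≤ m → m ≤ A + A → m < 2 ^ w → Level m 1
  base-level m A≤m m≤ m< = Base.base m A≤m m≤ m< (≤-trans (m≤m+n 2 30) (≤-trans 32≤A A≤m)) (≤-trans (*-monoˡ-≤ w (m≤m+n 21 279)) 300w≤A)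

  module Split (m : ℕ) (m> : A + A < m) (m< : m < 2 ^ w) where
    -- The degree is capped by m / A so that every child keeps at least A bits.
    b : ℕ
    b = B ⊓ (m / A)

    private
      2A≤m : 2 * A ≤ m
      2A≤m = ≤-trans (≤-reflexive (cong (A +_) (+-identityʳ A))) (<⇒≤ m>)

      2≤m/A : 2 ≤ m / A
      2≤m/A = ≤-trans (≤-reflexive (sym (m*n/n≡m 2 A))) (/-monoˡ-≤ A 2A≤m)

    b≥ : 2 ≤ b
    b≥ = ⊓-glb B≥ 2≤m/A

    private
      instance
        b≢0 : NonZero b
        b≢0 = >-nonZero (≤-trans (s≤s z≤n) b≥)

    b≤B : b ≤ B
    b≤B = m⊓n≤m B (m / A)

    q r : ℕ
    q = m / b
    r = m % b

    m≡ : m ≡ r + q * b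
    m≡ = m≡m%n+[m/n]*n m b

    r≤b : r ≤ b
    r≤b = <⇒≤ (m%n<n m b)

    private
      bA≤m : b * A ≤ m
      bA≤m = ≤-trans (*-monoˡ-≤ A (m⊓n≤n B (m / A))) (m/n*n≤m m A)

    A≤q : A ≤ q
    A≤q = ≤-trans (≤-reflexive (sym (m*n/n≡m A b))) (/-monoˡ-≤ b (≤-trans (≤-reflexive (*-comm A b)) bA≤m))

    q≤m : q ≤ m
    q≤m = ≤-trans (m≤m*n q b) (m/n*n≤m m b)

    ms≤m : ∀ i → part q r i ≤ m
    ms≤m i = part-≤ q r i m q≤m λ 1≤r → ≤-trans (+-mono-≤ 1≤r (m≤m*n q b)) (≤-reflexive (sym m≡))

    -- With full degree `B` the lengths shrink by the factor `B`; with the degree capped by m / A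
    -- they are at most 2A, which is leaf size.
    ms-upper : ∀ X → m ≤ X * B → 2 * A ≤ X → ∀ i → part q r i ≤ X
    ms-upper X m≤ 2A≤ i with ⊓-sel B (m / A)
    ... | inj₁ b≡B = part-≤ q r i X
            (*-cancelʳ-≤ q X b (≤-trans (m/n*n≤m m b) m≤′))
            λ 1≤r → *-cancelʳ-< b q X (<-≤-trans (≤-trans (+-monoˡ-≤ (q * b) 1≤r) (≤-reflexive (sym m≡))) m≤′)
      where
      m≤′ : m ≤ X * b
      m≤′ = ≤-trans m≤ (≤-reflexive (cong (X *_) (sym b≡B)))
    ... | inj₂ b≡ = part-≤ q r i X (<⇒≤ (<-≤-trans q<2A 2A≤)) (λ _ → ≤-trans q<2A 2A≤)
      where
      q<2A : q < 2 * A
      q<2A = *-cancelʳ-< b q (2 * A) (≤-<-trans (m/n*n≤m m b) (<-≤-trans m<bA (≤-trans (+-monoˡ-≤ (b * A) (≤-trans (≤-reflexive (sym (*-identityˡ A))) (*-monoˡ-≤ A (≤-trans (s≤s z≤n) b≥)))) (≤-reflexive (lem b A)))))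
        where
        lem : ∀ b A → b * A + b * A ≡ 2 * A * b
        lem = solve-∀
        m<bA : m < A + b * A
        m<bA = ≤-<-trans (≤-reflexive (m≡m%n+[m/n]*n m A)) (<-≤-trans (+-monoˡ-< (m / A * A) (m%n<n m A)) (≤-reflexive (cong (λ z → A + z * A) (sym b≡))))

    split-at : ∀ {c} d → 2 ^ (5 + 2 * d) ≤ q → suc q ≤ 2 ^ (8 + 2 * d) → (∀ i → Level (part q r i) c) → Level m (5 + c)
    split-at {c} d lower upper lv = NodeLevel.node w a d b (pred b) (sym (suc-pred b)) w≥ (≤-trans (+-monoˡ-≤ (2 * d) (m≤m+n 1 4)) (<⇒≤ d<w)) a≥ b≥
        (≤-trans (+-monoˡ-≤ 2 (*-monoʳ-≤ 3 b≤B)) B-small) wl W≤ (≤-trans d<w′ w≤wl)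
        (≤-trans (*-monoˡ-≤ (2 * wl + 2) b≤B) wl-small) m c (part q r) (part-sum m b q r m≡ r≤b) m< ms≤m (λ i → ≤-trans A≤q (part-≥ q r i))
        (λ i → ≤-trans lower (part-≥ q r i)) (λ i → part-≤ q r i (2 ^ (8 + 2 * d)) (≤-trans (n≤1+n q) upper) (λ _ → upper)) lv
      where
      d<w : 5 + 2 * d < w
      d<w = ≰⇒> λ p → <⇒≱ m< (≤-trans (2^-mono p) (≤-trans lower q≤m))
      d<w′ : suc d ≤ w
      d<w′ = ≤-trans (s≤s (≤-trans (m≤m+n d (d + 0)) (m≤n+m (2 * d) 5))) d<w

    split : ∀ {c} → (∀ i → Level (part q r i) c) → Level m (5 + c)
    split lv = split-at (proj₁ sc) (proj₁ (proj₂ sc)) (proj₂ (proj₂ sc)) lv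
      where
      sc = scale q (≤-trans 32≤A A≤q)

  tree : ∀ h m → A ≤ m → m ≤ 2 * A * B ^ h → m < 2 ^ w → Level m (1 + h * 5)
  tree zero m A≤m m≤ m< = base-level m A≤m (≤-trans m≤ (≤-reflexive (lem A))) m<
    where
    lem : ∀ A → 2 * A * 1 ≡ A + A
    lem = solve-∀
  tree (suc h) m A≤m m≤ m< = step (m ≤? A + A)
    where
    lem₁ : ∀ h → 5 + (1 + h * 5) ≡ 1 + (5 + h * 5)
    lem₁ = solve-∀
    lem₂ : ∀ x y z → x * (y * z) ≡ x * z * y
    lem₂ = solve-∀
    step : Dec (m ≤ A + A) → Level m (1 + suc h * 5)
    step (yes p) = level-weaken (s≤s z≤n) (base-level m A≤m p m<)
    step (no p) = level-weaken (≤-reflexive (lem₁ h)) (S.split λ i → tree h (part S.q S.r i) (≤-trans S.A≤q (part-≥ S.q S.r i))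
        (S.ms-upper (2 * A * B ^ h) (≤-trans m≤ (≤-reflexive (lem₂ (2 * A) B (B ^ h)))) (m≤m*n (2 * A) (B ^ h) {{m^n≢0 B h {{>-nonZero (≤-trans (s≤s z≤n) B≥)}}}}) i)
        (≤-<-trans (S.ms≤m i) m<))
      where
      module S = Split m (≰⇒> p) m<

-- Cell probes

bitAt-lookup : ∀ {s} (M : Vec Bool s) i (i< : i < s) → bitAt M i ≡ lookup M (fromℕ< i<)
bitAt-lookup {s} M i i< with i <? s
... | yes p = cong (λ q → lookup M (fromℕ< q)) (≤-irrelevant p i<)
... | no p = ⊥-elim (p i<)

bitAt-tabulate : ∀ {s} (f : ℕ → Bool) i → i < s → bitAt {s} (tabulate (f ∘ toℕ)) i ≡ f i
bitAt-tabulate f i i< = trans (bitAt-lookup (tabulate (f ∘ toℕ)) i i<)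
  (trans (VecP.lookup∘tabulate (f ∘ toℕ) (fromℕ< i<)) (cong f (FinP.toℕ-fromℕ< i<)))

bitAt-suc : ∀ {s} c (M : Vec Bool s) i → i < s → bitAt (c ∷ M) (suc i) ≡ bitAt M i
bitAt-suc c M i i< = trans (bitAt-lookup (c ∷ M) (suc i) (s≤s i<)) (sym (bitAt-lookup M i i<))

rank-rk : ∀ {n} (M : Vec Bool n) u → u ≤ n → rank M u ≡ rk (bitAt M) u
rank-rk [] zero _ = refl
rank-rk (c ∷ M) zero _ = refl
rank-rk (true ∷ M) (suc u) (s≤s u≤) = cong suc (trans (rank-rk M u u≤) (rk-cong u λ i i< → sym (bitAt-suc true M i (<-≤-trans i< u≤))))
rank-rk (false ∷ M) (suc u) (s≤s u≤) = trans (rank-rk M u u≤) (rk-cong u λ i i< → sym (bitAt-suc false M i (<-≤-trans i< u≤)))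

module Probing (w α : ℕ) .{{_ : NonZero w}} where

  Window : Set
  Window = ℕ → Bool

  extend : ℕ → Vec Bool w → Window → Window
  extend j v g i with j * w ≤? i
  ... | yes _ = bitAt v (i ∸ j * w)
  ... | no _ = g i

  collect : ∀ {R d} k → ℕ → Window → (Window → Probe w R d) → Probe w R (k + d)
  collect zero j g κ = κ g
  collect (suc k) j g κ = probe j λ v → collect k (suc j) (extend j v g) κ

  collected : ∀ {s} → ℕ → ℕ → Window → Vec Bool s → Window
  collected zero j g M = g
  collected (suc k) j g M = collected k (suc j) (extend j (cell w M j) g) M

  run-collect : ∀ {R d s} k j g (κ : Window → Probe w R d) (M : Vec Bool s) →
    run (collect k j g κ) M ≡ run (κ (collected k j g M)) M
  run-collect zero j g κ M = refl
  run-collect (suc k) j g κ M = run-collect k (suc j) (extend j (cell w M j) g) κ M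

  collected-correct : ∀ {s} k j g (M : Vec Bool s) i → i < (k + j) * w →
    (i < j * w → g i ≡ bitAt M i) → collected k j g M i ≡ bitAt M i
  collected-correct zero j g M i hi h = h hi
  collected-correct (suc k) j g M i hi h =
    collected-correct k (suc j) (extend j (cell w M j) g) M i (subst (λ z → i < z * w) (sym (+-suc k j)) hi) ext
    where
    ext : i < suc j * w → extend j (cell w M j) g i ≡ bitAt M i
    ext i< with j * w ≤? i
    ... | yes p = trans (bitAt-tabulate (λ t → bitAt M (j * w + t)) (i ∸ j * w) (+-cancelʳ-< (j * w) _ _ (subst (_< w + j * w) (sym (m∸n+n≡m p)) i<)))
                    (cong (bitAt M) (m+[n∸m]≡n p))
    ... | no p = h (≰⇒> p)

  module _ (A : ℕ) (A≤ : A ≤ α * w) where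
    open Eval A

    -- At most α * w bits at an arbitrary offset meet at most α + 1 consecutive cells, all of which
    -- are probed.
    toProbe : ∀ {R c} → Prog R c → Probe w R (c * suc α)
    toProbe (ret x) = ret x
    toProbe (rd p k) = collect (suc α) (p / w) (λ _ → false) λ g → toProbe (k (num A λ i → g (p + i)))

    run-toProbe : ∀ {R c s} (P : Prog R c) (M : Vec Bool s) → run (toProbe P) M ≡ eval P (bitAt M)
    run-toProbe (ret x) M = refl
    run-toProbe (rd p k) M = trans (run-collect (suc α) (p / w) (λ _ → false) (λ g → toProbe (k (num A λ i → g (p + i)))) M)
      (trans (run-toProbe (k _) M) (cong (λ v → eval (k v) (bitAt M)) (num-cong A λ i i< →
        collected-correct (suc α) (p / w) (λ _ → false) M (p + i) (hi i i<)
          (λ lt → ⊥-elim (<⇒≱ lt (≤-trans (m/n*n≤m p w) (m≤m+n p i)))))))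
      where
      hi : ∀ i → i < A → p + i < (suc α + p / w) * w
      hi i i< = <-≤-trans (+-mono-<-≤ (≤-<-trans (≤-reflexive (m≡m%n+[m/n]*n p w)) (+-monoˡ-< (p / w * w) (m%n<n p w))) (≤-trans (<⇒≤ i<) A≤))
        (≤-reflexive (lem w (p / w) α))
        where
        lem : ∀ w q α → w + q * w + α * w ≡ (suc α + q) * w
        lem = solve-∀

-- Structures for whole arrays

module Structures (w a : ℕ) where
  open Params w a
  open Levels w a

  record Structure (n s c : ℕ) : Set where
    field
      enc     : (ℕ → Bool) → ℕ → Bool
      qry     : ℕ → Prog ℕ c
      correct : ∀ f mem → (∀ i → i < s → mem i ≡ enc f i) → ∀ u → u ≤ n → eval (qry u) mem ≡ rk f u

  small : ∀ n → n ≤ A → Structure n n 1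
  small n n≤ = record
    { enc = λ f → f ; qry = λ u → rd 0 λ v → ret (rk (bitOf v) u)
    ; correct = λ f mem h u u≤ → rk-cong u λ i i< → trans (bitOf-num A mem i (<-≤-trans i< (≤-trans u≤ n≤))) (h i (<-≤-trans i< u≤)) }

  -- The waste stays below a factor two, so the state fits into A + 1 bits. As a read delivers only
  -- A bits, it is assembled from reads at positions 0 and 1.
  whole : ∀ {n c} → 1 ≤ w → 0 < A → A ≤ n → n < 2 ^ w → Level n c → Structure n (suc n) (2 + c)
  whole {n} {c} w≥ A≥1 A≤n n< L = record
    { enc = enc ; qry = λ u → rd 0 λ v → rd 1 λ v′ → shift (suc A) (qry (bit (bitOf v 0) + 2 * v′) u) ; correct = ok′ }
    where
    open Level L
    D>0 : NonZero D
    D>0 = m^n≢0 2 (20 * w)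
    2n≤D : 2 * n ≤ D
    2n≤D = ≤-trans (*-monoʳ-≤ 2 (<⇒≤ n<)) (2^-mono {suc w} {20 * w} (≤-trans (+-monoˡ-≤ w w≥) (≤-trans (≤-reflexive (cong (w +_) (sym (+-identityʳ w)))) (*-monoˡ-≤ w (m≤m+n 2 18)))))
    K≤ : K ≤ 2 ^ suc A
    K≤ = *-cancelʳ-≤ K (2 ^ suc A) D {{D>0}} (≤-trans (waste-linear L w≥ n<) (≤-trans (*-monoʳ-≤ (2 ^ A) (+-monoʳ-≤ D 2n≤D)) (≤-reflexive (lem (2 ^ A) D))))
      where
      lem : ∀ p d → p * (d + d) ≡ 2 * p * d
      lem = solve-∀
    enc : (ℕ → Bool) → ℕ → Bool
    enc f i with suc A ≤? i
    ... | yes _ = encM f (i ∸ suc A)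
    ... | no _ = bitOf (encS f) i
    enc-low : ∀ f i → i < suc A → enc f i ≡ bitOf (encS f) i
    enc-low f i i< with suc A ≤? i
    ... | yes p = ⊥-elim (<⇒≱ i< p)
    ... | no _ = refl
    enc-high : ∀ f i → enc f (suc A + i) ≡ encM f i
    enc-high f i with suc A ≤? suc A + i
    ... | yes _ = cong (encM f) (m+n∸m≡n (suc A) i)
    ... | no p = ⊥-elim (p (m≤m+n (suc A) i))
    ok′ : ∀ f mem → (∀ i → i < suc n → mem i ≡ enc f i) → ∀ u → u ≤ n →
      eval (shift (suc A) (qry (bit (bitOf (num A mem) 0) + 2 * num A (λ i → mem (1 + i))) u)) mem ≡ rk f u
    ok′ f mem h u u≤ = trans (cong (λ s → eval (shift (suc A) (qry s u)) mem) s≡)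
      (trans (eval-shift (suc A) (qry (encS f) u) mem)
      (correct f (λ i → mem (suc A + i)) (λ i i< → trans (h (suc A + i) (s≤s (≤-trans (+-monoʳ-< A i<) (≤-reflexive (m+[n∸m]≡n A≤n))))) (enc-high f i)) u u≤))
      where
      s≡ : bit (bitOf (num A mem) 0) + 2 * num A (λ i → mem (1 + i)) ≡ encS f
      s≡ = trans (cong (λ c → bit c + 2 * num A (λ i → mem (1 + i))) (bitOf-num A mem 0 A≥1))
        (trans (num-cong (suc A) {mem} {bitOf (encS f)} λ i i< → trans (h i (<-≤-trans i< (s≤s A≤n))) (enc-low f i i<))
        (num-bitOf (suc A) (encS f) (<-≤-trans (encS< f) K≤)))

  structure-weaken : ∀ {n s c c′} → c ≤ c′ → Structure n s c → Structure n s c′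
  structure-weaken h S = record
    { enc = enc ; qry = λ u → weaken h (qry u) ; correct = λ f mem p u u≤ → trans (eval-weaken h (qry u) mem) (correct f mem p u u≤) }
    where open Structure S

  module Forest {n c : ℕ} (q : ℕ) (ms : ℕ → ℕ) (q≥ : 1 ≤ q) (sum≡ : sumTo ms q ≡ n) (n< : n < 2 ^ A)
                (st : ∀ i → Structure (ms i) (suc (ms i)) c) where
    private
      len : ℕ → ℕ
      len i = suc (ms i)

      sub : (ℕ → Bool) → ℕ → ℕ → Bool
      sub f i t = f (sumTo ms i + t)

      blocks prefixes : (ℕ → Bool) → ℕ → Bool
      blocks f = cat len (λ i → Structure.enc (st i) (sub f i)) q
      prefixes f = cat (λ _ → A) (λ k → bitOf (rk f (sumTo ms k))) q

      enc : (ℕ → Bool) → ℕ → Bool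
      enc f p with q * A ≤? p
      ... | yes _ = blocks f (p ∸ q * A)
      ... | no _ = prefixes f p

      enc-prefix : ∀ f k t → k < q → t < A → enc f (k * A + t) ≡ bitOf (rk f (sumTo ms k)) t
      enc-prefix f k t k< t< with q * A ≤? k * A + t
      ... | yes p = ⊥-elim (<⇒≱ (<-≤-trans (+-monoʳ-< (k * A) t<) (≤-trans (≤-reflexive (+-comm (k * A) A)) (*-monoˡ-≤ A k<))) p)
      ... | no _ = trans (cong (λ z → prefixes f (z + t)) (sym (sumTo-const A k))) (cat-≡ (λ _ → A) (λ k → bitOf (rk f (sumTo ms k))) q k t k< t<)

      enc-block : ∀ f i t → i < q → t < len i → enc f (q * A + sumTo len i + t) ≡ Structure.enc (st i) (sub f i) t
      enc-block f i t i< t< with q * A ≤? q * A + sumTo len i + t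
      ... | no p = ⊥-elim (p (≤-trans (m≤m+n (q * A) (sumTo len i)) (m≤m+n _ t)))
      ... | yes _ = trans (cong (blocks f) (trans (cong (_∸ q * A) (+-assoc (q * A) (sumTo len i) t)) (m+n∸m≡n (q * A) (sumTo len i + t))))
                      (cat-≡ len (λ i → Structure.enc (st i) (sub f i)) q i t i< t<)

      size : ℕ
      size = q * A + sumTo len q

      prefix-range : ∀ k t → k < q → t < A → k * A + t < size
      prefix-range k t k< t< = <-≤-trans (+-monoʳ-< (k * A) t<) (≤-trans (≤-reflexive (+-comm (k * A) A)) (≤-trans (*-monoˡ-≤ A k<) (m≤m+n (q * A) (sumTo len q))))

      block-range : ∀ i t → i < q → t < len i → q * A + sumTo len i + t < size
      block-range i t i< t< = subst (_< size) (sym (+-assoc (q * A) (sumTo len i) t))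
        (+-monoʳ-< (q * A) (<-≤-trans (+-monoʳ-< (sumTo len i) t<) (≤-trans (≤-reflexive (+-comm (sumTo len i) (len i))) (sumTo-≤-total len i<))))

      query-block : ℕ → ℕ → Prog ℕ (suc c)
      query-block u i = rd (i * A) λ v → mapP (v +_) (shift (q * A + sumTo len i) (Structure.qry (st i) (u ∸ sumTo ms i)))

      query-ok : ∀ f mem → (∀ i → i < size → mem i ≡ enc f i) → ∀ u → u ≤ n → ∀ i → i < q → sumTo ms i ≤ u → u ∸ sumTo ms i ≤ ms i →
        eval (query-block u i) mem ≡ rk f u
      query-ok f mem h u u≤ i i< le₁ le₂ = begin
        eval (mapP (num A (λ t → mem (i * A + t)) +_) Q) mem   ≡⟨ eval-mapP (num A (λ t → mem (i * A + t)) +_) Q mem ⟩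
        num A (λ t → mem (i * A + t)) + eval Q mem             ≡⟨ cong₂ _+_ pre body ⟩
        rk f (sumTo ms i) + rk (sub f i) (u ∸ sumTo ms i)      ≡⟨ sym (rk-+ f (sumTo ms i) (u ∸ sumTo ms i)) ⟩
        rk f (sumTo ms i + (u ∸ sumTo ms i))                   ≡⟨ cong (rk f) (m+[n∸m]≡n le₁) ⟩
        rk f u ∎
        where
        open ≡-Reasoning
        Q : Prog ℕ c
        Q = shift (q * A + sumTo len i) (Structure.qry (st i) (u ∸ sumTo ms i))
        pre : num A (λ t → mem (i * A + t)) ≡ rk f (sumTo ms i)
        pre = trans (num-cong A λ t t< → trans (h _ (prefix-range i t i< t<)) (enc-prefix f i t i< t<))
          (num-bitOf A (rk f (sumTo ms i)) (≤-<-trans (rk-≤ f (sumTo ms i)) (≤-<-trans (≤-trans le₁ u≤) n<)))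
        body : eval Q mem ≡ rk (sub f i) (u ∸ sumTo ms i)
        body = trans (eval-shift (q * A + sumTo len i) (Structure.qry (st i) (u ∸ sumTo ms i)) mem)
          (Structure.correct (st i) (sub f i) _ (λ t t< → trans (h _ (block-range i t i< t<)) (enc-block f i t i< t<)) (u ∸ sumTo ms i) le₂)

    -- Every block pays A bits for the rank at its start, found by one read, and one bit for the
    -- rounded-up state of its tree.
    forest : Structure n (q * A + sumTo (λ i → suc (ms i)) q) (suc c)
    forest = record
      { enc = enc ; qry = λ u → query-block u (locate ms q u)
      ; correct = λ f mem h u u≤ → let z = locate-spec ms q u q≥ (≤-trans u≤ (≤-reflexive (sym sum≡))) in
          query-ok f mem h u u≤ (locate ms q u) (proj₁ z) (proj₁ (proj₂ z)) (proj₂ (proj₂ z)) }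

  toDS : ∀ {n s c} α .{{_ : NonZero w}} → A ≤ α * w → Structure n s c → RankDS n w s (c * suc α)
  toDS {n} {s} α A≤ S = record
    { preprocess = λ M → tabulate (enc (bitAt M) ∘ toℕ)
    ; query = λ u → Probing.toProbe w α A A≤ (qry (toℕ u))
    ; correct = λ M u → trans (Probing.run-toProbe w α A A≤ (qry (toℕ u)) (tabulate (enc (bitAt M) ∘ toℕ)))
        (trans (correct (bitAt M) (bitAt {s} (tabulate (enc (bitAt M) ∘ toℕ))) (λ i i< → bitAt-tabulate {s} (enc (bitAt M)) i i<) (toℕ u) (≤-pred (FinP.toℕ<n u)))
          (sym (rank-rk M (toℕ u) (≤-pred (FinP.toℕ<n u))))) }
    where open Structure S

-- Choice of parameters

log₂ : ∀ w → 1 ≤ w → ∃ λ ℓ → 2 ^ ℓ ≤ w × w < 2 ^ suc ℓ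
log₂ w h = go w 0 h (<-≤-trans (n<2^n w) (2^-mono (n≤1+n w)))
  where
  go : ∀ f ℓ → 2 ^ ℓ ≤ w → w < 2 ^ suc (ℓ + f) → ∃ λ ℓ → 2 ^ ℓ ≤ w × w < 2 ^ suc ℓ
  go zero ℓ p r = ℓ , p , subst (λ z → w < 2 ^ suc z) (+-identityʳ ℓ) r
  go (suc f) ℓ p r with 2 ^ suc ℓ ≤? w
  ... | yes p′ = go f (suc ℓ) p′ (subst (λ z → w < 2 ^ suc z) (+-suc ℓ f) r)
  ... | no p′ = ℓ , p , ≰⇒> p′

-- The inequality behind `wl-small`; it starts at exponent 6, half of the 12 in the lower bound 2^12
-- on w.
linear≤2^ : ∀ γ → 4 * (6 + γ) + 26 ≤ 2 ^ (6 + γ)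
linear≤2^ zero = m≤m+n 50 14
linear≤2^ (suc γ) = begin
  4 * (6 + suc γ) + 26            ≤⟨ ≤-add (46 + 4 * γ) (lem γ) ⟩
  2 * (4 * (6 + γ) + 26)          ≤⟨ *-monoʳ-≤ 2 (linear≤2^ γ) ⟩
  2 ^ suc (6 + γ)                 ≡⟨ cong (2 ^_) (sym (+-suc 6 γ)) ⟩
  2 ^ (6 + suc γ)                 ∎
  where
  open ≤-Reasoning
  lem : ∀ γ → 2 * (4 * (6 + γ) + 26) ≡ 4 * (6 + suc γ) + 26 + (46 + 4 * γ)
  lem = solve-∀

2^-cancel : ∀ {m n} → 2 ^ m ≤ 2 ^ n → m ≤ n
2^-cancel {m} {n} h = ≮⇒≥ λ lt → <⇒≱ (^-monoʳ-< 2 (s≤s (s≤s z≤n)) lt) h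

module Parameters (w : ℕ) (w≥ : 2 ^ 12 ≤ w) where
  private
    w≥1 : 1 ≤ w
    w≥1 = ≤-trans (2^>0 12) w≥
    L = log₂ w w≥1
    ℓ = proj₁ L
    ℓ≤ = proj₁ (proj₂ L)
    <ℓ = proj₂ (proj₂ L)
    β = ⌊ ℓ /2⌋
    12≤ℓ : 12 ≤ ℓ
    12≤ℓ = ≤-pred (≰⇒> λ p → <⇒≱ <ℓ (≤-trans (2^-mono p) w≥))
    6≤β : 6 ≤ β
    6≤β = ⌊n/2⌋-mono 12≤ℓ
    γ = β ∸ 6
    β≡ : 6 + γ ≡ β
    β≡ = m+[n∸m]≡n 6≤β
    2β≤ℓ : 2 * β ≤ ℓ
    2β≤ℓ with parity ℓ
    ... | inj₁ e = ≤-reflexive (sym e)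
    ... | inj₂ e = ≤-trans (n≤1+n _) (≤-reflexive (sym e))
    ℓ≤2β : ℓ ≤ suc (2 * β)
    ℓ≤2β with parity ℓ
    ... | inj₁ e = ≤-trans (≤-reflexive e) (n≤1+n _)
    ... | inj₂ e = ≤-reflexive e

  -- `B` lies between √w / 2 and √w, and `wl` bounds the binary logarithms of w and of `width w`.
  B wl : ℕ
  B = 2 ^ β
  wl = ℓ + 11

  B≥ : 2 ≤ B
  B≥ = 2^-mono {1} {β} (≤-trans (s≤s z≤n) 6≤β)

  wl-small : B * (2 * wl + 2) ≤ w
  wl-small = ≤-trans (2^*2^≤ β β ≤-refl (≤-trans (≤-trans (+-monoˡ-≤ 2 (*-monoʳ-≤ 2 (+-monoˡ-≤ 11 ℓ≤2β))) (≤-reflexive (lem β)))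
      (subst (λ z → 4 * z + 26 ≤ 2 ^ z) β≡ (linear≤2^ γ))) (≤-trans (≤-reflexive (cong (β +_) (sym (+-identityʳ β)))) 2β≤ℓ)) ℓ≤
    where
    lem : ∀ β → 2 * (suc (2 * β) + 11) + 2 ≡ 4 * β + 26
    lem = solve-∀

  B-small : 3 * B + 2 ≤ w
  B-small = ≤-trans (≤-trans (+-monoʳ-≤ (3 * B) (≤-trans (m≤m+n 2 2) (*-monoʳ-≤ 2 B≥))) (≤-trans (≤-reflexive (lem B)) (*-monoʳ-≤ B five))) wl-small
    where
    lem : ∀ B → 3 * B + 2 * B ≡ B * 5
    lem = solve-∀
    five : 5 ≤ 2 * wl + 2
    five = ≤-trans (≤-trans (m≤m+n 5 17) (*-monoʳ-≤ 2 (m≤n+m 11 ℓ))) (m≤m+n (2 * wl) 2)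

  w≤wl : w ≤ 2 ^ wl
  w≤wl = ≤-trans (<⇒≤ <ℓ) (2^-mono {suc ℓ} {wl} (≤-trans (≤-reflexive (+-comm 1 ℓ)) (+-monoʳ-≤ ℓ (m≤m+n 1 10))))

  W≤ : width w ≤ 2 ^ wl
  W≤ = ≤-trans (≤-reflexive (width-≡ w)) (≤-trans (≤-trans (+-monoʳ-≤ (640 * w) (≤-trans (m≤m+n 20 364) (*-monoʳ-≤ 384 w≥1))) (≤-reflexive (lem w)))
      (2^*2^≤ 10 (suc ℓ) ≤-refl (<⇒≤ <ℓ) (≤-reflexive (lem₂ ℓ))))
    where
    lem : ∀ w → 640 * w + 384 * w ≡ 1024 * w
    lem = solve-∀
    lem₂ : ∀ ℓ → 10 + suc ℓ ≡ ℓ + 11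
    lem₂ = solve-∀

  -- Rounding to a power of two can leave `B` squared below w, so three levels of the tree are spent
  -- on each factor w.
  w≤B³ : w ≤ B ^ 3
  w≤B³ = ≤-trans (<⇒≤ <ℓ) (≤-trans (2^-mono {suc ℓ} {β * 3} (≤-trans (s≤s ℓ≤2β) (≤-trans (+-monoˡ-≤ (2 * β) (≤-trans (m≤m+n 2 4) 6≤β)) (≤-reflexive (lem β)))))
      (≤-reflexive (sym (^-*-assoc 2 β 3))))
    where
    lem : ∀ β → β + 2 * β ≡ β * 3
    lem = solve-∀

-- One word, one tree or a forest, according to the length of the array

module Main (n w t : ℕ) (n≥ : 2 ≤ n) (n< : n < 2 ^ w) (w≥ : 2 ^ 12 ≤ w) (t≥ : 1 ≤ t) where
  open Parameters w w≥
  a : ℕ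
  a = 150 * w
  open Params w a
  open Levels w a
  open Structures w a

  private
    w≥1 : 1 ≤ w
    w≥1 = ≤-trans (2^>0 12) w≥
    w≥2 : 2 ≤ w
    w≥2 = ≤-trans (2^-mono {1} {12} (s≤s z≤n)) w≥
    module TR = Tree w a B wl w≥2 ≤-refl B≥ B-small W≤ w≤wl wl-small

    -- Three levels per factor w, and one more for the factor two in `P-large`.
    h : ℕ
    h = 3 * t + 1

    opaque
      w≤A : w ≤ A
      w≤A = ≤-trans (m≤m+n w (299 * w)) (300w≤2a w a ≤-refl)

      A>0 : 0 < A
      A>0 = ≤-trans w≥1 w≤A

    instance
      B≢0 : NonZero B
      B≢0 = >-nonZero (≤-trans (s≤s z≤n) B≥)
      A≢0 : NonZero A
      A≢0 = >-nonZero A>0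

    P : ℕ
    P = B ^ h

    instance
      P≢0 : NonZero P
      P≢0 = m^n≢0 B h

    S : ℕ
    S = A * P

    instance
      S≢0 : NonZero S
      S≢0 = m*n≢0 A P

    P-large : 2 * w ^ t ≤ P
    P-large = ≤-trans (*-mono-≤ B≥ (≤-trans (^-monoˡ-≤ t w≤B³) (≤-reflexive (^-*-assoc B 3 t))))
      (≤-reflexive (trans (*-comm B (B ^ (3 * t))) (sym (trans (^-distribˡ-+-* B (3 * t) 1) (cong (B ^ (3 * t) *_) (*-identityʳ B))))))

    -- Five reads per level, one at the leaf, two for the state at the root and one for the rank at
    -- the start of the block.
    cost : 4 + h * 5 ≤ 24 * t
    cost = ≤-trans (≤-reflexive (lem₁ t)) (≤-trans (+-monoˡ-≤ (15 * t) (*-monoʳ-≤ 9 t≥)) (≤-reflexive (lem₂ t)))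
      where
      lem₁ : ∀ t → 4 + (3 * t + 1) * 5 ≡ 9 * 1 + 15 * t
      lem₁ = solve-∀
      lem₂ : ∀ t → 9 * t + 15 * t ≡ 24 * t
      lem₂ = solve-∀

  -- The inequality is s ≤ n + ⌈n / w^t⌉ without division: an integer x satisfies x ≤ ⌈y⌉ exactly
  -- when x - 1 < y.
  Result : Set
  Result = Σ ℕ λ s → ((s ∸ n) ∸ 1) * w ^ t < n × Structure n s (24 * t)

  private
    no-redundancy : ∀ s → s ≤ suc n → ((s ∸ n) ∸ 1) * w ^ t < n
    no-redundancy s s≤ = subst (λ z → z * w ^ t < n) (sym (n≤0⇒n≡0 (m≤n+o⇒m∸n≤o (s ∸ n) 1 (≤-trans (∸-monoˡ-≤ n s≤) (≤-reflexive (m+n∸n≡m 1 n)))))) (≤-trans (s≤s z≤n) n≥)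

    module Many (n> : 2 * A * P < n) where
      q : ℕ
      q = n / S

      2S≤n : 2 * S ≤ n
      2S≤n = ≤-trans (≤-reflexive (sym (*-assoc 2 A P))) (<⇒≤ n>)

      q≥ : 1 ≤ q
      q≥ = m≥n⇒m/n>0 (≤-trans (m≤m+n S (S + 0)) 2S≤n)

      instance
        q≢0 : NonZero q
        q≢0 = >-nonZero q≥

      x r : ℕ
      x = n / q
      r = n % q

      n≡ : n ≡ r + x * q
      n≡ = m≡m%n+[m/n]*n n q

      qS≤n : q * S ≤ n
      qS≤n = m/n*n≤m n S

      S≤x : S ≤ x
      S≤x = ≤-trans (≤-reflexive (sym (m*n/n≡m S q))) (/-monoˡ-≤ q (≤-trans (≤-reflexive (*-comm S q)) qS≤n))

      x<2S : x < 2 * S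
      x<2S = *-cancelʳ-< q x (2 * S) (≤-<-trans (m/n*n≤m n q) (<-≤-trans (≤-<-trans (≤-reflexive (m≡m%n+[m/n]*n n S)) (+-monoˡ-< (q * S) (m%n<n n S)))
        (≤-trans (+-monoˡ-≤ (q * S) (≤-trans (≤-reflexive (sym (*-identityˡ S))) (*-monoˡ-≤ S q≥))) (≤-reflexive (lem q S)))))
        where
        lem : ∀ q S → q * S + q * S ≡ 2 * S * q
        lem = solve-∀

      part≤2S : ∀ i → part x r i ≤ 2 * A * P
      part≤2S i = ≤-trans (part-≤ x r i (2 * S) (<⇒≤ x<2S) (λ _ → x<2S)) (≤-reflexive (sym (*-assoc 2 A P)))

      part≤n : ∀ i → part x r i ≤ n
      part≤n i = ≤-trans (part≤2S i) (<⇒≤ n>)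

      A≤part : ∀ i → A ≤ part x r i
      A≤part i = ≤-trans (≤-trans (m≤m*n A P) S≤x) (part-≥ x r i)

      st : ∀ i → Structure (part x r i) (suc (part x r i)) (3 + h * 5)
      st i = whole w≥1 A>0 (A≤part i) (≤-<-trans (part≤n i) n<) (TR.tree h (part x r i) (A≤part i) (part≤2S i) (≤-<-trans (part≤n i) n<))

      sum≡ : sumTo (part x r) q ≡ n
      sum≡ = part-sum n q x r n≡ (<⇒≤ (m%n<n n q))

      size : ℕ
      size = q * A + sumTo (λ i → suc (part x r i)) q

      size≡ : size ∸ n ≡ q * A + q
      size≡ = trans (cong (_∸ n) (trans (cong (q * A +_) (trans (sumOf-add (λ _ → 1) (part x r) (downFrom q)) (cong₂ _+_ (trans (sumTo-const 1 q) (*-identityʳ q)) sum≡))) (sym (+-assoc (q * A) q n))))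
        (m+n∸n≡m (q * A + q) n)

      -- The A + 1 bits of overhead per block are at most 2A, while a block has at least `A * P`
      -- bits and `P` is at least 2 w^t.
      redundancy : (q * A + q) * w ^ t ≤ n
      redundancy = begin
        (q * A + q) * w ^ t        ≤⟨ *-monoˡ-≤ (w ^ t) (+-monoʳ-≤ (q * A) (m≤m*n q A)) ⟩
        (q * A + q * A) * w ^ t    ≡⟨ lem q A (w ^ t) ⟩
        q * (A * (2 * w ^ t))      ≤⟨ *-monoʳ-≤ q (*-monoʳ-≤ A P-large) ⟩
        q * S                      ≤⟨ qS≤n ⟩
        n                          ∎
        where
        open ≤-Reasoning
        lem : ∀ q A p → (q * A + q * A) * p ≡ q * (A * (2 * p))
        lem = solve-∀

      result : Result
      result = size , lt , structure-weaken cost (Forest.forest q (part x r) q≥ sum≡ (<-≤-trans n< (2^-mono w≤A)) st)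
        where
        pos : 0 < q * A + q
        pos = ≤-trans q≥ (m≤n+m q (q * A))
        lt : ((size ∸ n) ∸ 1) * w ^ t < n
        lt = subst (λ z → (z ∸ 1) * w ^ t < n) (sym size≡) (<-≤-trans (*-monoˡ-< (w ^ t) {{m^n≢0 w t {{>-nonZero w≥1}}}} (∸-monoʳ-< (s≤s z≤n) pos)) redundancy)

    one : Dec (n ≤ 2 * A * P) → A ≤ n → Result
    one (yes p) A≤n = suc n , no-redundancy (suc n) ≤-refl ,
      structure-weaken (≤-trans (n≤1+n _) cost) (whole w≥1 A>0 A≤n n< (TR.tree h n A≤n p n<))
    one (no p) A≤n = Many.result (≰⇒> p)

    cases : Dec (n ≤ A) → Result
    cases (yes p) = n , no-redundancy n (n≤1+n n) , structure-weaken (≤-trans (s≤s z≤n) cost) (small n p)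
    cases (no p) = one (n ≤? 2 * A * P) (<⇒≤ (≰⇒> p))

  result : Result
  result = cases (n ≤? A)

  A≤300w : A ≤ 300 * w
  A≤300w = ≤-reflexive (lem w)
    where
    lem : ∀ w → 150 * w + 150 * w ≡ 300 * w
    lem = solve-∀

  -- A read of A = 300 w bits costs 300 + 1 cell probes.
  rankDS : ∀ {s} → Structure n s (24 * t) → RankDS n w s (24 * 301 * t)
  rankDS {s} st = subst (RankDS n w s) (lem t) (toDS 300 {{>-nonZero w≥1}} A≤300w st)
    where
    lem : ∀ t → 24 * t * 301 ≡ 24 * 301 * t
    lem t = trans (*-assoc 24 t 301) (trans (cong (24 *_) (*-comm t 301)) (sym (*-assoc 24 301 t)))

word-large : ∀ e n w → 2 ^ e ≤ n → n ^ 7 ≤ 2 ^ w → e ≤ w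
word-large e n w h₁ h₂ = 2^-cancel (≤-trans h₁ (≤-trans (m≤m*n n (n ^ 6) {{m^n≢0 n 6 {{>-nonZero (≤-trans (2^>0 e) h₁)}}}}) h₂))

word-covers : ∀ n w → 2 ≤ n → n ^ 7 ≤ 2 ^ w → n < 2 ^ w
word-covers n w h₁ h₂ = <-≤-trans (<-≤-trans (m<m*n n 2 {{>-nonZero (≤-trans (s≤s z≤n) h₁)}} (s≤s (s≤s z≤n)))
  (*-monoʳ-≤ n (≤-trans h₁ (m≤m*n n (n ^ 5) {{m^n≢0 n 5 {{>-nonZero (≤-trans (s≤s z≤n) h₁)}}}})))) h₂

opaque
  -- Arrays of this length force w ≥ 2^12, the bound under which the parameters are chosen.
  threshold : ℕ
  threshold = 2 ^ (2 ^ 12)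

  threshold-≡ : threshold ≡ 2 ^ (2 ^ 12)
  threshold-≡ = refl

-- The constant c is 1/k, and k-th powers clear the root in w^(t/k); the proof takes k = 1. The
-- condition on `n ^ 7` is w ≥ 7 log₂ n, and `C` is the constant of O(t).
theorem1 : Σ ℕ λ k → 1 ≤ k × Σ ℕ λ C → Σ ℕ λ N →
    ∀ (n : ℕ) → N ≤ n → ∀ (t : ℕ) → 1 ≤ t → ∀ (w : ℕ) → n ^ 7 ≤ 2 ^ w →
    Σ ℕ λ s → ((s ∸ n) ∸ 1) ^ k * w ^ t < n ^ k × RankDS n w s (C * t)
theorem1 = 1 , ≤-refl , 24 * 301 , threshold , λ n N≤n t t≥ w h →
  let large = ≤-trans (≤-reflexive (sym threshold-≡)) N≤n
      n≥2 = ≤-trans (2^-mono {1} {2 ^ 12} (2^>0 12)) large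
      module M = Main n w t n≥2 (word-covers n w n≥2 h) (word-large (2 ^ 12) n w large h) t≥
      s , lt , st = M.result
  in s , subst₂ (λ x y → x * w ^ t < y) (sym (^-identityʳ ((s ∸ n) ∸ 1))) (sym (^-identityʳ n)) lt , M.rankDS st
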